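{- For any integers $n\ge2$ and $1\le r\le\log^*n$, every $r$-round probabilistic protocol (with common random source) for $\mathrm{EE}_n$ with error probability at most $1/3$ sends at least one message of size $\Omega(n\log^{(r)}n)$ bits. That is, there is an absolute constant $\delta>0$, independent of $n$ and $r$, such that every such protocol has maximum message size at least $\delta\, n\log^{(r)}n$.
   Context: All logarithms are to base 2. $\log^{(0)}x=x$, $\log^{(r)}x=\log(\log^{(r-1)}x)$; $\log^*x$ is the smallest integer $r$ with $\log^{(r)}x<2$. $[t]=\{1,\dots,t\}$. In the exists-equal problem $\mathrm{EE}_n$ (parameters $n$ and $t=4n$) Alice receives $x\in[t]^n$ and Bob receives $y\in[t]^n$; the value $\mathrm{EE}(x,y)$ is $1$ if there is $i\in[n]$ with $x_i=y_i$, and $0$ otherwise. In an $r$-round protocol the players take at most $r$ turns alternately sending each other a message, and the last player to receive a message declares the output. In a probabilistic protocol the players may base their actions on a common random source; the error probability is the maximum over inputs $(x,y)$ of the probability that the output differs from $\mathrm{EE}(x,y)$. The paper ignores divisibility/rounding issues throughout. -}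

module Defs where

open import Algebra.Definitions.RawSemiring as RawSemiringDefs using ()
open import Data.Bool.Base using (Bool)
open import Data.Fin.Base using (Fin)
import Data.Fin.Properties as Fin
open import Data.Integer.Base using (ℤ; +_; -[1+_])
open import Data.List.Base using (List; []; _∷_; length)
open import Data.List.Relation.Unary.All using (All)
open import Data.Nat.Base as ℕ using (ℕ; zero; suc)
open import Data.Product.Base using (∃; _×_; _,_; proj₁; proj₂)
open import Data.Rational.Base as ℚ using (ℚ; 0ℚ; 1ℚ; ½; ↥_; ↧ₙ_)
open import Data.Sum.Base using (_⊎_; inj₁; inj₂)
open import Data.Vec.Base using (Vec; lookup)
open import Level using (0ℓ)
open import Relation.Binary.PropositionalEquality.Core using (_≡_; _≢_)
open import Relation.Nullary using (¬_)
open import Relation.Nullary.Decidable.Core using (does)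
open import Relation.Unary using (Pred; _∈_; _∉_; _⊆_; _≐_; _⊥_; U; ∁; ⋃)

open RawSemiringDefs ℚ.+-*-rawSemiring using (_^_)

-- Real numbers, as one-sided Dedekind cuts: a real x is represented by
-- the set of all rationals strictly below x.
Cut : Set₁
Cut = Pred ℚ 0ℓ

record IsCut (x : Cut) : Set where
  field
    inhabited : ∃ λ q → q ∈ x
    bounded   : ∃ λ q → q ∉ x
    closed    : ∀ {p q} → p ℚ.≤ q → q ∈ x → p ∈ x
    open′     : ∀ {p} → p ∈ x → ∃ λ q → p ℚ.< q × q ∈ x

infix 4 _≤ᶜ_ _<ᶜ_

_≤ᶜ_ : Cut → Cut → Set
x ≤ᶜ y = x ⊆ y

_<ᶜ_ : Cut → Cut → Set
x <ᶜ y = ∃ λ q → q ∈ y × q ∉ x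

fromℚ : ℚ → Cut
fromℚ r q = q ℚ.< r

ℕ→ℚ : ℕ → ℚ
ℕ→ℚ n = (+ n) ℚ./ 1

fromℕ : ℕ → Cut
fromℕ n = fromℚ (ℕ→ℚ n)

infixl 6 _+ᶜ_

_+ᶜ_ : Cut → Cut → Cut
(x +ᶜ y) q = ∃ λ a → ∃ λ b → a ∈ x × b ∈ y × q ≡ a ℚ.+ b

sumᶜ : ℕ → (ℕ → Cut) → Cut
sumᶜ zero    f = fromℚ 0ℚ
sumᶜ (suc k) f = sumᶜ k f +ᶜ f k

-- The product c x, correct for c > 0 only.
infixr 7 _•_

_•_ : ℚ → Cut → Cut
(c • x) q = ∃ λ p → p ∈ x × q ≡ c ℚ.* p

2^ℤ_ : ℤ → ℚ
2^ℤ (+ k)    = ℕ→ℚ 2 ^ k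
2^ℤ -[1+ k ] = ½ ^ suc k

-- 2^q ≤ s, for s > 0 and q = a/b with b > 0, i.e. 2^a ≤ s^b.
2^_≤_ : ℚ → ℚ → Set
2^ q ≤ s = 2^ℤ (↥ q) ℚ.≤ s ^ ↧ₙ q

-- q < log x iff 2^q < x iff 2^q ≤ s < x for some rational s.  (For
-- x ≤ 0 this set is empty, i.e. log x is -∞.)
log : Cut → Cut
log x q = ∃ λ s → s ∈ x × 0ℚ ℚ.< s × (2^ q ≤ s)

log^ : ℕ → Cut → Cut
log^ zero    x = x
log^ (suc r) x = log (log^ r x)

record IsLog* (x : Cut) (ℓ : ℕ) : Set where
  field
    below-two : log^ ℓ x <ᶜ fromℕ 2
    smallest  : ∀ m → log^ m x <ᶜ fromℕ 2 → ℓ ℕ.≤ m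

-- Fin (4 * n) stands for [4n] = {1,…,4n}.
Input : ℕ → Set
Input n = Vec (Fin (4 ℕ.* n)) n

EE : ∀ {n} → Input n → Input n → Bool
EE x y = does (Fin.any? λ i → lookup x i Fin.≟ lookup y i)

Message : Set
Message = List Bool

-- The behaviour from the point at which the player holding an input
-- in P has just received a message, the other player holds an input in
-- Q, and at most k more messages may be sent.  The receiver either
-- declares the output or answers with a message; both players know the
-- messages sent so far, so the continuation may depend on them.
data Receiver (P Q : Set) : ℕ → Set where
  declare : (P → Bool) → Receiver P Q zero
  respond : ∀ {k} → (P → Bool ⊎ Message) → (Message → Receiver Q P k) →
            Receiver P Q (suc k)

-- At most r turns, and at least one, since the output is declared by a
-- player who has received a message.  Either player may start.
data DetProtocol (X Y : Set) : ℕ → Set where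
  aliceStarts : ∀ {k} → (X → Message) → (Message → Receiver Y X k) →
                DetProtocol X Y (suc k)
  bobStarts   : ∀ {k} → (Y → Message) → (Message → Receiver X Y k) →
                DetProtocol X Y (suc k)

-- The messages sent, in order, and the output.
Run : Set
Run = List Message × Bool

infixr 5 _◃_

_◃_ : Message → Run → Run
m ◃ (ms , b) = m ∷ ms , b

mutual
  runReceiver : ∀ {P Q k} → Receiver P Q k → P → Q → Run
  runReceiver (declare f)   p q = [] , f p
  runReceiver (respond f g) p q = continue (f p) g p q

  continue : ∀ {P Q k} → Bool ⊎ Message → (Message → Receiver Q P k) →
             P → Q → Run
  continue (inj₁ b) g p q = [] , b
  continue (inj₂ m) g p q = m ◃ runReceiver (g m) q p

run : ∀ {X Y r} → DetProtocol X Y r → X → Y → Run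
run (aliceStarts f g) x y = f x ◃ runReceiver (g (f x)) y x
run (bobStarts   f g) x y = f y ◃ runReceiver (g (f y)) x y

messages : ∀ {X Y r} → DetProtocol X Y r → X → Y → List Message
messages π x y = proj₁ (run π x y)

output : ∀ {X Y r} → DetProtocol X Y r → X → Y → Bool
output π x y = proj₂ (run π x y)

-- The value of ℙ on non-measurable events is
-- junk.  Countable additivity says that ℙ of a disjoint union is the
-- supremum of the partial sums; a supremum of cuts is their union.
record RandomSource : Set₂ where
  field
    Ω          : Set
    Measurable : Pred Ω 0ℓ → Set₁
    ℙ          : Pred Ω 0ℓ → Cut

    measurable-resp : ∀ {A B} → A ≐ B → Measurable A → Measurable B
    measurable-U    : Measurable U
    measurable-∁    : ∀ {A} → Measurable A → Measurable (∁ A)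
    measurable-⋃    : ∀ {A : ℕ → Pred Ω 0ℓ} → (∀ i → Measurable (A i)) →
                      Measurable (⋃ ℕ A)

    ℙ-isCut  : ∀ {A} → Measurable A → IsCut (ℙ A)
    ℙ-resp   : ∀ {A B} → Measurable A → A ≐ B → ℙ A ≐ ℙ B
    ℙ-nonneg : ∀ {A} → Measurable A → fromℚ 0ℚ ≤ᶜ ℙ A
    ℙ-U      : ℙ U ≐ fromℚ 1ℚ
    ℙ-⋃      : ∀ {A : ℕ → Pred Ω 0ℓ} → (∀ i → Measurable (A i)) →
               (∀ {i j} → i ≢ j → A i ⊥ A j) →
               ℙ (⋃ ℕ A) ≐ ⋃ ℕ (λ k → sumᶜ k (λ i → ℙ (A i)))

record ProbProtocol (n r : ℕ) : Set₂ where
  field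
    source : RandomSource

  open RandomSource source public

  field
    protocol : Ω → DetProtocol (Input n) (Input n) r
    output-measurable : ∀ x y b →
      Measurable (λ ω → output (protocol ω) x y ≡ b)

  Error : Input n → Input n → Pred Ω 0ℓ
  Error x y ω = output (protocol ω) x y ≢ EE x y

-- The error probability is the maximum of ℙ (Error x y) over x and y.
ErrorAtMost : ∀ {n r} → ProbProtocol n r → ℚ → Set
ErrorAtMost π ε = ∀ x y → ℙ (Error x y) ≤ᶜ fromℚ ε
  where open ProbProtocol π

MessageSizeAtMost : ∀ {n r} → ProbProtocol n r → ℕ → Set
MessageSizeAtMost π b =
  ∀ ω x y → All (λ m → length m ℕ.≤ b) (messages (protocol ω) x y)
  where open ProbProtocol π

{-# OPTIONS --safe #-}

-- Round elimination in which the alphabet is allowed to grow.  Take a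
-- random x and y in Tⁿ, either independent or with x_i = y_i planted at a
-- random coordinate i.  Alice's first message of δnl bits leaves her input
-- a law z of density at most 2^(δnl).  Cut the coordinates into blocks of
-- size B = 2^O(δl) and read each block as one letter of the alphabet T^B.
-- Let X be z with all but one random coordinate of every block replaced by
-- fresh letters.  Given the past, the density of a block of X is the mean
-- of B independent densities, most of which are bounded by 2^O(δl) because
-- the entropy deficiency is small; hence it concentrates around 1, and the
-- block can be coupled with a uniform one at small cost.  Planting an equal
-- block in the n/B-letter problem therefore looks to the remaining rounds
-- like planting one equal coordinate.  The cost is about 2^-k in the k-th
-- round, so it stays bounded over all rounds while n/B shrinks like a tower;
-- after the last round the output is independent of the planting.
--
-- Protocols that only send empty messages (the case of small n) need an
-- argument of their own: they can still stop early, and are handled by the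
-- discrepancy of rectangles.

module Submission where

open import Defs
open import Data.Bool.Base using (Bool; true; false; not; if_then_else_; _xor_)
import Data.Bool.Properties as Bool
open import Data.Empty using (⊥-elim)
open import Data.List.Base as List using (List; []; _∷_; length)
open import Data.List.Relation.Unary.All using (All; []; _∷_)
open import Data.Nat.Base as ℕ using (ℕ; zero; suc)
import Data.Nat.DivMod as ℕ
import Data.Nat.Properties as ℕ
open import Data.Product.Base using (∃; _×_; _,_; proj₁; proj₂)
open import Data.Sum.Base using (_⊎_; inj₁; inj₂; [_,_]′)
open import Data.Unit.Base using (tt)
open import Data.Vec.Base using (Vec; []; _∷_; lookup; take; drop)
open import Function.Base using (id; _∘_)
open import Level using (0ℓ)
open import Relation.Binary.PropositionalEquality
open import Relation.Nullary using (¬_; Dec; does; yes; no; contradiction)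

-- Laws on inputs are finite weighted lists with rational weights, so entropy and standard
-- deviations have no direct counterpart. Relative entropy becomes a sum of truncations `m ⊓ η` over
-- geometrically spaced thresholds η, and the square root of a variance is avoided by y ≤ Λ + y²/Λ.
-- Only one direction is ever compared: a protocol must not accept the planted law noticeably more
-- often than the uniform one. Hence positive parts of densities suffice. Since t = 4n, uniform
-- inputs contain an equal pair with probability at most 1/4. An advantage of at most 1/16 then
-- leaves an error mass of 3/4 - 1/16 out of a total of 2, just above the fraction 1/3. Block
-- lengths are powers of two and must divide the number of coordinates, so planting is confined to a
-- prefix of length 2^s. Coding the decision to stop early adds two bits to each message; this is a
-- constant factor except for empty messages, which is why those are treated apart.

-- Ordered arithmetic of the rationals

module RationalOrder where
  open import Data.Integer.Base as ℤ using (+_)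
  import Data.Integer.Properties as ℤ
  open import Data.Rational.Base
  open import Data.Rational.Properties
  open import Relation.Nullary.Decidable using (dec⇒maybe)
  open import Tactic.RingSolver.Core.AlmostCommutativeRing using (AlmostCommutativeRing; fromCommutativeRing)
  open import Tactic.RingSolver using (solve-∀)
  import Data.Nat.Coprimality as Coprimality

  ring : AlmostCommutativeRing 0ℓ 0ℓ
  ring = fromCommutativeRing +-*-commutativeRing (λ x → dec⇒maybe (0ℚ ≟ x))

  2ℚ : ℚ
  2ℚ = 1ℚ + 1ℚ

  ≤-slack : ∀ {a b} d → 0ℚ ≤ d → a + d ≡ b → a ≤ b
  ≤-slack {a} d 0≤d refl = subst (_≤ a + d) (+-identityʳ a) (+-monoʳ-≤ a 0≤d)

  0≤1 : 0ℚ ≤ 1ℚ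
  0≤1 = nonNegative⁻¹ 1ℚ

  0≤+ : ∀ {a b} → 0ℚ ≤ a → 0ℚ ≤ b → 0ℚ ≤ a + b
  0≤+ = +-mono-≤

  *-monoˡ-≤ : ∀ {a b} c → 0ℚ ≤ c → a ≤ b → c * a ≤ c * b
  *-monoˡ-≤ c 0≤c = *-monoˡ-≤-nonNeg c {{nonNegative 0≤c}}

  *-monoʳ-≤ : ∀ {a b} c → 0ℚ ≤ c → a ≤ b → a * c ≤ b * c
  *-monoʳ-≤ c 0≤c = *-monoʳ-≤-nonNeg c {{nonNegative 0≤c}}

  0≤* : ∀ {a b} → 0ℚ ≤ a → 0ℚ ≤ b → 0ℚ ≤ a * b
  0≤* {a} {b} 0≤a 0≤b = subst (_≤ a * b) (*-zeroʳ a) (*-monoˡ-≤ a 0≤a 0≤b)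

  *-mono-≤ : ∀ {a b c d} → 0ℚ ≤ a → 0ℚ ≤ d → a ≤ b → c ≤ d → a * c ≤ b * d
  *-mono-≤ {a} {b} {c} {d} 0≤a 0≤d a≤b c≤d =
    ≤-trans (*-monoˡ-≤ a 0≤a c≤d) (*-monoʳ-≤ d 0≤d a≤b)

  *-≤1ˡ : ∀ {a b} → 0ℚ ≤ b → a ≤ 1ℚ → a * b ≤ b
  *-≤1ˡ {a} {b} 0≤b a≤1 = subst (a * b ≤_) (*-identityˡ b) (*-monoʳ-≤ b 0≤b a≤1)

  a≤b⇒0≤b-a : ∀ {a b} → a ≤ b → 0ℚ ≤ b - a
  a≤b⇒0≤b-a {a} {b} a≤b = subst (_≤ b - a) (+-inverseʳ a) (+-monoˡ-≤ (- a) a≤b)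

  0≤b-a⇒a≤b : ∀ {a b} → 0ℚ ≤ b - a → a ≤ b
  0≤b-a⇒a≤b {a} {b} 0≤b-a = ≤-slack (b - a) 0≤b-a (eq a b)
    where
    eq : ∀ x y → x + (y - x) ≡ y
    eq = solve-∀ ring

  0≤square : ∀ a → 0ℚ ≤ a * a
  0≤square a with ≤-total 0ℚ a
  ... | inj₁ 0≤a = 0≤* 0≤a 0≤a
  ... | inj₂ a≤0 = subst (0ℚ ≤_) (eq a) (0≤* (neg-antimono-≤ a≤0) (neg-antimono-≤ a≤0))
    where
    eq : ∀ x → - x * - x ≡ x * x
    eq = solve-∀ ring

  posPart : ℚ → ℚ
  posPart a = a ⊔ 0ℚ

  0≤pos : ∀ a → 0ℚ ≤ posPart a
  0≤pos a = p≤q⊔p a 0ℚ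

  ≤pos : ∀ a → a ≤ posPart a
  ≤pos a = p≤p⊔q a 0ℚ

  pos-lub : ∀ {a b} → a ≤ b → 0ℚ ≤ b → posPart a ≤ b
  pos-lub = ⊔-lub

  ⊓+pos : ∀ a r → (a ⊓ r) + posPart (a - r) ≡ a
  ⊓+pos a r with ≤-total a r
  ... | inj₁ a≤r = trans (cong₂ _+_ (p≤q⇒p⊓q≡p a≤r) (p≤q⇒p⊔q≡q a-r≤0)) (+-identityʳ a)
    where
    eq : ∀ a r → (a - r) + (r - a) ≡ 0ℚ
    eq = solve-∀ ring
    a-r≤0 : a - r ≤ 0ℚ
    a-r≤0 = ≤-slack (r - a) (a≤b⇒0≤b-a a≤r) (eq a r)
  ... | inj₂ r≤a = trans (cong₂ _+_ (p≥q⇒p⊓q≡q r≤a) (p≥q⇒p⊔q≡p (a≤b⇒0≤b-a r≤a))) (eq a r)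
    where
    eq : ∀ a r → r + (a - r) ≡ a
    eq = solve-∀ ring

  ℕ→ℚ-mkℚ : ∀ n → ℕ→ℚ n ≡ mkℚ (+ n) 0 (Coprimality.sym (Coprimality.1-coprimeTo n))
  ℕ→ℚ-mkℚ n = normalize-coprime (Coprimality.sym (Coprimality.1-coprimeTo n))

  ℕ→ℚ-+ : ∀ m n → ℕ→ℚ (m ℕ.+ n) ≡ ℕ→ℚ m + ℕ→ℚ n
  ℕ→ℚ-+ m n rewrite ℕ→ℚ-mkℚ m | ℕ→ℚ-mkℚ n =
    cong (_/ 1) (sym (trans (cong₂ ℤ._+_ (ℤ.*-identityʳ (+ m)) (ℤ.*-identityʳ (+ n))) refl))

  ℕ→ℚ-* : ∀ m n → ℕ→ℚ (m ℕ.* n) ≡ ℕ→ℚ m * ℕ→ℚ n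
  ℕ→ℚ-* m n rewrite ℕ→ℚ-mkℚ m | ℕ→ℚ-mkℚ n = cong (_/ 1) (ℤ.pos-* m n)

  ℕ→ℚ-mono : ∀ {m n} → m ℕ.≤ n → ℕ→ℚ m ≤ ℕ→ℚ n
  ℕ→ℚ-mono {m} {n} m≤n rewrite ℕ→ℚ-mkℚ m | ℕ→ℚ-mkℚ n =
    *≤* (subst₂ ℤ._≤_ (sym (ℤ.*-identityʳ (+ m))) (sym (ℤ.*-identityʳ (+ n))) (ℤ.+≤+ m≤n))

  ℕ→ℚ-cancel-< : ∀ {m n} → ℕ→ℚ m < ℕ→ℚ n → m ℕ.< n
  ℕ→ℚ-cancel-< {m} {n} m<n with m ℕ.<? n
  ... | yes p = p
  ... | no ¬p = contradiction (<-≤-trans m<n (ℕ→ℚ-mono (ℕ.≮⇒≥ ¬p))) (<-irrefl refl)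

  ℕ→ℚ-cancel-≤ : ∀ {m n} → ℕ→ℚ m ≤ ℕ→ℚ n → m ℕ.≤ n
  ℕ→ℚ-cancel-≤ {m} {n} m≤n rewrite ℕ→ℚ-mkℚ m | ℕ→ℚ-mkℚ n =
    ℤ.drop‿+≤+ (subst₂ ℤ._≤_ (ℤ.*-identityʳ (+ m)) (ℤ.*-identityʳ (+ n)) (drop-*≤* m≤n))

  ℕ→ℚ-suc : ∀ n → ℕ→ℚ (suc n) ≡ 1ℚ + ℕ→ℚ n
  ℕ→ℚ-suc = ℕ→ℚ-+ 1

  0≤ℕ→ℚ : ∀ n → 0ℚ ≤ ℕ→ℚ n
  0≤ℕ→ℚ n = ℕ→ℚ-mono {0} {n} ℕ.z≤n

  half^ : ℕ → ℚ
  half^ zero    = 1ℚ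
  half^ (suc k) = ½ * half^ k

  0<half^ : ∀ k → 0ℚ < half^ k
  0<half^ zero    = positive⁻¹ 1ℚ
  0<half^ (suc k) = subst (_< ½ * half^ k) (*-zeroʳ ½) (*-monoʳ-<-pos ½ (0<half^ k))

  0≤half^ : ∀ k → 0ℚ ≤ half^ k
  0≤half^ k = <⇒≤ (0<half^ k)

  half^-inverse : ∀ k → half^ k * ℕ→ℚ (2 ℕ.^ k) ≡ 1ℚ
  half^-inverse zero    = refl
  half^-inverse (suc k) = begin
    ½ * half^ k * ℕ→ℚ (2 ℕ.* 2 ℕ.^ k)       ≡⟨ cong (½ * half^ k *_) (ℕ→ℚ-* 2 (2 ℕ.^ k)) ⟩
    ½ * half^ k * (ℕ→ℚ 2 * ℕ→ℚ (2 ℕ.^ k))   ≡⟨ eq ½ (half^ k) (ℕ→ℚ 2) (ℕ→ℚ (2 ℕ.^ k)) ⟩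
    ½ * ℕ→ℚ 2 * (half^ k * ℕ→ℚ (2 ℕ.^ k))   ≡⟨ cong (½ * ℕ→ℚ 2 *_) (half^-inverse k) ⟩
    1ℚ                                       ∎
    where
    open ≡-Reasoning
    eq : ∀ a b c d → a * b * (c * d) ≡ a * c * (b * d)
    eq = solve-∀ ring

-- Integration over finite weighted lists

module Integral where
  open import Data.Rational.Base
  open import Data.Rational.Properties
  open import Tactic.RingSolver using (solve-∀)
  open RationalOrder

  private
    variable
      A B C : Set

  -- A list rather than a function on `A`: sums are finite without `A` being finite or having
  -- decidable equality, and a point may be listed repeatedly, its weights adding up.
  Measure : Set → Set
  Measure A = List (ℚ × A)

  ∫ : Measure A → (A → ℚ) → ℚ
  ∫ []            f = 0ℚ
  ∫ ((w , a) ∷ μ) f = w * f a + ∫ μ f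

  Nonneg : Measure A → Set
  Nonneg = All (λ wa → 0ℚ ≤ proj₁ wa)

  ∫-cong : ∀ (μ : Measure A) {f g} → (∀ a → f a ≡ g a) → ∫ μ f ≡ ∫ μ g
  ∫-cong []            h = refl
  ∫-cong ((w , a) ∷ μ) h = cong₂ _+_ (cong (w *_) (h a)) (∫-cong μ h)

  ∫-+ : ∀ (μ : Measure A) f g → ∫ μ (λ a → f a + g a) ≡ ∫ μ f + ∫ μ g
  ∫-+ []            f g = refl
  ∫-+ ((w , a) ∷ μ) f g = trans (cong (w * (f a + g a) +_) (∫-+ μ f g)) (eq w (f a) (g a) (∫ μ f) (∫ μ g))
    where
    eq : ∀ w x y s t → w * (x + y) + (s + t) ≡ (w * x + s) + (w * y + t)
    eq = solve-∀ ring

  ∫-*ˡ : ∀ (μ : Measure A) c f → ∫ μ (λ a → c * f a) ≡ c * ∫ μ f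
  ∫-*ˡ []            c f = sym (*-zeroʳ c)
  ∫-*ˡ ((w , a) ∷ μ) c f = trans (cong (w * (c * f a) +_) (∫-*ˡ μ c f)) (eq w c (f a) (∫ μ f))
    where
    eq : ∀ w c x s → w * (c * x) + c * s ≡ c * (w * x + s)
    eq = solve-∀ ring

  ∫-*ʳ : ∀ (μ : Measure A) f c → ∫ μ (λ a → f a * c) ≡ ∫ μ f * c
  ∫-*ʳ μ f c = trans (∫-cong μ (λ a → *-comm (f a) c)) (trans (∫-*ˡ μ c f) (*-comm c (∫ μ f)))

  ∫-- : ∀ (μ : Measure A) f g → ∫ μ (λ a → f a - g a) ≡ ∫ μ f - ∫ μ g
  ∫-- μ f g = trans (∫-+ μ f (λ a → - g a)) (cong (_+_ (∫ μ f)) negated)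
    where
    eq : ∀ x → - x ≡ - 1ℚ * x
    eq = solve-∀ ring
    negated : ∫ μ (λ a → - g a) ≡ - ∫ μ g
    negated = trans (∫-cong μ (λ a → eq (g a))) (trans (∫-*ˡ μ (- 1ℚ) g) (sym (eq (∫ μ g))))

  ∫-0 : ∀ (μ : Measure A) → ∫ μ (λ _ → 0ℚ) ≡ 0ℚ
  ∫-0 []            = refl
  ∫-0 ((w , a) ∷ μ) = trans (cong₂ _+_ (*-zeroʳ w) (∫-0 μ)) refl

  ∫-const : ∀ (μ : Measure A) c → ∫ μ (λ _ → c) ≡ c * ∫ μ (λ _ → 1ℚ)
  ∫-const μ c = trans (∫-cong μ (λ _ → sym (*-identityʳ c))) (∫-*ˡ μ c (λ _ → 1ℚ))

  ∫-swap : ∀ (μ : Measure A) (ν : Measure B) (f : A → B → ℚ) →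
           ∫ μ (λ a → ∫ ν (λ b → f a b)) ≡ ∫ ν (λ b → ∫ μ (λ a → f a b))
  ∫-swap []            ν f = sym (∫-0 ν)
  ∫-swap ((w , a) ∷ μ) ν f = begin
    w * ∫ ν (f a) + ∫ μ (λ a → ∫ ν (f a))
      ≡⟨ cong₂ _+_ (sym (∫-*ˡ ν w (f a))) (∫-swap μ ν f) ⟩
    ∫ ν (λ b → w * f a b) + ∫ ν (λ b → ∫ μ (λ a → f a b))
      ≡⟨ ∫-+ ν _ _ ⟨
    ∫ ν (λ b → w * f a b + ∫ μ (λ a → f a b)) ∎
    where open ≡-Reasoning

  ∫-mono : ∀ {μ : Measure A} → Nonneg μ → ∀ {f g} → (∀ a → f a ≤ g a) → ∫ μ f ≤ ∫ μ g
  ∫-mono []                        h = ≤-refl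
  ∫-mono {μ = (w , a) ∷ μ} (p ∷ ps) h = +-mono-≤ (*-monoˡ-≤ w p (h a)) (∫-mono ps h)

  ∫-nonneg : ∀ {μ : Measure A} → Nonneg μ → ∀ {f} → (∀ a → 0ℚ ≤ f a) → 0ℚ ≤ ∫ μ f
  ∫-nonneg {μ = μ} p {f} h = subst (_≤ ∫ μ f) (∫-0 μ) (∫-mono p h)

  record Probability (μ : Measure A) : Set where
    field
      weights≥0 : Nonneg μ
      total    : ∫ μ (λ _ → 1ℚ) ≡ 1ℚ

    average-const : ∀ c → ∫ μ (λ _ → c) ≡ c
    average-const c = trans (∫-const μ c) (trans (cong (c *_) total) (*-identityʳ c))

    average-mono : ∀ {f g} → (∀ a → f a ≤ g a) → ∫ μ f ≤ ∫ μ g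
    average-mono = ∫-mono weights≥0

    average-nonneg : ∀ {f} → (∀ a → 0ℚ ≤ f a) → 0ℚ ≤ ∫ μ f
    average-nonneg = ∫-nonneg weights≥0

    average-≤ : ∀ {f} c → (∀ a → f a ≤ c) → ∫ μ f ≤ c
    average-≤ {f} c h = subst (∫ μ f ≤_) (average-const c) (average-mono h)

  open Probability public

  pushforward : (A → B) → Measure A → Measure B
  pushforward φ = List.map (λ (w , a) → w , φ a)

  ∫-pushforward : ∀ (φ : A → B) μ f → ∫ (pushforward φ μ) f ≡ ∫ μ (λ a → f (φ a))
  ∫-pushforward φ []            f = refl
  ∫-pushforward φ ((w , a) ∷ μ) f = cong (w * f (φ a) +_) (∫-pushforward φ μ f)

  pushforward-nonneg : ∀ (φ : A → B) {μ} → Nonneg μ → Nonneg (pushforward φ μ)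
  pushforward-nonneg φ []       = []
  pushforward-nonneg φ (p ∷ ps) = p ∷ pushforward-nonneg φ ps

  infixr 6 _▹_

  -- The measure of density `h` with respect to `μ`.
  _▹_ : (A → ℚ) → Measure A → Measure A
  h ▹ μ = List.map (λ (w , a) → w * h a , a) μ

  ∫-▹ : ∀ (h : A → ℚ) μ f → ∫ (h ▹ μ) f ≡ ∫ μ (λ a → h a * f a)
  ∫-▹ h []            f = refl
  ∫-▹ h ((w , a) ∷ μ) f = cong₂ _+_ (*-assoc w (h a) (f a)) (∫-▹ h μ f)

  ▹-nonneg : ∀ {h : A → ℚ} → (∀ a → 0ℚ ≤ h a) → ∀ {μ} → Nonneg μ → Nonneg (h ▹ μ)
  ▹-nonneg 0≤h []                     = []
  ▹-nonneg 0≤h {(w , a) ∷ μ} (p ∷ ps) = 0≤* p (0≤h a) ∷ ▹-nonneg 0≤h ps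

  infixr 5 _⊗_

  _⊗_ : Measure A → Measure B → Measure (A × B)
  []            ⊗ ν = []
  ((w , a) ∷ μ) ⊗ ν = List.map (λ (v , b) → w * v , (a , b)) ν List.++ (μ ⊗ ν)

  ∫-++ : ∀ (μ ν : Measure A) f → ∫ (μ List.++ ν) f ≡ ∫ μ f + ∫ ν f
  ∫-++ []            ν f = sym (+-identityˡ _)
  ∫-++ ((w , a) ∷ μ) ν f = trans (cong (w * f a +_) (∫-++ μ ν f)) (sym (+-assoc (w * f a) (∫ μ f) (∫ ν f)))

  ∫-⊗ : ∀ (μ : Measure A) (ν : Measure B) (f : A × B → ℚ) →
        ∫ (μ ⊗ ν) f ≡ ∫ μ (λ a → ∫ ν (λ b → f (a , b)))
  ∫-⊗ []            ν f = refl
  ∫-⊗ ((w , a) ∷ μ) ν f =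
    trans (∫-++ (List.map _ ν) (μ ⊗ ν) f) (cong₂ _+_ (scaled ν) (∫-⊗ μ ν f))
    where
    scaled : ∀ ν → ∫ (List.map (λ (v , b) → w * v , (a , b)) ν) f ≡ w * ∫ ν (λ b → f (a , b))
    scaled []            = sym (*-zeroʳ w)
    scaled ((v , b) ∷ ν) = trans (cong (w * v * f (a , b) +_) (scaled ν)) (eq w v (f (a , b)) _)
      where
      eq : ∀ w v x s → w * v * x + w * s ≡ w * (v * x + s)
      eq = solve-∀ ring

  ++-nonneg : ∀ {μ ν : Measure A} → Nonneg μ → Nonneg ν → Nonneg (μ List.++ ν)
  ++-nonneg []       qs = qs
  ++-nonneg (p ∷ ps) qs = p ∷ ++-nonneg ps qs

  ⊗-nonneg : ∀ {μ : Measure A} {ν : Measure B} → Nonneg μ → Nonneg ν → Nonneg (μ ⊗ ν)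
  ⊗-nonneg []                     qs = []
  ⊗-nonneg {μ = (w , a) ∷ μ} (p ∷ ps) qs = ++-nonneg (scaled qs) (⊗-nonneg ps qs)
    where
    scaled : ∀ {ν} → Nonneg ν → Nonneg (List.map (λ (v , b) → w * v , (a , b)) ν)
    scaled []       = []
    scaled (q ∷ qs) = 0≤* p q ∷ scaled qs

  ∫∫-swap-nested : ∀ (μ : Measure A) (ν : Measure B) (ρ : Measure C) (f : A → B → C → ℚ) →
                   ∫ μ (λ a → ∫ ν (λ b → ∫ ρ (λ c → f a b c))) ≡
                   ∫ ρ (λ c → ∫ μ (λ a → ∫ ν (λ b → f a b c)))
  ∫∫-swap-nested μ ν ρ f =
    trans (∫-cong μ (λ a → ∫-swap ν ρ (f a))) (∫-swap μ ρ (λ a c → ∫ ν (λ b → f a b c)))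

-- Alphabets, their powers, and the density of a planted agreement

module Alphabets where
  open import Data.Rational.Base
  open import Data.Rational.Properties
  open RationalOrder
  open Integral

  -- δ is the density of equality: t times the indicator of a ≡ b on a
  -- t-element alphabet with the uniform measure.
  record Alphabet : Set₁ where
    field
      Symbol  : Set
      uniform : Measure Symbol
      prob    : Probability uniform
      δ       : Symbol → Symbol → ℚ
      δ≥0     : ∀ a b → 0ℚ ≤ δ a b
      δ-sym   : ∀ a b → δ a b ≡ δ b a
      δ-sift  : ∀ (g : Symbol → ℚ) b → ∫ uniform (λ a → δ a b * g a) ≡ g b

    δ-siftˡ : ∀ (g : Symbol → ℚ) b → ∫ uniform (λ a → δ b a * g a) ≡ g b
    δ-siftˡ g b = trans (∫-cong uniform (λ a → cong (_* g a) (δ-sym b a))) (δ-sift g b)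

    δ-total : ∀ b → ∫ uniform (λ a → δ a b) ≡ 1ℚ
    δ-total b = trans (∫-cong uniform (λ a → sym (*-identityʳ (δ a b)))) (δ-sift (λ _ → 1ℚ) b)

  open Alphabet public

  module _ (𝓐 : Alphabet) where

    uniform-words : ∀ n → Measure (Vec (Symbol 𝓐) n)
    uniform-words zero    = (1ℚ , []) ∷ []
    uniform-words (suc n) = pushforward (λ (a , v) → a ∷ v) (uniform 𝓐 ⊗ uniform-words n)

    ∫-[] : ∀ (f : Vec (Symbol 𝓐) 0 → ℚ) → ∫ (uniform-words 0) f ≡ f []
    ∫-[] f = trans (+-identityʳ _) (*-identityˡ (f []))

    ∫-∷ : ∀ n (f : Vec (Symbol 𝓐) (suc n) → ℚ) → ∫ (uniform-words (suc n)) f ≡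
          ∫ (uniform 𝓐) (λ a → ∫ (uniform-words n) (λ v → f (a ∷ v)))
    ∫-∷ n f = trans (∫-pushforward (λ (a , v) → a ∷ v) (uniform 𝓐 ⊗ uniform-words n) f)
                    (∫-⊗ (uniform 𝓐) (uniform-words n) (λ (a , v) → f (a ∷ v)))

    words-prob : ∀ n → Probability (uniform-words n)
    words-prob zero    = record { weights≥0 = 0≤1 ∷ [] ; total = refl }
    words-prob (suc n) = record
      { weights≥0 = pushforward-nonneg _ (⊗-nonneg (weights≥0 (prob 𝓐)) (weights≥0 (words-prob n)))
      ; total     = trans (∫-∷ n (λ _ → 1ℚ))
                          (trans (∫-cong (uniform 𝓐) (λ _ → total (words-prob n))) (total (prob 𝓐)))
      }

    δ-words : ∀ {n} → Vec (Symbol 𝓐) n → Vec (Symbol 𝓐) n → ℚ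
    δ-words []      []      = 1ℚ
    δ-words (a ∷ x) (b ∷ y) = δ 𝓐 a b * δ-words x y

    δ-words≥0 : ∀ {n} (x y : Vec (Symbol 𝓐) n) → 0ℚ ≤ δ-words x y
    δ-words≥0 []      []      = 0≤1
    δ-words≥0 (a ∷ x) (b ∷ y) = 0≤* (δ≥0 𝓐 a b) (δ-words≥0 x y)

    δ-words-sym : ∀ {n} (x y : Vec (Symbol 𝓐) n) → δ-words x y ≡ δ-words y x
    δ-words-sym []      []      = refl
    δ-words-sym (a ∷ x) (b ∷ y) = cong₂ _*_ (δ-sym 𝓐 a b) (δ-words-sym x y)

    δ-words-sift : ∀ n (g : Vec (Symbol 𝓐) n → ℚ) (y : Vec (Symbol 𝓐) n) →
                   ∫ (uniform-words n) (λ x → δ-words x y * g x) ≡ g y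
    δ-words-sift zero    g []      = trans (∫-[] (λ x → δ-words x [] * g x)) (*-identityˡ (g []))
    δ-words-sift (suc n) g (b ∷ y) = begin
      ∫ (uniform-words (suc n)) (λ x → δ-words x (b ∷ y) * g x)
        ≡⟨ ∫-∷ n _ ⟩
      ∫ (uniform 𝓐) (λ a → ∫ (uniform-words n) (λ x → δ 𝓐 a b * δ-words x y * g (a ∷ x)))
        ≡⟨ ∫-cong (uniform 𝓐) (λ a → trans
             (∫-cong (uniform-words n) (λ x → *-assoc (δ 𝓐 a b) (δ-words x y) (g (a ∷ x))))
             (trans (∫-*ˡ (uniform-words n) (δ 𝓐 a b) _)
                    (cong (δ 𝓐 a b *_) (δ-words-sift n (λ x → g (a ∷ x)) y)))) ⟩
      ∫ (uniform 𝓐) (λ a → δ 𝓐 a b * g (a ∷ y))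
        ≡⟨ δ-sift 𝓐 (λ a → g (a ∷ y)) b ⟩
      g (b ∷ y) ∎
      where open ≡-Reasoning

  -- Densities of equality multiply, so words are letters of a new alphabet. This closure lets a
  -- round of elimination read blocks as letters and repeat.
  power : Alphabet → ℕ → Alphabet
  power 𝓐 n = record
    { Symbol  = Vec (Symbol 𝓐) n
    ; uniform = uniform-words 𝓐 n
    ; prob    = words-prob 𝓐 n
    ; δ       = δ-words 𝓐
    ; δ≥0     = δ-words≥0 𝓐
    ; δ-sym   = δ-words-sym 𝓐
    ; δ-sift  = δ-words-sift 𝓐 n
    }

  module _ (𝓐 : Alphabet) where

    -- Divided by n this is the density, against two independent uniform words, of the law that
    -- makes them equal at one random coordinate.
    agree : ∀ {n} → Vec (Symbol 𝓐) n → Vec (Symbol 𝓐) n → ℚ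
    agree []      []      = 0ℚ
    agree (a ∷ x) (b ∷ y) = δ 𝓐 a b + agree x y

    agree≥0 : ∀ {n} (x y : Vec (Symbol 𝓐) n) → 0ℚ ≤ agree x y
    agree≥0 []      []      = ≤-refl
    agree≥0 (a ∷ x) (b ∷ y) = 0≤+ (δ≥0 𝓐 a b) (agree≥0 x y)

    agree-sym : ∀ {n} (x y : Vec (Symbol 𝓐) n) → agree x y ≡ agree y x
    agree-sym []      []      = refl
    agree-sym (a ∷ x) (b ∷ y) = cong₂ _+_ (δ-sym 𝓐 a b) (agree-sym x y)

    ∫-∷-+ : ∀ n (f : Symbol 𝓐 → ℚ) (g : Vec (Symbol 𝓐) n → ℚ) (h : Vec (Symbol 𝓐) (suc n) → ℚ) →
            (∀ a x → h (a ∷ x) ≡ f a + g x) →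
            ∫ (uniform-words 𝓐 (suc n)) h ≡ ∫ (uniform 𝓐) f + ∫ (uniform-words 𝓐 n) g
    ∫-∷-+ n f g h eq = begin
      ∫ (uniform-words 𝓐 (suc n)) h
        ≡⟨ ∫-∷ 𝓐 n h ⟩
      ∫ (uniform 𝓐) (λ a → ∫ (uniform-words 𝓐 n) (λ x → h (a ∷ x)))
        ≡⟨ ∫-cong (uniform 𝓐) (λ a → trans (∫-cong (uniform-words 𝓐 n) (eq a))
             (trans (∫-+ (uniform-words 𝓐 n) (λ _ → f a) g)
                    (cong (_+ ∫ (uniform-words 𝓐 n) g) (average-const (words-prob 𝓐 n) (f a))))) ⟩
      ∫ (uniform 𝓐) (λ a → f a + ∫ (uniform-words 𝓐 n) g)
        ≡⟨ trans (∫-+ (uniform 𝓐) f _) (cong (∫ (uniform 𝓐) f +_) (average-const (prob 𝓐) _)) ⟩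
      ∫ (uniform 𝓐) f + ∫ (uniform-words 𝓐 n) g ∎
      where open ≡-Reasoning

    agree-average : ∀ n (y : Vec (Symbol 𝓐) n) →
                    ∫ (uniform-words 𝓐 n) (λ x → agree x y) ≡ ℕ→ℚ n
    agree-average zero    []      = ∫-[] 𝓐 (λ x → agree x [])
    agree-average (suc n) (b ∷ y) = begin
      ∫ (uniform-words 𝓐 (suc n)) (λ x → agree x (b ∷ y))
        ≡⟨ ∫-∷-+ n (λ a → δ 𝓐 a b) (λ x → agree x y) _ (λ _ _ → refl) ⟩
      ∫ (uniform 𝓐) (λ a → δ 𝓐 a b) + ∫ (uniform-words 𝓐 n) (λ x → agree x y)
        ≡⟨ cong₂ _+_ (δ-total 𝓐 b) (agree-average n y) ⟩
      1ℚ + ℕ→ℚ n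
        ≡⟨ ℕ→ℚ-suc n ⟨
      ℕ→ℚ (suc n) ∎
      where open ≡-Reasoning

-- Large marginals of a bounded density, controlled by a potential

module Overflow where
  open import Data.Rational.Base
  open import Data.Rational.Properties
  open import Tactic.RingSolver using (solve-∀)
  open RationalOrder
  open Integral
  open Alphabets

  posPart-jensen : ∀ {A : Set} {ν : Measure A} → Nonneg ν → ∀ f →
                   posPart (∫ ν f) ≤ ∫ ν (λ w → posPart (f w))
  posPart-jensen ν≥0 f = pos-lub (∫-mono ν≥0 (λ w → ≤pos (f w))) (∫-nonneg ν≥0 (λ w → 0≤pos (f w)))

  ⊓-jensen : ∀ {A : Set} {ν : Measure A} → Probability ν → ∀ f η →
             ∫ ν (λ w → f w ⊓ η) ≤ ∫ ν f ⊓ η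
  ⊓-jensen P f η = ⊓-glb (average-mono P (λ w → p⊓q≤p (f w) η)) (average-≤ P η (λ w → p⊓q≤q (f w) η))

  -- In terms of the marginals fᵢ of a density F on words, overflow F r is
  -- the sum over i of the averages of (fᵢ − r)⁺.
  module _ (𝓐 : Alphabet) where
    private
      T = Symbol 𝓐
      τ = uniform 𝓐
      W = uniform-words 𝓐

    overflow : ∀ n → (Vec T n → ℚ) → ℚ → ℚ
    overflow zero    F r = 0ℚ
    overflow (suc n) F r =
      ∫ τ (λ a → posPart (∫ (W n) (λ x → F (a ∷ x)) - r)) +
      overflow n (λ x → ∫ τ (λ a → F (a ∷ x))) r

    overflow-cong : ∀ n {F G r s} → (∀ x → F x ≡ G x) → r ≡ s → overflow n F r ≡ overflow n G s
    overflow-cong zero    F≗G r≡s = refl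
    overflow-cong (suc n) F≗G refl = cong₂ _+_
      (∫-cong τ (λ a → cong (λ f → posPart (f - _)) (∫-cong (W n) (λ x → F≗G (a ∷ x)))))
      (overflow-cong n (λ x → ∫-cong τ (λ a → F≗G (a ∷ x))) refl)

    -- Convexity, jointly in the density and the level, inherited from `posPart` in each coordinate.
    -- By homogeneity the weights need not have total one, so reweighted measures are allowed.
    overflow-mixture : ∀ n {A : Set} {ν : Measure A} → Nonneg ν → (F : A → Vec T n → ℚ) (r : A → ℚ) →
      overflow n (λ x → ∫ ν (λ w → F w x)) (∫ ν r) ≤ ∫ ν (λ w → overflow n (F w) (r w))
    overflow-mixture zero    {ν = ν} ν≥0 F r = ≤-reflexive (sym (∫-0 ν))
    overflow-mixture (suc n) {ν = ν} ν≥0 F r = begin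
      ∫ τ (λ a → posPart (∫ (W n) (λ x → ∫ ν (λ w → F w (a ∷ x))) - ∫ ν r)) +
      overflow n (λ x → ∫ τ (λ a → ∫ ν (λ w → F w (a ∷ x)))) (∫ ν r)
        ≡⟨ cong₂ _+_
             (∫-cong τ (λ a → cong posPart (trans
               (cong (_- ∫ ν r) (∫-swap (W n) ν (λ x w → F w (a ∷ x))))
               (sym (∫-- ν _ r)))))
             (overflow-cong n (λ x → ∫-swap τ ν (λ a w → F w (a ∷ x))) refl) ⟩
      ∫ τ (λ a → posPart (∫ ν (λ w → ∫ (W n) (λ x → F w (a ∷ x)) - r w))) +
      overflow n (λ x → ∫ ν (λ w → ∫ τ (λ a → F w (a ∷ x)))) (∫ ν r)
        ≤⟨ +-mono-≤ (average-mono (prob 𝓐) (λ a → posPart-jensen ν≥0 _))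
                    (overflow-mixture n ν≥0 (λ w x → ∫ τ (λ a → F w (a ∷ x))) r) ⟩
      ∫ τ (λ a → ∫ ν (λ w → posPart (∫ (W n) (λ x → F w (a ∷ x)) - r w))) +
      ∫ ν (λ w → overflow n (λ x → ∫ τ (λ a → F w (a ∷ x))) (r w))
        ≡⟨ cong (_+ ∫ ν (λ w → overflow n (λ x → ∫ τ (λ a → F w (a ∷ x))) (r w)))
             (∫-swap τ ν (λ a w → posPart (∫ (W n) (λ x → F w (a ∷ x)) - r w))) ⟩
      ∫ ν (λ w → ∫ τ (λ a → posPart (∫ (W n) (λ x → F w (a ∷ x)) - r w))) +
      ∫ ν (λ w → overflow n (λ x → ∫ τ (λ a → F w (a ∷ x))) (r w))
        ≡⟨ ∫-+ ν _ _ ⟨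
      ∫ ν (λ w → overflow (suc n) (F w) (r w)) ∎
      where open ≤-Reasoning

    marginal-average : ∀ n (F : Vec T (suc n) → ℚ) →
      ∫ (W n) (λ x → ∫ τ (λ a → F (a ∷ x))) ≡ ∫ (W (suc n)) F
    marginal-average n F = trans (∫-swap (W n) τ (λ x a → F (a ∷ x))) (sym (∫-∷ 𝓐 n F))

  -- The overflow at level R is charged to the decrease of a concave
  -- potential, a discretised relative entropy: if θ ≤ v ≤ θRᵈ for the
  -- average v, then one of the thresholds θ, θR, …, θRᵈ lies in [v, Rv].
  module _ (R : ℚ) (1≤R : 1ℚ ≤ R) (θ : ℚ) (0≤θ : 0ℚ ≤ θ) where
    private
      0≤R : 0ℚ ≤ R
      0≤R = ≤-trans 0≤1 1≤R

    threshold : ℕ → ℚ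
    threshold zero    = θ
    threshold (suc j) = threshold j * R

    0≤threshold : ∀ j → 0ℚ ≤ threshold j
    0≤threshold zero    = 0≤θ
    0≤threshold (suc j) = 0≤* (0≤threshold j) 0≤R

    potential : ℕ → ℚ → ℚ
    potential zero    m = m ⊓ θ
    potential (suc d) m = potential d m + m ⊓ threshold (suc d)

    0≤potential : ∀ d {m} → 0ℚ ≤ m → 0ℚ ≤ potential d m
    0≤potential zero    0≤m = ⊓-glb 0≤m 0≤θ
    0≤potential (suc d) 0≤m = 0≤+ (0≤potential d 0≤m) (⊓-glb 0≤m (0≤threshold (suc d)))

    potential-1 : ∀ d → potential d 1ℚ ≤ ℕ→ℚ (suc d)
    potential-1 zero    = p⊓q≤p 1ℚ θ
    potential-1 (suc d) = begin
      potential d 1ℚ + 1ℚ ⊓ threshold (suc d) ≤⟨ +-mono-≤ (potential-1 d) (p⊓q≤p 1ℚ (threshold (suc d))) ⟩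
      ℕ→ℚ (suc d) + 1ℚ                         ≡⟨ +-comm (ℕ→ℚ (suc d)) 1ℚ ⟩
      1ℚ + ℕ→ℚ (suc d)                         ≡⟨ ℕ→ℚ-suc (suc d) ⟨
      ℕ→ℚ (suc (suc d))                        ∎
      where open ≤-Reasoning

    module _ {A : Set} {ν : Measure A} (P : Probability ν) where

      potential-jensen : ∀ d f → ∫ ν (λ w → potential d (f w)) ≤ potential d (∫ ν f)
      potential-jensen zero    f = ⊓-jensen P f θ
      potential-jensen (suc d) f = begin
        ∫ ν (λ w → potential d (f w) + f w ⊓ threshold (suc d))
          ≡⟨ ∫-+ ν _ _ ⟩
        ∫ ν (λ w → potential d (f w)) + ∫ ν (λ w → f w ⊓ threshold (suc d))
          ≤⟨ +-mono-≤ (potential-jensen d f) (⊓-jensen P f _) ⟩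
        potential d (∫ ν f) + ∫ ν f ⊓ threshold (suc d) ∎
        where open ≤-Reasoning

      -- As η ≤ Rv, each integrand is at most `(f w ⊓ Rv) + (f w − Rv)⁺ = f w`, whose average v
      -- equals `v ⊓ η`. So when v splits into the values of `f`, a threshold in [v, Rv] loses at
      -- least the overflow above Rv.
      threshold-gain : ∀ f η → ∫ ν f ≤ η → η ≤ R * ∫ ν f →
        ∫ ν (λ w → posPart (f w - R * ∫ ν f)) + ∫ ν (λ w → f w ⊓ η) ≤ ∫ ν f ⊓ η
      threshold-gain f η v≤η η≤Rv = begin
        ∫ ν (λ w → posPart (f w - R * v)) + ∫ ν (λ w → f w ⊓ η)
          ≡⟨ ∫-+ ν _ _ ⟨
        ∫ ν (λ w → posPart (f w - R * v) + f w ⊓ η)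
          ≤⟨ average-mono P (λ w → ≤-trans
               (+-monoʳ-≤ (posPart (f w - R * v)) (⊓-monoʳ-≤ (f w) η≤Rv))
               (≤-reflexive (trans (+-comm (posPart (f w - R * v)) (f w ⊓ (R * v))) (⊓+pos (f w) (R * v))))) ⟩
        v
          ≡⟨ p≤q⇒p⊓q≡p v≤η ⟨
        v ⊓ η ∎
        where
        v = ∫ ν f
        open ≤-Reasoning

      potential-gain-large : ∀ d f → θ ≤ ∫ ν f → ∫ ν f ≤ threshold d →
        ∫ ν (λ w → posPart (f w - R * ∫ ν f)) + ∫ ν (λ w → potential d (f w)) ≤ potential d (∫ ν f)
      potential-gain-large zero    f θ≤v v≤θ = threshold-gain f θ v≤θ
        (≤-trans θ≤v (subst (_≤ R * ∫ ν f) (*-identityˡ _) (*-monoʳ-≤ _ (≤-trans 0≤θ θ≤v) 1≤R)))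
      potential-gain-large (suc d) f θ≤v v≤η = begin
        e + ∫ ν (λ w → potential d (f w) + f w ⊓ η)
          ≡⟨ cong (e +_) (∫-+ ν _ _) ⟩
        e + (p + q)
          ≤⟨ gain (≤-total v (threshold d)) ⟩
        potential d v + v ⊓ η ∎
        where
        open ≤-Reasoning
        v = ∫ ν f
        η = threshold (suc d)
        e = ∫ ν (λ w → posPart (f w - R * v))
        p = ∫ ν (λ w → potential d (f w))
        q = ∫ ν (λ w → f w ⊓ η)
        eq : ∀ x y z → x + (y + z) ≡ y + (x + z)
        eq = solve-∀ ring
        -- Only one threshold is charged: the top one if v exceeds `threshold d`, otherwise one
        -- further down. The other terms need no more than Jensen.
        gain : _ → e + (p + q) ≤ potential d v + v ⊓ η
        gain (inj₁ v≤t) = subst (_≤ potential d v + v ⊓ η) (+-assoc e p q)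
          (+-mono-≤ (potential-gain-large d f θ≤v v≤t) (⊓-jensen P f η))
        gain (inj₂ t≤v) = subst (_≤ potential d v + v ⊓ η) (eq p e q)
          (+-mono-≤ (potential-jensen d f) (threshold-gain f η v≤η
            (subst (_≤ R * v) (*-comm R (threshold d)) (*-monoˡ-≤ R 0≤R t≤v))))

      -- Below the smallest threshold nothing can be charged, but then the whole overflow is at most
      -- the average v ≤ θ. This is the origin of the additive θ, paid once per letter.
      potential-gain : ∀ d f → (∀ w → 0ℚ ≤ f w) → ∫ ν f ≤ threshold d →
        ∫ ν (λ w → posPart (f w - R * ∫ ν f)) + ∫ ν (λ w → potential d (f w)) ≤ potential d (∫ ν f) + θ
      potential-gain d f 0≤f v≤t with ≤-total θ (∫ ν f)
      ... | inj₁ θ≤v = ≤-trans (potential-gain-large d f θ≤v v≤t) (≤-slack θ 0≤θ refl)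
      ... | inj₂ v≤θ = begin
        ∫ ν (λ w → posPart (f w - R * v)) + ∫ ν (λ w → potential d (f w))
          ≤⟨ +-mono-≤ (average-mono P (λ w → pos-lub {f w - R * v} (≤-slack (R * v) 0≤Rv (eq (f w) (R * v))) (0≤f w)))
                      (potential-jensen d f) ⟩
        v + potential d v
          ≤⟨ +-monoˡ-≤ _ v≤θ ⟩
        θ + potential d v
          ≡⟨ +-comm θ _ ⟩
        potential d v + θ ∎
        where
        open ≤-Reasoning
        v = ∫ ν f
        0≤Rv : 0ℚ ≤ R * v
        0≤Rv = 0≤* 0≤R (average-nonneg P 0≤f)
        eq : ∀ x y → x - y + y ≡ x
        eq = solve-∀ ring

    module _ (𝓐 : Alphabet) (d : ℕ) where
      private
        T = Symbol 𝓐
        τ = uniform 𝓐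
        W = uniform-words 𝓐

      -- The chain rule of entropy in this setting. Marginals of the later letters are mixtures of
      -- those conditioned on the first letter a, so `overflow-mixture` replaces the level `R * ∫ F`
      -- by the conditional levels `R * F̄ a`, and the potentials telescope.
      overflow-potential : ∀ n (F : Vec T n → ℚ) → (∀ x → 0ℚ ≤ F x) → (∀ x → F x ≤ threshold d) →
        overflow 𝓐 n F (R * ∫ (W n) F) + ∫ (W n) (λ x → potential d (F x)) ≤
        potential d (∫ (W n) F) + ℕ→ℚ n * θ
      overflow-potential zero F 0≤F F≤t = ≤-reflexive (begin
        0ℚ + ∫ (W 0) (λ x → potential d (F x)) ≡⟨ +-identityˡ _ ⟩
        ∫ (W 0) (λ x → potential d (F x))      ≡⟨ ∫-[] 𝓐 (λ x → potential d (F x)) ⟩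
        potential d (F [])                     ≡⟨ cong (potential d) (∫-[] 𝓐 F) ⟨
        potential d (∫ (W 0) F)                ≡⟨ +-identityʳ _ ⟨
        potential d (∫ (W 0) F) + 0ℚ           ≡⟨ cong (potential d (∫ (W 0) F) +_) (sym (*-zeroˡ θ)) ⟩
        potential d (∫ (W 0) F) + 0ℚ * θ       ∎)
        where open ≡-Reasoning
      overflow-potential (suc n) F 0≤F F≤t = begin
        overflow 𝓐 (suc n) F (R * ∫ (W (suc n)) F) + ∫ (W (suc n)) (λ x → potential d (F x))
          ≡⟨ cong₂ _+_ (cong (λ v → overflow 𝓐 (suc n) F (R * v)) (∫-∷ 𝓐 n F)) (∫-∷ 𝓐 n _) ⟩
        (e + overflow 𝓐 n (λ x → ∫ τ (λ a → F (a ∷ x))) (R * ∫ τ F̄)) + p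
          ≤⟨ +-monoˡ-≤ p (+-monoʳ-≤ e mixture) ⟩
        (e + ∫ τ (λ a → overflow 𝓐 n (λ x → F (a ∷ x)) (R * F̄ a))) + p
          ≡⟨ trans (+-assoc e _ p) (cong (e +_) (sym (∫-+ τ _ _))) ⟩
        e + ∫ τ (λ a → overflow 𝓐 n (λ x → F (a ∷ x)) (R * F̄ a) + ∫ (W n) (λ x → potential d (F (a ∷ x))))
          ≤⟨ +-monoʳ-≤ e (average-mono (prob 𝓐) (λ a →
               overflow-potential n (λ x → F (a ∷ x)) (λ x → 0≤F (a ∷ x)) (λ x → F≤t (a ∷ x)))) ⟩
        e + ∫ τ (λ a → potential d (F̄ a) + ℕ→ℚ n * θ)
          ≡⟨ cong (e +_) (trans (∫-+ τ _ _) (cong (∫ τ (λ a → potential d (F̄ a)) +_) (average-const (prob 𝓐) _))) ⟩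
        e + (∫ τ (λ a → potential d (F̄ a)) + ℕ→ℚ n * θ)
          ≡⟨ +-assoc e _ _ ⟨
        (e + ∫ τ (λ a → potential d (F̄ a))) + ℕ→ℚ n * θ
          ≤⟨ +-monoˡ-≤ _ (potential-gain (prob 𝓐) d F̄
               (λ a → average-nonneg (words-prob 𝓐 n) (λ x → 0≤F (a ∷ x)))
               (average-≤ (prob 𝓐) _ (λ a → average-≤ (words-prob 𝓐 n) _ (λ x → F≤t (a ∷ x))))) ⟩
        (potential d (∫ τ F̄) + θ) + ℕ→ℚ n * θ
          ≡⟨ eq (potential d (∫ τ F̄)) θ (ℕ→ℚ n) ⟩
        potential d (∫ τ F̄) + (1ℚ + ℕ→ℚ n) * θ
          ≡⟨ cong₂ (λ v k → potential d v + k * θ) (sym (∫-∷ 𝓐 n F)) (sym (ℕ→ℚ-suc n)) ⟩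
        potential d (∫ (W (suc n)) F) + ℕ→ℚ (suc n) * θ ∎
        where
        open ≤-Reasoning
        F̄ : T → ℚ
        F̄ a = ∫ (W n) (λ x → F (a ∷ x))
        e = ∫ τ (λ a → posPart (F̄ a - R * ∫ τ F̄))
        p = ∫ τ (λ a → ∫ (W n) (λ x → potential d (F (a ∷ x))))
        mixture : overflow 𝓐 n (λ x → ∫ τ (λ a → F (a ∷ x))) (R * ∫ τ F̄) ≤
                  ∫ τ (λ a → overflow 𝓐 n (λ x → F (a ∷ x)) (R * F̄ a))
        mixture = subst (λ r → overflow 𝓐 n (λ x → ∫ τ (λ a → F (a ∷ x))) r ≤
                               ∫ τ (λ a → overflow 𝓐 n (λ x → F (a ∷ x)) (R * F̄ a)))
          (∫-*ˡ τ R F̄)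
          (overflow-mixture 𝓐 n (weights≥0 (prob 𝓐)) (λ a x → F (a ∷ x)) (λ a → R * F̄ a))
        eq : ∀ p t k → (p + t) + k * t ≡ p + (1ℚ + k) * t
        eq = solve-∀ ring

-- Concentration of the average agreement with a random word

module Concentration where
  open import Data.Rational.Base
  open import Data.Rational.Properties
  open import Tactic.RingSolver using (solve-∀)
  open RationalOrder
  open Integral
  open Alphabets
  open Overflow

  second-moment-centred : ∀ {A : Set} {ν : Measure A} → Probability ν → ∀ f →
    ∫ ν (λ w → (f w - ∫ ν f) * (f w - ∫ ν f)) ≡ ∫ ν (λ w → f w * f w) - ∫ ν f * ∫ ν f
  second-moment-centred {ν = ν} P f = begin
    ∫ ν (λ w → (f w - v) * (f w - v))
      ≡⟨ ∫-cong ν (λ w → expand (f w) v) ⟩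
    ∫ ν (λ w → f w * f w + (f w * (- 2ℚ * v) + v * v))
      ≡⟨ trans (∫-+ ν _ _) (cong (∫ ν (λ w → f w * f w) +_) (∫-+ ν _ _)) ⟩
    s + (∫ ν (λ w → f w * (- 2ℚ * v)) + ∫ ν (λ _ → v * v))
      ≡⟨ cong (s +_) (cong₂ _+_ (∫-*ʳ ν f (- 2ℚ * v)) (average-const P (v * v))) ⟩
    s + (v * (- 2ℚ * v) + v * v)
      ≡⟨ collect s v ⟩
    s - v * v ∎
    where
    open ≡-Reasoning
    v = ∫ ν f
    s = ∫ ν (λ w → f w * f w)
    expand : ∀ x v → (x - v) * (x - v) ≡ x * x + (x * (- 2ℚ * v) + v * v)
    expand = solve-∀ ring
    collect : ∀ s v → s + (v * (- 2ℚ * v) + v * v) ≡ s - v * v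
    collect = solve-∀ ring

  centred-average : ∀ {A : Set} {ν : Measure A} → Probability ν → ∀ f →
                    ∫ ν (λ w → f w - ∫ ν f) ≡ 0ℚ
  centred-average {ν = ν} P f =
    trans (∫-- ν f _) (trans (cong (_-_ (∫ ν f)) (average-const P (∫ ν f))) (+-inverseʳ (∫ ν f)))

  module _ (𝓐 : Alphabet) where
    private
      T = Symbol 𝓐
      τ = uniform 𝓐
      W = uniform-words 𝓐

    marginal : ∀ n → (Vec T (suc n) → ℚ) → T → ℚ
    marginal n F a = ∫ (W n) (λ x → F (a ∷ x))

    tail-density : ∀ n → (Vec T (suc n) → ℚ) → Vec T n → ℚ
    tail-density n F x = ∫ τ (λ a → F (a ∷ x))

    -- Against a fixed word, `agree` averages to the sum of the marginals at its letters; for a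
    -- random word this is a sum of independent terms. Here one term is split off, by sifting.
    agree-correlation : ∀ n (F : Vec T (suc n) → ℚ) c x →
      ∫ (W (suc n)) (λ y → F y * agree 𝓐 (c ∷ x) y) ≡
      marginal n F c + ∫ (W n) (λ y → tail-density n F y * agree 𝓐 x y)
    agree-correlation n F c x = begin
      ∫ (W (suc n)) (λ y → F y * agree 𝓐 (c ∷ x) y)
        ≡⟨ ∫-∷ 𝓐 n _ ⟩
      ∫ τ (λ a → ∫ (W n) (λ y → F (a ∷ y) * (δ 𝓐 c a + agree 𝓐 x y)))
        ≡⟨ ∫-cong τ (λ a → trans
             (∫-cong (W n) (λ y → distrib (F (a ∷ y)) (δ 𝓐 c a) (agree 𝓐 x y)))
             (trans (∫-+ (W n) _ _) (cong (_+ ∫ (W n) (λ y → F (a ∷ y) * agree 𝓐 x y))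
               (∫-*ˡ (W n) (δ 𝓐 c a) (λ y → F (a ∷ y)))))) ⟩
      ∫ τ (λ a → δ 𝓐 c a * marginal n F a + ∫ (W n) (λ y → F (a ∷ y) * agree 𝓐 x y))
        ≡⟨ ∫-+ τ _ _ ⟩
      ∫ τ (λ a → δ 𝓐 c a * marginal n F a) + ∫ τ (λ a → ∫ (W n) (λ y → F (a ∷ y) * agree 𝓐 x y))
        ≡⟨ cong₂ _+_ (δ-siftˡ 𝓐 (marginal n F) c)
             (trans (∫-swap τ (W n) (λ a y → F (a ∷ y) * agree 𝓐 x y))
                    (∫-cong (W n) (λ y → ∫-*ʳ τ (λ a → F (a ∷ y)) (agree 𝓐 x y)))) ⟩
      marginal n F c + ∫ (W n) (λ y → tail-density n F y * agree 𝓐 x y) ∎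
      where
      open ≡-Reasoning
      distrib : ∀ f d g → f * (d + g) ≡ d * f + f * g
      distrib = solve-∀ ring

    module _ (R : ℚ) (0≤R : 0ℚ ≤ R) where

      truncated : ∀ n → (Vec T (suc n) → ℚ) → T → ℚ
      truncated n F a = marginal n F a ⊓ R

      -- The marginals are cut at level `R`. `centre` sums the truncated marginals minus their
      -- means, which are independent and bounded; `spill` sums the excesses, whose average is
      -- `overflow`.
      centre : ∀ n → (Vec T n → ℚ) → Vec T n → ℚ
      centre zero    F _       = 0ℚ
      centre (suc n) F (a ∷ x) =
        (truncated n F a - ∫ τ (truncated n F)) + centre n (tail-density n F) x

      spill : ∀ n → (Vec T n → ℚ) → Vec T n → ℚ
      spill zero    F _       = 0ℚ
      spill (suc n) F (a ∷ x) = posPart (marginal n F a - R) + spill n (tail-density n F) x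

      0≤spill : ∀ n F x → 0ℚ ≤ spill n F x
      0≤spill zero    F _       = ≤-refl
      0≤spill (suc n) F (a ∷ x) = 0≤+ (0≤pos (marginal n F a - R)) (0≤spill n (tail-density n F) x)

      spill-average : ∀ n F → ∫ (W n) (spill n F) ≡ overflow 𝓐 n F R
      spill-average zero    F = ∫-[] 𝓐 (spill 0 F)
      spill-average (suc n) F =
        trans (∫-∷-+ 𝓐 n (λ a → posPart (marginal n F a - R)) (spill n (tail-density n F))
                     (spill (suc n) F) (λ _ _ → refl))
              (cong (∫ τ (λ a → posPart (marginal n F a - R)) +_) (spill-average n (tail-density n F)))

      centre-average : ∀ n F → ∫ (W n) (centre n F) ≡ 0ℚ
      centre-average zero    F = ∫-[] 𝓐 (centre 0 F)
      centre-average (suc n) F =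
        trans (∫-∷-+ 𝓐 n (λ a → truncated n F a - ∫ τ (truncated n F)) (centre n (tail-density n F))
                     (centre (suc n) F) (λ _ _ → refl))
              (cong₂ _+_ (centred-average (prob 𝓐) (truncated n F)) (centre-average n (tail-density n F)))

      tail-average : ∀ n F → ∫ (W (suc n)) F ≡ 1ℚ → ∫ (W n) (tail-density n F) ≡ 1ℚ
      tail-average n F ∫F≡1 = trans (marginal-average 𝓐 n F) ∫F≡1

      marginal≥0 : ∀ n {F} → (∀ x → 0ℚ ≤ F x) → ∀ a → 0ℚ ≤ marginal n F a
      marginal≥0 n 0≤F a = average-nonneg (words-prob 𝓐 n) (λ x → 0≤F (a ∷ x))

      truncated-average : ∀ n F → ∫ (W (suc n)) F ≡ 1ℚ → ∫ τ (truncated n F) ≤ 1ℚ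
      truncated-average n F ∫F≡1 = ≤-trans (average-mono (prob 𝓐) (λ a → p⊓q≤p (marginal n F a) R))
                                           (≤-reflexive (trans (sym (∫-∷ 𝓐 n F)) ∫F≡1))

      -- The cross term vanishes because the tail is centred. A truncated marginal has second moment
      -- at most `R` times its mean, and the mean is at most 1.
      centre-variance : ∀ n F → (∀ x → 0ℚ ≤ F x) → ∫ (W n) F ≡ 1ℚ →
                        ∫ (W n) (λ x → centre n F x * centre n F x) ≤ ℕ→ℚ n * R
      centre-variance zero F 0≤F ∫F≡1 =
        ≤-reflexive (trans (∫-[] 𝓐 (λ x → centre 0 F x * centre 0 F x)) (sym (*-zeroˡ R)))
      centre-variance (suc n) F 0≤F ∫F≡1 = begin
        ∫ (W (suc n)) (λ x → centre (suc n) F x * centre (suc n) F x)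
          ≡⟨ ∫-∷ 𝓐 n _ ⟩
        ∫ τ (λ a → ∫ (W n) (λ x → (w a + s x) * (w a + s x)))
          ≡⟨ ∫-cong τ (λ a → cross a) ⟩
        ∫ τ (λ a → w a * w a + S)
          ≡⟨ trans (∫-+ τ _ _) (cong (∫ τ (λ a → w a * w a) +_) (average-const (prob 𝓐) S)) ⟩
        ∫ τ (λ a → w a * w a) + S
          ≤⟨ +-mono-≤ w²≤R (centre-variance n (tail-density n F)
               (λ x → average-nonneg (prob 𝓐) (λ a → 0≤F (a ∷ x))) (tail-average n F ∫F≡1)) ⟩
        R + ℕ→ℚ n * R
          ≡⟨ trans (eq R (ℕ→ℚ n)) (cong (_* R) (sym (ℕ→ℚ-suc n))) ⟩
        ℕ→ℚ (suc n) * R ∎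
        where
        open ≤-Reasoning
        g = truncated n F
        w : T → ℚ
        w a = g a - ∫ τ g
        s : Vec T n → ℚ
        s = centre n (tail-density n F)
        S = ∫ (W n) (λ x → s x * s x)
        eq : ∀ r k → r + k * r ≡ (1ℚ + k) * r
        eq = solve-∀ ring
        expand : ∀ w s → (w + s) * (w + s) ≡ w * w + (2ℚ * w * s + s * s)
        expand = solve-∀ ring
        cross : ∀ a → ∫ (W n) (λ x → (w a + s x) * (w a + s x)) ≡ w a * w a + S
        cross a = begin-equality
          ∫ (W n) (λ x → (w a + s x) * (w a + s x))
            ≡⟨ trans (∫-cong (W n) (λ x → expand (w a) (s x)))
                 (trans (∫-+ (W n) _ _) (cong₂ _+_ (average-const (words-prob 𝓐 n) (w a * w a))
                   (trans (∫-+ (W n) _ _) (cong (_+ S) (trans (∫-*ˡ (W n) (2ℚ * w a) s)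
                     (cong (2ℚ * w a *_) (centre-average n (tail-density n F)))))))) ⟩
          w a * w a + (2ℚ * w a * 0ℚ + S)
            ≡⟨ cong (w a * w a +_) (trans (cong (_+ S) (*-zeroʳ (2ℚ * w a))) (+-identityˡ S)) ⟩
          w a * w a + S ∎
        g≥0 : ∀ a → 0ℚ ≤ g a
        g≥0 a = ⊓-glb (marginal≥0 n 0≤F a) 0≤R
        w²≤R : ∫ τ (λ a → w a * w a) ≤ R
        w²≤R = begin
          ∫ τ (λ a → w a * w a)
            ≡⟨ second-moment-centred (prob 𝓐) g ⟩
          ∫ τ (λ a → g a * g a) - ∫ τ g * ∫ τ g
            ≤⟨ ≤-slack (∫ τ g * ∫ τ g) (0≤square (∫ τ g)) (minus+ _ _) ⟩
          ∫ τ (λ a → g a * g a)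
            ≤⟨ average-mono (prob 𝓐) (λ a → *-monoʳ-≤ (g a) (g≥0 a) (p⊓q≤q (marginal n F a) R)) ⟩
          ∫ τ (λ a → R * g a)
            ≡⟨ ∫-*ˡ τ R g ⟩
          R * ∫ τ g
            ≤⟨ *-monoˡ-≤ R 0≤R (truncated-average n F ∫F≡1) ⟩
          R * 1ℚ
            ≡⟨ *-identityʳ R ⟩
          R ∎
          where
          minus+ : ∀ x y → x - y + y ≡ x
          minus+ = solve-∀ ring

      correlation-bound : ∀ n F → ∫ (W n) F ≡ 1ℚ → ∀ x →
        ∫ (W n) (λ y → F y * agree 𝓐 x y) ≤ ℕ→ℚ n + (centre n F x + spill n F x)
      correlation-bound zero    F ∫F≡1 [] =
        ≤-reflexive (trans (∫-[] 𝓐 (λ y → F y * agree 𝓐 [] y)) (*-zeroʳ (F [])))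
      correlation-bound (suc n) F ∫F≡1 (c ∷ x) = begin
        ∫ (W (suc n)) (λ y → F y * agree 𝓐 (c ∷ x) y)
          ≡⟨ agree-correlation n F c x ⟩
        m + ∫ (W n) (λ y → tail-density n F y * agree 𝓐 x y)
          ≤⟨ +-mono-≤ m-bound (correlation-bound n (tail-density n F) (tail-average n F ∫F≡1) x) ⟩
        (1ℚ + ((m ⊓ R - v) + posPart (m - R))) + (ℕ→ℚ n + (c′ + s′))
          ≡⟨ eq 1ℚ (m ⊓ R - v) (posPart (m - R)) (ℕ→ℚ n) c′ s′ ⟩
        (1ℚ + ℕ→ℚ n) + (((m ⊓ R - v) + c′) + (posPart (m - R) + s′))
          ≡⟨ cong (_+ (((m ⊓ R - v) + c′) + (posPart (m - R) + s′))) (ℕ→ℚ-suc n) ⟨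
        ℕ→ℚ (suc n) + (centre (suc n) F (c ∷ x) + spill (suc n) F (c ∷ x)) ∎
        where
        open ≤-Reasoning
        m = marginal n F c
        v = ∫ τ (truncated n F)
        c′ = centre n (tail-density n F) x
        s′ = spill n (tail-density n F) x
        eq : ∀ a b c d e f → (a + (b + c)) + (d + (e + f)) ≡ (a + d) + ((b + e) + (c + f))
        eq = solve-∀ ring
        slack : ∀ g p v → g + p + (1ℚ - v) ≡ 1ℚ + ((g - v) + p)
        slack = solve-∀ ring
        -- Truncation lowers the mean below 1, which is the favourable direction: `1ℚ - v` is the
        -- slack.
        m-bound : m ≤ 1ℚ + ((m ⊓ R - v) + posPart (m - R))
        m-bound = ≤-slack (1ℚ - v) (a≤b⇒0≤b-a (truncated-average n F ∫F≡1))
          (trans (cong (_+ (1ℚ - v)) (sym (⊓+pos m R))) (slack (m ⊓ R) (posPart (m - R)) v))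

      module _ (Λ ι : ℚ) (0≤Λ : 0ℚ ≤ Λ) (0≤ι : 0ℚ ≤ ι) (Λι≡1 : Λ * ι ≡ 1ℚ) where

        -- ι is 1/Λ, and y ≤ y²/Λ above Λ. With Λ of the order of the standard deviation this
        -- replaces the bound of a first moment by the root of the second, at the price of a factor
        -- of two.
        ≤Λ+ιsquare : ∀ y → y ≤ Λ + ι * (y * y)
        ≤Λ+ιsquare y with ≤-total y Λ
        ... | inj₁ y≤Λ = ≤-trans y≤Λ (≤-slack (ι * (y * y)) (0≤* 0≤ι (0≤square y)) refl)
        ... | inj₂ Λ≤y = ≤-slack (Λ + ι * y * (y - Λ)) (0≤+ 0≤Λ (0≤* (0≤* 0≤ι (≤-trans 0≤Λ Λ≤y)) (a≤b⇒0≤b-a Λ≤y)))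
          (trans (eq y Λ ι) (trans (cong (λ u → y + Λ + ι * (y * y) - u * y) Λι≡1) (eq₂ y Λ (ι * (y * y)))))
          where
          eq : ∀ y l i → y + (l + i * y * (y - l)) ≡ y + l + i * (y * y) - l * i * y
          eq = solve-∀ ring
          eq₂ : ∀ y l q → y + l + q - 1ℚ * y ≡ l + q
          eq₂ = solve-∀ ring

        concentration : ∀ n F → (∀ x → 0ℚ ≤ F x) → ∫ (W n) F ≡ 1ℚ → ι * (ℕ→ℚ n * R) ≤ Λ →
          ∫ (W n) (λ x → posPart (∫ (W n) (λ y → F y * agree 𝓐 x y) - ℕ→ℚ n)) ≤
          (Λ + Λ) + overflow 𝓐 n F R
        concentration n F 0≤F ∫F≡1 hΛ = begin
          ∫ (W n) (λ x → posPart (∫ (W n) (λ y → F y * agree 𝓐 x y) - ℕ→ℚ n))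
            ≤⟨ average-mono (words-prob 𝓐 n) bound ⟩
          ∫ (W n) (λ x → (Λ + ι * (c x * c x)) + spill n F x)
            ≡⟨ trans (∫-+ (W n) _ _) (cong₂ _+_
                 (trans (∫-+ (W n) _ _) (cong₂ _+_ (average-const (words-prob 𝓐 n) Λ) (∫-*ˡ (W n) ι _)))
                 (spill-average n F)) ⟩
          (Λ + ι * ∫ (W n) (λ x → c x * c x)) + overflow 𝓐 n F R
            ≤⟨ +-monoˡ-≤ _ (+-monoʳ-≤ Λ (≤-trans (*-monoˡ-≤ ι 0≤ι (centre-variance n F 0≤F ∫F≡1)) hΛ)) ⟩
          (Λ + Λ) + overflow 𝓐 n F R ∎
          where
          open ≤-Reasoning
          c = centre n F
          eq : ∀ x y z → x + (y + z) - x ≡ y + z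
          eq = solve-∀ ring
          bound : ∀ x → posPart (∫ (W n) (λ y → F y * agree 𝓐 x y) - ℕ→ℚ n) ≤ (Λ + ι * (c x * c x)) + spill n F x
          bound x = pos-lub
            (begin
              ∫ (W n) (λ y → F y * agree 𝓐 x y) - ℕ→ℚ n
                ≤⟨ +-monoˡ-≤ (- ℕ→ℚ n) (correlation-bound n F ∫F≡1 x) ⟩
              ℕ→ℚ n + (c x + spill n F x) - ℕ→ℚ n
                ≡⟨ eq (ℕ→ℚ n) (c x) (spill n F x) ⟩
              c x + spill n F x
                ≤⟨ +-monoˡ-≤ (spill n F x) (≤Λ+ιsquare (c x)) ⟩
              (Λ + ι * (c x * c x)) + spill n F x ∎)
            (0≤+ (0≤+ 0≤Λ (0≤* 0≤ι (0≤square (c x)))) (0≤spill n F x))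

-- Maximal coupling with the uniform law

module Transports where
  open import Data.Rational.Base
  open import Data.Rational.Properties
  open import Tactic.RingSolver using (solve-∀)
  open RationalOrder
  open Integral
  open Alphabets

  inverse : ∀ x → 0ℚ < x → ∃ λ y → 0ℚ ≤ y × x * y ≡ 1ℚ
  inverse x 0<x = y , nonNegative⁻¹ y {{pos⇒nonNeg y {{1/pos⇒pos x {{x>0}}}}}} , *-inverseʳ x {{x≢0}}
    where
    x>0 : Positive x
    x>0 = positive 0<x
    x≢0 : NonZero x
    x≢0 = pos⇒nonZero x {{x>0}}
    y : ℚ
    y = (1/ x) {{x≢0}}

  -- The witness is min(1, 1/x), the proportion of a density x that fits under the uniform density
  -- 1.
  shrink : ∀ x → ∃ λ g → 0ℚ ≤ g × g ≤ 1ℚ × x * g ≤ 1ℚ × x * (1ℚ - g) ≤ posPart (x - 1ℚ)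
  shrink x with x ≤? 1ℚ
  ... | yes x≤1 = 1ℚ , 0≤1 , ≤-refl , ≤-trans (≤-reflexive (*-identityʳ x)) x≤1 ,
                  ≤-trans (≤-reflexive (eq x)) (0≤pos (x - 1ℚ))
    where
    eq : ∀ x → x * (1ℚ - 1ℚ) ≡ 0ℚ
    eq = solve-∀ ring
  ... | no  x≰1 with inverse x (<-trans (positive⁻¹ 1ℚ) (≰⇒> x≰1))
  ... | g , 0≤g , xg≡1 = g , 0≤g , g≤1 , ≤-reflexive xg≡1 ,
                         ≤-trans (≤-reflexive (trans (eq x g) (cong (_-_ x) xg≡1))) (≤pos (x - 1ℚ))
    where
    eq : ∀ x g → x * (1ℚ - g) ≡ x - x * g
    eq = solve-∀ ring
    g≤1 : g ≤ 1ℚ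
    g≤1 = subst₂ _≤_ (*-identityˡ g) xg≡1 (*-monoʳ-≤ g 0≤g (<⇒≤ (≰⇒> x≰1)))

  -- A nonnegative `e` of integral zero vanishes at each listed point of positive weight, so the
  -- sign of `h` does not matter.
  ∫≡0⇒∫h≡0 : ∀ {A : Set} {ν : Measure A} → Nonneg ν → ∀ {e} → (∀ a → 0ℚ ≤ e a) → ∫ ν e ≡ 0ℚ →
             ∀ (h : A → ℚ) → ∫ ν (λ a → h a * e a) ≡ 0ℚ
  ∫≡0⇒∫h≡0 []                          0≤e ∫e≡0 h = refl
  ∫≡0⇒∫h≡0 {ν = (w , a) ∷ ν} (p ∷ ps) {e} 0≤e ∫e≡0 h = begin
    w * (h a * e a) + ∫ ν (λ a → h a * e a)
      ≡⟨ cong₂ _+_ (trans (eq w (h a) (e a)) (trans (cong (h a *_) we≡0) (*-zeroʳ (h a))))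
                   (∫≡0⇒∫h≡0 ps 0≤e s≡0 h) ⟩
    0ℚ ∎
    where
    open ≡-Reasoning
    eq : ∀ w h e → w * (h * e) ≡ h * (w * e)
    eq = solve-∀ ring
    0≤we : 0ℚ ≤ w * e a
    0≤we = 0≤* p (0≤e a)
    0≤s : 0ℚ ≤ ∫ ν e
    0≤s = ∫-nonneg ps 0≤e
    we≡0 : w * e a ≡ 0ℚ
    we≡0 = ≤-antisym (≤-slack (∫ ν e) 0≤s ∫e≡0) 0≤we
    s≡0 : ∫ ν e ≡ 0ℚ
    s≡0 = ≤-antisym (≤-slack (w * e a) 0≤we (trans (+-comm (∫ ν e) (w * e a)) ∫e≡0)) 0≤s

  -- A maximal coupling: the kernel p turns the law F into a law with
  -- density f, and is modified, by at most the mass of (f − 1)⁺, into a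
  -- kernel that turns F into the uniform law.
  module Transport {B : Set} (μ : Measure B) (μ≥0 : Nonneg μ) (𝓒 : Alphabet)
                   (F : B → ℚ) (0≤F : ∀ b → 0ℚ ≤ F b) (∫F≡1 : ∫ μ F ≡ 1ℚ)
                   (p : Symbol 𝓒 → B → ℚ) (0≤p : ∀ c b → 0ℚ ≤ p c b)
                   (∫p≡1 : ∀ b → ∫ (uniform 𝓒) (λ c → p c b) ≡ 1ℚ) where
    private
      ν = uniform 𝓒

    f : Symbol 𝓒 → ℚ
    f c = ∫ μ (λ b → F b * p c b)

    keep : Symbol 𝓒 → ℚ
    keep c = proj₁ (shrink (f c))

    0≤keep : ∀ c → 0ℚ ≤ keep c
    0≤keep c = proj₁ (proj₂ (shrink (f c)))

    loss : Symbol 𝓒 → ℚ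
    loss c = 1ℚ - keep c

    0≤loss : ∀ c → 0ℚ ≤ loss c
    0≤loss c = a≤b⇒0≤b-a (proj₁ (proj₂ (proj₂ (shrink (f c)))))

    loss-average : ∫ ν (λ c → f c * loss c) ≤ ∫ ν (λ c → posPart (f c - 1ℚ))
    loss-average = average-mono (prob 𝓒) (λ c → proj₂ (proj₂ (proj₂ (proj₂ (shrink (f c))))))

    deficit : Symbol 𝓒 → ℚ
    deficit c = 1ℚ - f c * keep c

    0≤deficit : ∀ c → 0ℚ ≤ deficit c
    0≤deficit c = a≤b⇒0≤b-a (proj₁ (proj₂ (proj₂ (proj₂ (shrink (f c))))))

    rest : B → ℚ
    rest b = ∫ ν (λ c → p c b * loss c)

    0≤rest : ∀ b → 0ℚ ≤ rest b
    0≤rest b = average-nonneg (prob 𝓒) (λ c → 0≤* (0≤p c b) (0≤loss c))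

    kept+rest : ∀ b → ∫ ν (λ c → p c b * keep c) + rest b ≡ 1ℚ
    kept+rest b = begin
      ∫ ν (λ c → p c b * keep c) + rest b         ≡⟨ ∫-+ ν _ _ ⟨
      ∫ ν (λ c → p c b * keep c + p c b * loss c) ≡⟨ ∫-cong ν (λ c → eq (p c b) (keep c)) ⟩
      ∫ ν (λ c → p c b)                           ≡⟨ ∫p≡1 b ⟩
      1ℚ                                          ∎
      where
      open ≡-Reasoning
      eq : ∀ p k → p * k + p * (1ℚ - k) ≡ p
      eq = solve-∀ ring

    ∫f≡1 : ∫ ν f ≡ 1ℚ
    ∫f≡1 = begin
      ∫ ν (λ c → ∫ μ (λ b → F b * p c b))
        ≡⟨ ∫-swap ν μ (λ c b → F b * p c b) ⟩
      ∫ μ (λ b → ∫ ν (λ c → F b * p c b))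
        ≡⟨ ∫-cong μ (λ b → trans (∫-*ˡ ν (F b) (λ c → p c b)) (trans (cong (F b *_) (∫p≡1 b)) (*-identityʳ (F b)))) ⟩
      ∫ μ F
        ≡⟨ ∫F≡1 ⟩
      1ℚ ∎
      where open ≡-Reasoning

    mass : ℚ
    mass = ∫ μ (λ b → F b * rest b)

    -- `f` and the uniform density both have total one, so what is missing below 1 after the cut is
    -- what was cut off.
    deficit-average : ∫ ν deficit ≡ mass
    deficit-average = begin
      ∫ ν (λ c → 1ℚ - f c * keep c)
        ≡⟨ trans (∫-- ν _ _) (cong (_- ∫ ν (λ c → f c * keep c)) (trans (total (prob 𝓒)) (sym ∫f≡1))) ⟩
      ∫ ν f - ∫ ν (λ c → f c * keep c)
        ≡⟨ ∫-- ν f _ ⟨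
      ∫ ν (λ c → f c - f c * keep c)
        ≡⟨ ∫-cong ν (λ c → trans (eq (f c) (keep c)) (sym (∫-*ʳ μ (λ b → F b * p c b) (loss c)))) ⟩
      ∫ ν (λ c → ∫ μ (λ b → F b * p c b * loss c))
        ≡⟨ ∫-swap ν μ (λ c b → F b * p c b * loss c) ⟩
      ∫ μ (λ b → ∫ ν (λ c → F b * p c b * loss c))
        ≡⟨ ∫-cong μ (λ b → trans (∫-cong ν (λ c → *-assoc (F b) (p c b) (loss c)))
                                 (∫-*ˡ ν (F b) (λ c → p c b * loss c))) ⟩
      mass ∎
      where
      open ≡-Reasoning
      eq : ∀ f k → f - f * k ≡ f * (1ℚ - k)
      eq = solve-∀ ring

    0≤mass : 0ℚ ≤ mass
    0≤mass = ∫-nonneg μ≥0 (λ b → 0≤* (0≤F b) (0≤rest b))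

    refill : ∃ λ (q : Symbol 𝓒 → ℚ) → (∀ c → 0ℚ ≤ q c) × (∫ ν q ≡ 1ℚ) × (∀ c → mass * q c ≡ deficit c)
    refill with 0ℚ <? mass
    ... | yes 0<mass with inverse mass 0<mass
    ...   | ι , 0≤ι , mι≡1 =
      (λ c → ι * deficit c) , (λ c → 0≤* 0≤ι (0≤deficit c)) ,
      trans (∫-*ˡ ν ι deficit) (trans (cong (ι *_) deficit-average) (trans (*-comm ι mass) mι≡1)) ,
      (λ c → trans (sym (*-assoc mass ι (deficit c))) (trans (cong (_* deficit c) mι≡1) (*-identityˡ (deficit c))))
    -- Nothing was cut off and `q` is arbitrary. The deficit then vanishes at every symbol, and not
    -- only on average, because `deficit c` is itself the average of `deficit` against `δ`.
    refill | no 0≮mass =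
      (λ _ → 1ℚ) , (λ _ → 0≤1) , total (prob 𝓒) ,
      (λ c → trans (cong (_* 1ℚ) mass≡0) (sym (trans (sym (δ-sift 𝓒 deficit c))
        (∫≡0⇒∫h≡0 (weights≥0 (prob 𝓒)) 0≤deficit (trans deficit-average mass≡0) (λ a → δ 𝓒 a c)))))
      where
      mass≡0 : mass ≡ 0ℚ
      mass≡0 = ≤-antisym (≮⇒≥ 0≮mass) 0≤mass

    q : Symbol 𝓒 → ℚ
    q = proj₁ refill

    kernel : Symbol 𝓒 → B → ℚ
    kernel c b = p c b * keep c + rest b * q c

    0≤kernel : ∀ c b → 0ℚ ≤ kernel c b
    0≤kernel c b = 0≤+ (0≤* (0≤p c b) (0≤keep c)) (0≤* (0≤rest b) (proj₁ (proj₂ refill) c))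

    kernel-total : ∀ b → ∫ ν (λ c → kernel c b) ≡ 1ℚ
    kernel-total b = begin
      ∫ ν (λ c → p c b * keep c + rest b * q c)
        ≡⟨ trans (∫-+ ν _ _) (cong (∫ ν (λ c → p c b * keep c) +_) (∫-*ˡ ν (rest b) q)) ⟩
      ∫ ν (λ c → p c b * keep c) + rest b * ∫ ν q
        ≡⟨ cong (∫ ν (λ c → p c b * keep c) +_)
                (trans (cong (rest b *_) (proj₁ (proj₂ (proj₂ refill)))) (*-identityʳ (rest b))) ⟩
      ∫ ν (λ c → p c b * keep c) + rest b
        ≡⟨ kept+rest b ⟩
      1ℚ ∎
      where open ≡-Reasoning

    kernel-uniform : ∀ c → ∫ μ (λ b → F b * kernel c b) ≡ 1ℚ
    kernel-uniform c = begin
      ∫ μ (λ b → F b * (p c b * keep c + rest b * q c))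
        ≡⟨ trans (∫-cong μ (λ b → eq (F b) (p c b) (keep c) (rest b) (q c))) (∫-+ μ _ _) ⟩
      ∫ μ (λ b → F b * p c b * keep c) + ∫ μ (λ b → F b * rest b * q c)
        ≡⟨ cong₂ _+_ (∫-*ʳ μ _ (keep c)) (trans (∫-*ʳ μ _ (q c)) (proj₂ (proj₂ (proj₂ refill)) c)) ⟩
      f c * keep c + deficit c
        ≡⟨ cancel (f c * keep c) ⟩
      1ℚ ∎
      where
      open ≡-Reasoning
      eq : ∀ F p k r q → F * (p * k + r * q) ≡ F * p * k + F * r * q
      eq = solve-∀ ring
      cancel : ∀ x → x + (1ℚ - x) ≡ 1ℚ
      cancel = solve-∀ ring

    kernel-close : ∀ c b → p c b ≤ kernel c b + p c b * loss c
    kernel-close c b = ≤-slack (rest b * q c) (0≤* (0≤rest b) (proj₁ (proj₂ refill) c))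
                               (eq (p c b) (keep c) (rest b * q c))
      where
      eq : ∀ p k s → p + s ≡ (p * k + s) + p * (1ℚ - k)
      eq = solve-∀ ring

-- Coupling a law of small entropy deficiency with uniform blocks

module BlockCoupling where
  open import Data.Rational.Base
  open import Data.Rational.Properties
  open import Tactic.RingSolver using (solve-∀)
  open RationalOrder
  open Integral
  open Alphabets
  open Overflow
  open Concentration
  open Transports

  module _ (𝓐 : Alphabet) (B : ℕ) where
    private
      𝓑 = power 𝓐 B
      Block = Symbol 𝓑
      W = uniform 𝓑
      M = uniform-words 𝓑

    -- This still counts equal letters of `𝓐`, whereas `agree 𝓑` counts equal blocks; the coupling
    -- compares the two.
    agree-blocks : ∀ {m} → Vec Block m → Vec Block m → ℚ
    agree-blocks []      []      = 0ℚ
    agree-blocks (b ∷ x) (c ∷ y) = agree 𝓐 b c + agree-blocks x y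

    module _ (R : ℚ) where

      -- The overflow of every block given the blocks before it. Conditional densities stay
      -- unnormalised, and the level is `R` times their mass instead.
      cost : ∀ m → (Vec Block m → ℚ) → ℚ
      cost zero    V = 0ℚ
      cost (suc m) V =
        overflow 𝓐 B (λ b → ∫ (M m) (λ z → V (b ∷ z))) (R * ∫ W (λ b → ∫ (M m) (λ z → V (b ∷ z)))) +
        ∫ W (λ b → cost m (λ z → V (b ∷ z)))

      cost-cong : ∀ m {V V′} → (∀ z → V z ≡ V′ z) → cost m V ≡ cost m V′
      cost-cong zero    h = refl
      cost-cong (suc m) h = cong₂ _+_
        (overflow-cong 𝓐 B (λ b → ∫-cong (M m) (λ z → h (b ∷ z)))
          (cong (R *_) (∫-cong W (λ b → ∫-cong (M m) (λ z → h (b ∷ z))))))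
        (∫-cong W (λ b → cost-cong m (λ z → h (b ∷ z))))

      cost-mixture : ∀ m {A : Set} {ν : Measure A} → Nonneg ν → (V : A → Vec Block m → ℚ) →
                     cost m (λ z → ∫ ν (λ w → V w z)) ≤ ∫ ν (λ w → cost m (V w))
      cost-mixture zero    {ν = ν} ν≥0 V = ≤-reflexive (sym (∫-0 ν))
      cost-mixture (suc m) {A} {ν} ν≥0 V = begin
        overflow 𝓐 B (λ b → ∫ (M m) (λ z → ∫ ν (λ w → V w (b ∷ z))))
                      (R * ∫ W (λ b → ∫ (M m) (λ z → ∫ ν (λ w → V w (b ∷ z))))) +
        ∫ W (λ b → cost m (λ z → ∫ ν (λ w → V w (b ∷ z))))
          ≡⟨ cong (_+ ∫ W (λ b → cost m (λ z → ∫ ν (λ w → V w (b ∷ z)))))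
               (overflow-cong 𝓐 B (λ b → ∫-swap (M m) ν (λ z w → V w (b ∷ z)))
                 (trans (cong (R *_) (∫∫-swap-nested W (M m) ν (λ b z w → V w (b ∷ z)))) (sym (∫-*ˡ ν R _)))) ⟩
        overflow 𝓐 B (λ b → ∫ ν (λ w → F w b)) (∫ ν (λ w → R * ∫ W (F w))) +
        ∫ W (λ b → cost m (λ z → ∫ ν (λ w → V w (b ∷ z))))
          ≤⟨ +-mono-≤ (overflow-mixture 𝓐 B ν≥0 F (λ w → R * ∫ W (F w)))
                      (average-mono (prob 𝓑) (λ b → cost-mixture m ν≥0 (λ w z → V w (b ∷ z)))) ⟩
        ∫ ν (λ w → overflow 𝓐 B (F w) (R * ∫ W (F w))) +
        ∫ W (λ b → ∫ ν (λ w → cost m (λ z → V w (b ∷ z))))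
          ≡⟨ cong (∫ ν (λ w → overflow 𝓐 B (F w) (R * ∫ W (F w))) +_)
               (∫-swap W ν (λ b w → cost m (λ z → V w (b ∷ z)))) ⟩
        ∫ ν (λ w → overflow 𝓐 B (F w) (R * ∫ W (F w))) +
        ∫ ν (λ w → ∫ W (λ b → cost m (λ z → V w (b ∷ z))))
          ≡⟨ ∫-+ ν _ _ ⟨
        ∫ ν (λ w → cost (suc m) (V w)) ∎
        where
        open ≤-Reasoning
        F : A → Block → ℚ
        F w b = ∫ (M m) (λ z → V w (b ∷ z))

      module _ (1≤R : 1ℚ ≤ R) (θ : ℚ) (0≤θ : 0ℚ ≤ θ) (d : ℕ) where
        private
          Ψ = potential R 1≤R θ 0≤θ d

        -- `overflow-potential` for one block ends at the averaged potential of the masses `F b`,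
        -- which is where the bound for the later blocks starts. So the potential is paid once for
        -- all blocks together.
        cost-bound : ∀ m V → (∀ z → 0ℚ ≤ V z) → (∀ z → V z ≤ threshold R 1≤R θ 0≤θ d) →
                     cost m V ≤ Ψ (∫ (M m) V) + ℕ→ℚ (m ℕ.* B) * θ
        cost-bound zero V 0≤V V≤t = 0≤+ (0≤potential R 1≤R θ 0≤θ d (average-nonneg (words-prob 𝓑 0) 0≤V))
                                        (0≤* (0≤ℕ→ℚ 0) 0≤θ)
        cost-bound (suc m) V 0≤V V≤t = begin
          overflow 𝓐 B F (R * ∫ W F) + ∫ W (λ b → cost m (λ z → V (b ∷ z)))
            ≤⟨ +-monoʳ-≤ (overflow 𝓐 B F (R * ∫ W F)) (average-mono (prob 𝓑) (λ b →
                 cost-bound m (λ z → V (b ∷ z)) (λ z → 0≤V (b ∷ z)) (λ z → V≤t (b ∷ z)))) ⟩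
          overflow 𝓐 B F (R * ∫ W F) + ∫ W (λ b → Ψ (F b) + ℕ→ℚ (m ℕ.* B) * θ)
            ≡⟨ cong (overflow 𝓐 B F (R * ∫ W F) +_)
                 (trans (∫-+ W _ _) (cong (∫ W (λ b → Ψ (F b)) +_) (average-const (prob 𝓑) _))) ⟩
          overflow 𝓐 B F (R * ∫ W F) + (∫ W (λ b → Ψ (F b)) + ℕ→ℚ (m ℕ.* B) * θ)
            ≡⟨ +-assoc (overflow 𝓐 B F (R * ∫ W F)) _ _ ⟨
          overflow 𝓐 B F (R * ∫ W F) + ∫ W (λ b → Ψ (F b)) + ℕ→ℚ (m ℕ.* B) * θ
            ≤⟨ +-monoˡ-≤ _ (overflow-potential R 1≤R θ 0≤θ 𝓐 d B F
                 (λ b → average-nonneg (words-prob 𝓑 m) (λ z → 0≤V (b ∷ z)))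
                 (λ b → average-≤ (words-prob 𝓑 m) _ (λ z → V≤t (b ∷ z)))) ⟩
          Ψ (∫ W F) + ℕ→ℚ B * θ + ℕ→ℚ (m ℕ.* B) * θ
            ≡⟨ trans (eq (Ψ (∫ W F)) (ℕ→ℚ B) (ℕ→ℚ (m ℕ.* B)) θ)
                     (cong₂ (λ v k → Ψ v + k * θ) (sym (∫-∷ 𝓑 m V)) (sym (ℕ→ℚ-+ B (m ℕ.* B)))) ⟩
          Ψ (∫ (M (suc m)) V) + ℕ→ℚ (suc m ℕ.* B) * θ ∎
          where
          open ≤-Reasoning
          F : Block → ℚ
          F b = ∫ (M m) (λ z → V (b ∷ z))
          eq : ∀ p k l t → p + k * t + l * t ≡ p + (k + l) * t
          eq = solve-∀ ring

    ∫∫-∷ : ∀ m (f : Vec Block (suc m) → Vec Block (suc m) → ℚ) →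
      ∫ (M (suc m)) (λ z → ∫ (M (suc m)) (λ y → f z y)) ≡
      ∫ W (λ b → ∫ (M m) (λ z → ∫ W (λ c → ∫ (M m) (λ y → f (b ∷ z) (c ∷ y)))))
    ∫∫-∷ m f = trans (∫-∷ 𝓑 m _) (∫-cong W (λ b → ∫-cong (M m) (λ z → ∫-∷ 𝓑 m (f (b ∷ z)))))

    module _ (m : ℕ) (U : Vec Block (suc m) → Vec Block (suc m) → ℚ) where

      first-blocks : Block → Block → ℚ
      first-blocks b c = ∫ (M m) (λ z → ∫ (M m) (λ y → U (b ∷ z) (c ∷ y)))

      -- The test weight left for the later blocks when the first pair is integrated out and the new
      -- first block has kernel `k`.
      later-blocks : (Block → ℚ) → Vec Block m → Vec Block m → ℚ
      later-blocks k z y = ∫ W (λ b → ∫ W (λ c → k b * U (b ∷ z) (c ∷ y)))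

      ∫-first-blocks : ∀ (α : Block → Block → ℚ) →
        ∫ W (λ b → ∫ (M m) (λ z → ∫ W (λ c → ∫ (M m) (λ y → U (b ∷ z) (c ∷ y) * α b c)))) ≡
        ∫ W (λ b → ∫ W (λ c → first-blocks b c * α b c))
      ∫-first-blocks α = ∫-cong W (λ b → trans
        (∫-swap (M m) W (λ z c → ∫ (M m) (λ y → U (b ∷ z) (c ∷ y) * α b c)))
        (∫-cong W (λ c → trans (∫-cong (M m) (λ z → ∫-*ʳ (M m) _ (α b c))) (∫-*ʳ (M m) _ (α b c)))))

      ∫-later-blocks : ∀ (k : Block → Block → ℚ) (Φ : Block → Vec Block m → Vec Block m → ℚ) →
        ∫ W (λ b → ∫ (M m) (λ z → ∫ W (λ c → ∫ (M m) (λ y →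
          U (b ∷ z) (c ∷ y) * ∫ W (λ x → k x b * Φ x z y))))) ≡
        ∫ W (λ x → ∫ (M m) (λ z → ∫ (M m) (λ y → later-blocks (k x) z y * Φ x z y)))
      ∫-later-blocks k Φ = begin
        ∫ W (λ b → ∫ (M m) (λ z → ∫ W (λ c → ∫ (M m) (λ y →
          U (b ∷ z) (c ∷ y) * ∫ W (λ x → k x b * Φ x z y)))))
          ≡⟨ ∫-cong W (λ b → ∫-cong (M m) (λ z → trans
               (∫-cong W (λ c → ∫-cong (M m) (λ y → trans
                 (sym (∫-*ˡ W (U (b ∷ z) (c ∷ y)) (λ x → k x b * Φ x z y)))
                 (∫-cong W (λ x → eq (U (b ∷ z) (c ∷ y)) (k x b) (Φ x z y))))))
               (∫∫-swap-nested W (M m) W (λ c y x → k x b * U (b ∷ z) (c ∷ y) * Φ x z y)))) ⟩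
        ∫ W (λ b → ∫ (M m) (λ z → ∫ W (λ x → ∫ W (λ c → ∫ (M m) (λ y → k x b * U (b ∷ z) (c ∷ y) * Φ x z y)))))
          ≡⟨ ∫∫-swap-nested W (M m) W (λ b z x → ∫ W (λ c → ∫ (M m) (λ y → k x b * U (b ∷ z) (c ∷ y) * Φ x z y))) ⟩
        ∫ W (λ x → ∫ W (λ b → ∫ (M m) (λ z → ∫ W (λ c → ∫ (M m) (λ y → k x b * U (b ∷ z) (c ∷ y) * Φ x z y)))))
          ≡⟨ ∫-cong W (λ x → trans
               (∫-swap W (M m) (λ b z → ∫ W (λ c → ∫ (M m) (λ y → k x b * U (b ∷ z) (c ∷ y) * Φ x z y))))
               (∫-cong (M m) (λ z → trans
                 (∫∫-swap-nested W W (M m) (λ b c y → k x b * U (b ∷ z) (c ∷ y) * Φ x z y))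
                 (∫-cong (M m) (λ y → trans (∫-cong W (λ b → ∫-*ʳ W _ (Φ x z y))) (∫-*ʳ W _ (Φ x z y))))))) ⟩
        ∫ W (λ x → ∫ (M m) (λ z → ∫ (M m) (λ y → later-blocks (k x) z y * Φ x z y))) ∎
        where
        open ≡-Reasoning
        eq : ∀ u k p → u * (k * p) ≡ k * u * p
        eq = solve-∀ ring

      -- Applied twice: to `agree-blocks`, and to the expected agreement of the coupled word.
      ∫-blocks : ∀ (α : Block → Block → ℚ) (k : Block → Block → ℚ) (Φ : Block → Vec Block m → Vec Block m → ℚ)
        (g : Vec Block (suc m) → Vec Block (suc m) → ℚ) →
        (∀ b z c y → g (b ∷ z) (c ∷ y) ≡ α b c + ∫ W (λ x → k x b * Φ x z y)) →
        ∫ (M (suc m)) (λ z → ∫ (M (suc m)) (λ y → U z y * g z y)) ≡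
        ∫ W (λ b → ∫ W (λ c → first-blocks b c * α b c)) +
        ∫ W (λ x → ∫ (M m) (λ z → ∫ (M m) (λ y → later-blocks (k x) z y * Φ x z y)))
      ∫-blocks α k Φ g g-split = begin
        ∫ (M (suc m)) (λ z → ∫ (M (suc m)) (λ y → U z y * g z y))
          ≡⟨ ∫∫-∷ m (λ z y → U z y * g z y) ⟩
        ∫ W (λ b → ∫ (M m) (λ z → ∫ W (λ c → ∫ (M m) (λ y → U (b ∷ z) (c ∷ y) * g (b ∷ z) (c ∷ y)))))
          ≡⟨ ∫-cong W (λ b → trans (∫-cong (M m) (λ z → trans (∫-cong W (λ c → trans
               (∫-cong (M m) (λ y → trans (cong (U (b ∷ z) (c ∷ y) *_) (g-split b z c y))
                                          (*-distribˡ-+ (U (b ∷ z) (c ∷ y)) (α b c) _)))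
               (∫-+ (M m) _ _))) (∫-+ W _ _))) (∫-+ (M m) _ _)) ⟩
        ∫ W (λ b → ∫ (M m) (λ z → ∫ W (λ c → ∫ (M m) (λ y → U (b ∷ z) (c ∷ y) * α b c))) +
                   ∫ (M m) (λ z → ∫ W (λ c → ∫ (M m) (λ y →
                     U (b ∷ z) (c ∷ y) * ∫ W (λ x → k x b * Φ x z y)))))
          ≡⟨ trans (∫-+ W _ _) (cong₂ _+_ (∫-first-blocks α) (∫-later-blocks k Φ)) ⟩
        ∫ W (λ b → ∫ W (λ c → first-blocks b c * α b c)) +
        ∫ W (λ x → ∫ (M m) (λ z → ∫ (M m) (λ y → later-blocks (k x) z y * Φ x z y))) ∎
        where open ≡-Reasoning

    record Coupling (m : ℕ) (V : Vec Block m → ℚ) (loss : ℚ) : Set where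
      field
        kernel         : Vec Block m → Vec Block m → ℚ
        0≤kernel       : ∀ x z → 0ℚ ≤ kernel x z
        kernel-total   : ∀ z → ∫ (M m) (λ x → kernel x z) ≡ 1ℚ
        kernel-uniform : ∀ x → ∫ (M m) (λ z → V z * kernel x z) ≡ 1ℚ
        -- `U` is the joint density of (z, y), with y uniform and independent of z, multiplied by an
        -- acceptance probability; hence the bound by `V`. One `loss` serves all such `U`.
        kernel-agree   : ∀ (U : Vec Block m → Vec Block m → ℚ) → (∀ z y → 0ℚ ≤ U z y) → (∀ z y → U z y ≤ V z) →
          ∫ (M m) (λ z → ∫ (M m) (λ y → U z y * agree-blocks z y)) ≤
          ℕ→ℚ B * ∫ (M m) (λ z → ∫ (M m) (λ y → U z y * ∫ (M m) (λ x → kernel x z * agree 𝓑 x y))) + loss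

    module _ (R : ℚ) (0≤R : 0ℚ ≤ R) (β : ℚ) (0≤β : 0ℚ ≤ β) (Bβ≡1 : ℕ→ℚ B * β ≡ 1ℚ)
             (Λ ι : ℚ) (0≤Λ : 0ℚ ≤ Λ) (0≤ι : 0ℚ ≤ ι) (Λι≡1 : Λ * ι ≡ 1ℚ) (hΛ : ι * (ℕ→ℚ B * R) ≤ Λ) where

      -- The blocks are coupled one after another. Since the new first block x is exactly uniform,
      -- `V′ x` is the density of the later old blocks given x; it has total one, and the induction
      -- applies to it.
      coupling : ∀ m V → (∀ z → 0ℚ ≤ V z) → ∫ (M m) V ≡ 1ℚ →
                 Coupling m V (ℕ→ℚ m * (Λ + Λ) + cost R m V)
      coupling zero V 0≤V ∫V≡1 = record
        { kernel         = λ _ _ → 1ℚ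
        ; 0≤kernel       = λ _ _ → 0≤1
        ; kernel-total   = λ _ → total (words-prob 𝓑 0)
        ; kernel-uniform = λ _ → trans (∫-cong (M 0) (λ z → *-identityʳ (V z))) ∫V≡1
        ; kernel-agree   = λ U 0≤U U≤V → begin
            ∫ (M 0) (λ z → ∫ (M 0) (λ y → U z y * agree-blocks z y))
              ≡⟨ trans (∫-[] 𝓑 (λ z → ∫ (M 0) (λ y → U z y * agree-blocks z y)))
                       (trans (∫-[] 𝓑 (λ y → U [] y * agree-blocks [] y)) (*-zeroʳ (U [] []))) ⟩
            0ℚ
              ≤⟨ 0≤+ (0≤* (0≤ℕ→ℚ B) (average-nonneg (words-prob 𝓑 0) (λ z → average-nonneg (words-prob 𝓑 0) (λ y →
                   0≤* (0≤U z y) (average-nonneg (words-prob 𝓑 0) (λ x → 0≤* 0≤1 (agree≥0 𝓑 x y)))))))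
                 (0≤+ (0≤* (0≤ℕ→ℚ 0) (0≤+ 0≤Λ 0≤Λ)) ≤-refl) ⟩
            ℕ→ℚ B * ∫ (M 0) (λ z → ∫ (M 0) (λ y → U z y * ∫ (M 0) (λ x → 1ℚ * agree 𝓑 x y))) +
            (ℕ→ℚ 0 * (Λ + Λ) + 0ℚ) ∎
        }
        where open ≤-Reasoning
      coupling (suc m) V 0≤V ∫V≡1 = record
        { kernel         = kernel
        ; 0≤kernel       = λ { (b ∷ x) (c ∷ z) → 0≤* (T.0≤kernel b c) (C.0≤kernel b x z) }
        ; kernel-total   = kernel-total
        ; kernel-uniform = kernel-uniform
        ; kernel-agree   = kernel-agree
        }
        where
        F : Block → ℚ
        F b = ∫ (M m) (λ z → V (b ∷ z))
        0≤F : ∀ b → 0ℚ ≤ F b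
        0≤F b = average-nonneg (words-prob 𝓑 m) (λ z → 0≤V (b ∷ z))
        ∫F≡1 : ∫ W F ≡ 1ℚ
        ∫F≡1 = trans (sym (∫-∷ 𝓑 m V)) ∫V≡1
        p : Block → Block → ℚ
        -- The law of a block that keeps one random letter of b and draws the others afresh. When b
        -- has density `F`, the result has as density at c the mean of the marginals of `F` at the
        -- letters of c.
        p c b = β * agree 𝓐 c b
        module T = Transport W (weights≥0 (prob 𝓑)) 𝓑 F 0≤F ∫F≡1 p
          (λ c b → 0≤* 0≤β (agree≥0 𝓐 c b))
          (λ b → trans (∫-*ˡ W β _) (trans (cong (β *_) (agree-average 𝓐 B b)) (trans (*-comm β (ℕ→ℚ B)) Bβ≡1)))
        V′ : Block → Vec Block m → ℚ
        V′ x z = ∫ W (λ b → T.kernel x b * V (b ∷ z))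
        C : ∀ x → Coupling m (V′ x) (ℕ→ℚ m * (Λ + Λ) + cost R m (V′ x))
        C x = coupling m (V′ x) (λ z → average-nonneg (prob 𝓑) (λ b → 0≤* (T.0≤kernel x b) (0≤V (b ∷ z))))
          (begin
            ∫ (M m) (λ z → ∫ W (λ b → T.kernel x b * V (b ∷ z)))
              ≡⟨ ∫-swap (M m) W (λ z b → T.kernel x b * V (b ∷ z)) ⟩
            ∫ W (λ b → ∫ (M m) (λ z → T.kernel x b * V (b ∷ z)))
              ≡⟨ ∫-cong W (λ b → trans (∫-*ˡ (M m) (T.kernel x b) _) (*-comm (T.kernel x b) (F b))) ⟩
            ∫ W (λ b → F b * T.kernel x b)
              ≡⟨ T.kernel-uniform x ⟩
            1ℚ ∎)
          where open ≡-Reasoning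
        module C x = Coupling (C x)

        kernel : Vec Block (suc m) → Vec Block (suc m) → ℚ
        kernel (b ∷ x) (c ∷ z) = T.kernel b c * C.kernel b x z

        kernel-total : ∀ z → ∫ (M (suc m)) (λ x → kernel x z) ≡ 1ℚ
        kernel-total (c ∷ z) = begin
          ∫ (M (suc m)) (λ x → kernel x (c ∷ z))
            ≡⟨ ∫-∷ 𝓑 m (λ x → kernel x (c ∷ z)) ⟩
          ∫ W (λ b → ∫ (M m) (λ x → T.kernel b c * C.kernel b x z))
            ≡⟨ ∫-cong W (λ b → trans (∫-*ˡ (M m) (T.kernel b c) _)
                 (trans (cong (T.kernel b c *_) (C.kernel-total b z)) (*-identityʳ (T.kernel b c)))) ⟩
          ∫ W (λ b → T.kernel b c)
            ≡⟨ T.kernel-total c ⟩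
          1ℚ ∎
          where open ≡-Reasoning

        kernel-uniform : ∀ x → ∫ (M (suc m)) (λ z → V z * kernel x z) ≡ 1ℚ
        kernel-uniform (b ∷ x) = begin
          ∫ (M (suc m)) (λ z → V z * kernel (b ∷ x) z)
            ≡⟨ ∫-∷ 𝓑 m (λ z → V z * kernel (b ∷ x) z) ⟩
          ∫ W (λ c → ∫ (M m) (λ z → V (c ∷ z) * (T.kernel b c * C.kernel b x z)))
            ≡⟨ ∫-swap W (M m) (λ c z → V (c ∷ z) * (T.kernel b c * C.kernel b x z)) ⟩
          ∫ (M m) (λ z → ∫ W (λ c → V (c ∷ z) * (T.kernel b c * C.kernel b x z)))
            ≡⟨ ∫-cong (M m) (λ z → trans
                 (∫-cong W (λ c → eq (V (c ∷ z)) (T.kernel b c) (C.kernel b x z)))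
                 (∫-*ʳ W (λ c → T.kernel b c * V (c ∷ z)) (C.kernel b x z))) ⟩
          ∫ (M m) (λ z → V′ b z * C.kernel b x z)
            ≡⟨ C.kernel-uniform b x ⟩
          1ℚ ∎
          where
          open ≡-Reasoning
          eq : ∀ v k l → v * (k * l) ≡ k * v * l
          eq = solve-∀ ring

        -- By sifting, the first new block equals c with density `T.kernel c b`; the later blocks
        -- are coupled given the first new one.
        kernel-agreement : ∀ b z c y → ∫ (M (suc m)) (λ x → kernel x (b ∷ z) * agree 𝓑 x (c ∷ y)) ≡
          T.kernel c b + ∫ W (λ x₁ → T.kernel x₁ b * ∫ (M m) (λ x → C.kernel x₁ x z * agree 𝓑 x y))
        kernel-agreement b z c y = begin
          ∫ (M (suc m)) (λ x → kernel x (b ∷ z) * agree 𝓑 x (c ∷ y))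
            ≡⟨ ∫-∷ 𝓑 m (λ x → kernel x (b ∷ z) * agree 𝓑 x (c ∷ y)) ⟩
          ∫ W (λ x₁ → ∫ (M m) (λ x → T.kernel x₁ b * C.kernel x₁ x z * (δ 𝓑 x₁ c + agree 𝓑 x y)))
            ≡⟨ ∫-cong W (λ x₁ → trans
                 (∫-cong (M m) (λ x → eq (T.kernel x₁ b) (C.kernel x₁ x z) (δ 𝓑 x₁ c) (agree 𝓑 x y)))
                 (trans (∫-+ (M m) _ _) (cong₂ _+_
                   (trans (∫-*ˡ (M m) (δ 𝓑 x₁ c * T.kernel x₁ b) (λ x → C.kernel x₁ x z))
                          (trans (cong (δ 𝓑 x₁ c * T.kernel x₁ b *_) (C.kernel-total x₁ z))
                                 (*-identityʳ (δ 𝓑 x₁ c * T.kernel x₁ b))))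
                   (∫-*ˡ (M m) (T.kernel x₁ b) (λ x → C.kernel x₁ x z * agree 𝓑 x y))))) ⟩
          ∫ W (λ x₁ → δ 𝓑 x₁ c * T.kernel x₁ b + T.kernel x₁ b * ∫ (M m) (λ x → C.kernel x₁ x z * agree 𝓑 x y))
            ≡⟨ trans (∫-+ W _ _) (cong (_+ ∫ W (λ x₁ → T.kernel x₁ b * ∫ (M m) (λ x → C.kernel x₁ x z * agree 𝓑 x y)))
                                       (δ-sift 𝓑 (λ x₁ → T.kernel x₁ b) c)) ⟩
          T.kernel c b + ∫ W (λ x₁ → T.kernel x₁ b * ∫ (M m) (λ x → C.kernel x₁ x z * agree 𝓑 x y)) ∎
          where
          open ≡-Reasoning
          eq : ∀ k l d a → k * l * (d + a) ≡ d * k * l + k * (l * a)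
          eq = solve-∀ ring

        first-loss : ℕ→ℚ B * ∫ W (λ c → posPart (T.f c - 1ℚ)) ≤ (Λ + Λ) + overflow 𝓐 B F (R * ∫ W F)
        first-loss = begin
          ℕ→ℚ B * ∫ W (λ c → posPart (T.f c - 1ℚ))
            ≤⟨ *-monoˡ-≤ (ℕ→ℚ B) (0≤ℕ→ℚ B) (average-mono (prob 𝓑) pointwise) ⟩
          ℕ→ℚ B * ∫ W (λ c → β * posPart (h c - ℕ→ℚ B))
            ≡⟨ trans (cong (ℕ→ℚ B *_) (∫-*ˡ W β _)) (trans (sym (*-assoc (ℕ→ℚ B) β _))
                 (trans (cong (_* ∫ W (λ c → posPart (h c - ℕ→ℚ B))) Bβ≡1) (*-identityˡ _))) ⟩
          ∫ W (λ c → posPart (h c - ℕ→ℚ B))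
            ≤⟨ concentration 𝓐 R 0≤R Λ ι 0≤Λ 0≤ι Λι≡1 B F 0≤F ∫F≡1 hΛ ⟩
          (Λ + Λ) + overflow 𝓐 B F R
            ≡⟨ cong (λ r → (Λ + Λ) + overflow 𝓐 B F r) (sym (trans (cong (R *_) ∫F≡1) (*-identityʳ R))) ⟩
          (Λ + Λ) + overflow 𝓐 B F (R * ∫ W F) ∎
          where
          open ≤-Reasoning
          h : Block → ℚ
          h c = ∫ W (λ b → F b * agree 𝓐 c b)
          f≡βh : ∀ c → T.f c ≡ β * h c
          f≡βh c = trans (∫-cong W (λ b → eq (F b) β (agree 𝓐 c b))) (∫-*ˡ W β _)
            where
            eq : ∀ f b a → f * (b * a) ≡ b * (f * a)
            eq = solve-∀ ring
          pointwise : ∀ c → posPart (T.f c - 1ℚ) ≤ β * posPart (h c - ℕ→ℚ B)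
          pointwise c = pos-lub (begin
            T.f c - 1ℚ                  ≡⟨ cong₂ _-_ (f≡βh c) (sym Bβ≡1) ⟩
            β * h c - ℕ→ℚ B * β         ≡⟨ eq β (h c) (ℕ→ℚ B) ⟩
            β * (h c - ℕ→ℚ B)           ≤⟨ *-monoˡ-≤ β 0≤β (≤pos (h c - ℕ→ℚ B)) ⟩
            β * posPart (h c - ℕ→ℚ B)   ∎) (0≤* 0≤β (0≤pos (h c - ℕ→ℚ B)))
            where
            eq : ∀ b x n → b * x - n * b ≡ b * (x - n)
            eq = solve-∀ ring

        -- `V′ x` mixes the densities given b with weights that average to one over x. By convexity,
        -- conditioning on x instead of b does not raise the average cost.
        cost-V′ : ∫ W (λ x → cost R m (V′ x)) ≤ ∫ W (λ b → cost R m (λ z → V (b ∷ z)))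
        cost-V′ = begin
          ∫ W (λ x → cost R m (V′ x))
            ≤⟨ average-mono (prob 𝓑) (λ x → ≤-trans
                 (≤-reflexive (cost-cong R m (λ z → sym (∫-▹ (T.kernel x) W (λ b → V (b ∷ z))))))
                 (≤-trans (cost-mixture R m (▹-nonneg (T.0≤kernel x) (weights≥0 (prob 𝓑))) (λ b z → V (b ∷ z)))
                          (≤-reflexive (∫-▹ (T.kernel x) W (λ b → cost R m (λ z → V (b ∷ z))))))) ⟩
          ∫ W (λ x → ∫ W (λ b → T.kernel x b * cost R m (λ z → V (b ∷ z))))
            ≡⟨ ∫-swap W W (λ x b → T.kernel x b * cost R m (λ z → V (b ∷ z))) ⟩
          ∫ W (λ b → ∫ W (λ x → T.kernel x b * cost R m (λ z → V (b ∷ z))))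
            ≡⟨ ∫-cong W (λ b → trans (∫-*ʳ W (λ x → T.kernel x b) _)
                 (trans (cong (_* cost R m (λ z → V (b ∷ z))) (T.kernel-total b)) (*-identityˡ _))) ⟩
          ∫ W (λ b → cost R m (λ z → V (b ∷ z))) ∎
          where open ≤-Reasoning

        module _ (U : Vec Block (suc m) → Vec Block (suc m) → ℚ)
                 (0≤U : ∀ z y → 0ℚ ≤ U z y) (U≤V : ∀ z y → U z y ≤ V z) where
          private
            G = first-blocks m U
            U′ : Block → Vec Block m → Vec Block m → ℚ
            U′ x = later-blocks m U (T.kernel x)
            Φ : Block → Vec Block m → Vec Block m → ℚ
            Φ x₁ z y = ∫ (M m) (λ x → C.kernel x₁ x z * agree 𝓑 x y)
            L₁ = ∫ W (λ b → ∫ W (λ c → G b c * agree 𝓐 b c))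
            L₂ = ∫ W (λ x → ∫ (M m) (λ z → ∫ (M m) (λ y → U′ x z y * agree-blocks z y)))
            R₁ = ∫ W (λ b → ∫ W (λ c → G b c * T.kernel c b))
            R₂ = ∫ W (λ x → ∫ (M m) (λ z → ∫ (M m) (λ y → U′ x z y * Φ x z y)))

          0≤G : ∀ b c → 0ℚ ≤ G b c
          0≤G b c = average-nonneg (words-prob 𝓑 m) (λ z → average-nonneg (words-prob 𝓑 m) (λ y → 0≤U (b ∷ z) (c ∷ y)))

          -- Thanks to this bound the loss of the first block is charged to `F`, whatever the test
          -- weight.
          G≤F : ∀ b c → G b c ≤ F b
          G≤F b c = average-mono (words-prob 𝓑 m) (λ z → average-≤ (words-prob 𝓑 m) _ (λ y → U≤V (b ∷ z) (c ∷ y)))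

          first-part : L₁ ≤ ℕ→ℚ B * R₁ + ((Λ + Λ) + overflow 𝓐 B F (R * ∫ W F))
          first-part = begin
            ∫ W (λ b → ∫ W (λ c → G b c * agree 𝓐 b c))
              ≤⟨ average-mono (prob 𝓑) (λ b → average-mono (prob 𝓑) (λ c → pointwise b c)) ⟩
            ∫ W (λ b → ∫ W (λ c → ℕ→ℚ B * (G b c * T.kernel c b + F b * p c b * T.loss c)))
              ≡⟨ trans (∫-cong W (λ b → ∫-*ˡ W (ℕ→ℚ B) _)) (∫-*ˡ W (ℕ→ℚ B) _) ⟩
            ℕ→ℚ B * ∫ W (λ b → ∫ W (λ c → G b c * T.kernel c b + F b * p c b * T.loss c))
              ≡⟨ cong (ℕ→ℚ B *_) (trans (∫-cong W (λ b → ∫-+ W _ _)) (∫-+ W _ _)) ⟩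
            ℕ→ℚ B * (R₁ + ∫ W (λ b → ∫ W (λ c → F b * p c b * T.loss c)))
              ≡⟨ trans (*-distribˡ-+ (ℕ→ℚ B) R₁ _) (cong (λ s → ℕ→ℚ B * R₁ + ℕ→ℚ B * s)
                   (trans (∫-swap W W (λ b c → F b * p c b * T.loss c))
                          (∫-cong W (λ c → ∫-*ʳ W (λ b → F b * p c b) (T.loss c))))) ⟩
            ℕ→ℚ B * R₁ + ℕ→ℚ B * ∫ W (λ c → T.f c * T.loss c)
              ≤⟨ +-monoʳ-≤ (ℕ→ℚ B * R₁) (≤-trans (*-monoˡ-≤ (ℕ→ℚ B) (0≤ℕ→ℚ B) T.loss-average) first-loss) ⟩
            ℕ→ℚ B * R₁ + ((Λ + Λ) + overflow 𝓐 B F (R * ∫ W F)) ∎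
            where
            open ≤-Reasoning
            pointwise : ∀ b c → G b c * agree 𝓐 b c ≤ ℕ→ℚ B * (G b c * T.kernel c b + F b * p c b * T.loss c)
            pointwise b c = begin
              G b c * agree 𝓐 b c
                ≡⟨ trans (cong (G b c *_) (trans (agree-sym 𝓐 b c) (trans (sym (*-identityˡ _))
                     (cong (_* agree 𝓐 c b) (sym Bβ≡1))))) (eq (G b c) (ℕ→ℚ B) β (agree 𝓐 c b)) ⟩
              ℕ→ℚ B * (G b c * p c b)
                ≤⟨ *-monoˡ-≤ (ℕ→ℚ B) (0≤ℕ→ℚ B) (*-monoˡ-≤ (G b c) (0≤G b c) (T.kernel-close c b)) ⟩
              ℕ→ℚ B * (G b c * (T.kernel c b + p c b * T.loss c))
                ≡⟨ cong (ℕ→ℚ B *_) (eq₂ (G b c) (T.kernel c b) (p c b * T.loss c)) ⟩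
              ℕ→ℚ B * (G b c * T.kernel c b + G b c * (p c b * T.loss c))
                ≤⟨ *-monoˡ-≤ (ℕ→ℚ B) (0≤ℕ→ℚ B) (+-monoʳ-≤ (G b c * T.kernel c b) (≤-trans
                     (*-monoʳ-≤ (p c b * T.loss c) (0≤* (0≤* 0≤β (agree≥0 𝓐 c b)) (T.0≤loss c)) (G≤F b c))
                     (≤-reflexive (sym (*-assoc (F b) (p c b) (T.loss c)))))) ⟩
              ℕ→ℚ B * (G b c * T.kernel c b + F b * p c b * T.loss c) ∎
              where
              eq : ∀ g n b a → g * (n * b * a) ≡ n * (g * (b * a))
              eq = solve-∀ ring
              eq₂ : ∀ g k l → g * (k + l) ≡ g * k + g * l
              eq₂ = solve-∀ ring

          later-part : L₂ ≤ ℕ→ℚ B * R₂ + (ℕ→ℚ m * (Λ + Λ) + ∫ W (λ b → cost R m (λ z → V (b ∷ z))))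
          later-part = begin
            L₂
              ≤⟨ average-mono (prob 𝓑) (λ x → C.kernel-agree x (U′ x)
                   (λ z y → average-nonneg (prob 𝓑) (λ b → average-nonneg (prob 𝓑) (λ c →
                     0≤* (T.0≤kernel x b) (0≤U (b ∷ z) (c ∷ y)))))
                   (λ z y → average-mono (prob 𝓑) (λ b → average-≤ (prob 𝓑) _ (λ c →
                     *-monoˡ-≤ (T.kernel x b) (T.0≤kernel x b) (U≤V (b ∷ z) (c ∷ y)))))) ⟩
            ∫ W (λ x → ℕ→ℚ B * ∫ (M m) (λ z → ∫ (M m) (λ y → U′ x z y * Φ x z y)) +
                       (ℕ→ℚ m * (Λ + Λ) + cost R m (V′ x)))
              ≡⟨ trans (∫-+ W _ _) (cong₂ _+_ (∫-*ˡ W (ℕ→ℚ B) _)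
                   (trans (∫-+ W (λ _ → ℕ→ℚ m * (Λ + Λ)) (λ x → cost R m (V′ x)))
                          (cong (_+ ∫ W (λ x → cost R m (V′ x))) (average-const (prob 𝓑) (ℕ→ℚ m * (Λ + Λ)))))) ⟩
            ℕ→ℚ B * R₂ + (ℕ→ℚ m * (Λ + Λ) + ∫ W (λ x → cost R m (V′ x)))
              ≤⟨ +-monoʳ-≤ (ℕ→ℚ B * R₂) (+-monoʳ-≤ (ℕ→ℚ m * (Λ + Λ)) cost-V′) ⟩
            ℕ→ℚ B * R₂ + (ℕ→ℚ m * (Λ + Λ) + ∫ W (λ b → cost R m (λ z → V (b ∷ z)))) ∎
            where open ≤-Reasoning

          kernel-agree :
            ∫ (M (suc m)) (λ z → ∫ (M (suc m)) (λ y → U z y * agree-blocks z y)) ≤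
            ℕ→ℚ B * ∫ (M (suc m)) (λ z → ∫ (M (suc m)) (λ y →
              U z y * ∫ (M (suc m)) (λ x → kernel x z * agree 𝓑 x y))) +
            (ℕ→ℚ (suc m) * (Λ + Λ) + cost R (suc m) V)
          kernel-agree = begin
            ∫ (M (suc m)) (λ z → ∫ (M (suc m)) (λ y → U z y * agree-blocks z y))
              ≡⟨ ∫-blocks m U (agree 𝓐) T.kernel (λ _ → agree-blocks) agree-blocks
                   (λ b z c y → cong (agree 𝓐 b c +_) (sym (trans (∫-*ʳ W (λ x → T.kernel x b) _)
                     (trans (cong (_* agree-blocks z y) (T.kernel-total b)) (*-identityˡ _))))) ⟩
            L₁ + L₂
              ≤⟨ +-mono-≤ first-part later-part ⟩
            (ℕ→ℚ B * R₁ + ((Λ + Λ) + o)) + (ℕ→ℚ B * R₂ + (ℕ→ℚ m * (Λ + Λ) + k))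
              ≡⟨ eq (ℕ→ℚ B) R₁ (Λ + Λ) o R₂ (ℕ→ℚ m) k ⟩
            ℕ→ℚ B * (R₁ + R₂) + ((1ℚ + ℕ→ℚ m) * (Λ + Λ) + (o + k))
              ≡⟨ cong₂ (λ s n → ℕ→ℚ B * s + (n * (Λ + Λ) + (o + k)))
                   (sym (∫-blocks m U (λ b c → T.kernel c b) T.kernel Φ _ kernel-agreement)) (sym (ℕ→ℚ-suc m)) ⟩
            ℕ→ℚ B * ∫ (M (suc m)) (λ z → ∫ (M (suc m)) (λ y →
              U z y * ∫ (M (suc m)) (λ x → kernel x z * agree 𝓑 x y))) +
            (ℕ→ℚ (suc m) * (Λ + Λ) + cost R (suc m) V) ∎
            where
            open ≤-Reasoning
            o = overflow 𝓐 B F (R * ∫ W F)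
            k = ∫ W (λ b → cost R m (λ z → V (b ∷ z)))
            eq : ∀ n r l o s m k → (n * r + (l + o)) + (n * s + (m * l + k)) ≡ n * (r + s) + ((1ℚ + m) * l + (o + k))
            eq = solve-∀ ring

-- Fixed-length protocols, players, and conditioning on a message

module RoundElimination where
  open import Data.Rational.Base
  open import Data.Rational.Properties
  open import Tactic.RingSolver using (solve-∀)
  open RationalOrder
  open Integral
  open Alphabets
  open BlockCoupling

  indicator : Bool → ℚ
  indicator b = if b then 1ℚ else 0ℚ

  0≤indicator : ∀ b → 0ℚ ≤ indicator b
  0≤indicator false = ≤-refl
  0≤indicator true  = 0≤1

  indicator≤1 : ∀ b → indicator b ≤ 1ℚ
  indicator≤1 false = 0≤1
  indicator≤1 true  = ≤-refl

  bits : Alphabet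
  bits = record
    { Symbol  = Bool
    ; uniform = (½ , false) ∷ (½ , true) ∷ []
    ; prob    = record { weights≥0 = nonNegative⁻¹ ½ ∷ nonNegative⁻¹ ½ ∷ [] ; total = refl }
    ; δ       = δ₂
    ; δ≥0     = λ { false false → 0≤2 ; false true → ≤-refl ; true false → ≤-refl ; true true → 0≤2 }
    ; δ-sym   = λ { false false → refl ; false true → refl ; true false → refl ; true true → refl }
    ; δ-sift  = λ { g false → siftˡ (g false) (g true) ; g true → siftʳ (g false) (g true) }
    }
    where
    δ₂ : Bool → Bool → ℚ
    δ₂ false false = 2ℚ
    δ₂ true  true  = 2ℚ
    δ₂ _     _     = 0ℚ
    0≤2 : 0ℚ ≤ 2ℚ
    0≤2 = nonNegative⁻¹ 2ℚ
    siftˡ : ∀ x y → ½ * (2ℚ * x) + (½ * (0ℚ * y) + 0ℚ) ≡ x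
    siftˡ = solve-∀ ring
    siftʳ : ∀ x y → ½ * (0ℚ * x) + (½ * (2ℚ * y) + 0ℚ) ≡ y
    siftʳ = solve-∀ ring

  bits-δ≤2 : ∀ a b → δ bits a b ≤ 2ℚ
  bits-δ≤2 false false = ≤-refl
  bits-δ≤2 false true  = nonNegative⁻¹ 2ℚ
  bits-δ≤2 true  false = nonNegative⁻¹ 2ℚ
  bits-δ≤2 true  true  = ≤-refl

  -- The factor by which one message of c bits can raise the density of its sender's law, apart from
  -- the normalisation.
  δ-bits≤ : ∀ c (x y : Vec Bool c) → δ-words bits x y ≤ ℕ→ℚ (2 ℕ.^ c)
  δ-bits≤ zero    []      []      = ≤-refl
  δ-bits≤ (suc c) (a ∷ x) (b ∷ y) = begin
    δ bits a b * δ-words bits x y ≤⟨ *-mono-≤ (δ≥0 bits a b) (0≤ℕ→ℚ (2 ℕ.^ c)) (bits-δ≤2 a b) (δ-bits≤ c x y) ⟩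
    2ℚ * ℕ→ℚ (2 ℕ.^ c)            ≡⟨ ℕ→ℚ-* 2 (2 ℕ.^ c) ⟨
    ℕ→ℚ (2 ℕ.^ suc c)             ∎
    where open ≤-Reasoning

  -- The normal form for elimination: exactly r messages of exactly c bits, the roles of `P` and `Q`
  -- changing with each.
  data Protocol (c : ℕ) (P Q : Set) : ℕ → Set where
    declare : (P → Bool) → Protocol c P Q zero
    send    : ∀ {r} → (P → Vec Bool c) → (Vec Bool c → Protocol c Q P r) → Protocol c P Q (suc r)

  eval : ∀ {c P Q r} → Protocol c P Q r → P → Q → Bool
  eval (declare f) p q = f p
  eval (send f g)  p q = eval (g (f p)) q p

  comap : ∀ {c P Q P′ Q′ r} → (P′ → P) → (Q′ → Q) → Protocol c P Q r → Protocol c P′ Q′ r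
  comap φ ψ (declare f) = declare (f ∘ φ)
  comap φ ψ (send f g)  = send (f ∘ φ) (λ m → comap ψ φ (g m))

  eval-comap : ∀ {c P Q P′ Q′ r} (φ : P′ → P) (ψ : Q′ → Q) (π : Protocol c P Q r) p q →
               eval (comap φ ψ π) p q ≡ eval π (φ p) (ψ q)
  eval-comap φ ψ (declare f) p q = refl
  eval-comap φ ψ (send f g)  p q = eval-comap ψ φ (g (f (φ p))) q p

  -- State and word are separated because elimination replaces the word by a fresh one over a larger
  -- alphabet, while the protocol goes on reading the old input kept in the state.
  record Player (𝓐 : Alphabet) (n : ℕ) : Set₁ where
    field
      State        : Set
      law          : Measure State
      law-prob     : Probability law
      word         : State → Vec (Symbol 𝓐) n
      word-uniform : ∀ (g : Vec (Symbol 𝓐) n → ℚ) →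
                     ∫ law (λ s → g (word s)) ≡ ∫ (uniform-words 𝓐 n) g

  open Player public

  module _ (𝓐 : Alphabet) where

    ∫-take-drop : ∀ k l (f : Vec (Symbol 𝓐) k → Vec (Symbol 𝓐) l → ℚ) →
      ∫ (uniform-words 𝓐 (k ℕ.+ l)) (λ v → f (take k v) (drop k v)) ≡
      ∫ (uniform-words 𝓐 k) (λ x → ∫ (uniform-words 𝓐 l) (λ y → f x y))
    ∫-take-drop zero    l f = sym (∫-[] 𝓐 (λ x → ∫ (uniform-words 𝓐 l) (λ y → f x y)))
    ∫-take-drop (suc k) l f = trans (∫-∷ 𝓐 (k ℕ.+ l) _) (trans
      (∫-cong (uniform 𝓐) (λ a → ∫-take-drop k l (λ x y → f (a ∷ x) y)))
      (sym (∫-∷ 𝓐 k _)))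

    agree-take-drop : ∀ k {l} (x y : Vec (Symbol 𝓐) (k ℕ.+ l)) →
      agree 𝓐 x y ≡ agree 𝓐 (take k x) (take k y) + agree 𝓐 (drop k x) (drop k y)
    agree-take-drop zero    x       y       = sym (+-identityˡ (agree 𝓐 x y))
    agree-take-drop (suc k) (a ∷ x) (b ∷ y) = trans (cong (δ 𝓐 a b +_) (agree-take-drop k x y))
      (sym (+-assoc (δ 𝓐 a b) (agree 𝓐 (take k x) (take k y)) (agree 𝓐 (drop k x) (drop k y))))

    module _ (B : ℕ) where

      chunks : ∀ m → Vec (Symbol 𝓐) (m ℕ.* B) → Vec (Vec (Symbol 𝓐) B) m
      chunks zero    v = []
      chunks (suc m) v = take B v ∷ chunks m (drop B v)

      chunks-uniform : ∀ m (g : Vec (Vec (Symbol 𝓐) B) m → ℚ) →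
        ∫ (uniform-words 𝓐 (m ℕ.* B)) (λ v → g (chunks m v)) ≡ ∫ (uniform-words (power 𝓐 B) m) g
      chunks-uniform zero    g = trans (∫-[] 𝓐 (λ v → g [])) (sym (∫-[] (power 𝓐 B) g))
      chunks-uniform (suc m) g = trans (∫-take-drop B (m ℕ.* B) (λ x v → g (x ∷ chunks m v))) (trans
        (∫-cong (uniform-words 𝓐 B) (λ x → chunks-uniform m (λ z → g (x ∷ z))))
        (sym (∫-∷ (power 𝓐 B) m g)))

      agree-chunks : ∀ m x y → agree 𝓐 x y ≡ agree-blocks 𝓐 B (chunks m x) (chunks m y)
      agree-chunks zero    [] [] = refl
      agree-chunks (suc m) x  y  = trans (agree-take-drop B x y)
        (cong (agree 𝓐 (take B x) (take B y) +_) (agree-chunks m (drop B x) (drop B y)))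

      regroup : ∀ m → Player 𝓐 (m ℕ.* B) → Player (power 𝓐 B) m
      regroup m A = record
        { State        = State A
        ; law          = law A
        ; law-prob     = law-prob A
        ; word         = λ s → chunks m (word A s)
        ; word-uniform = λ g → trans (word-uniform A (λ v → g (chunks m v))) (chunks-uniform m g)
        }

  -- Alice's state conditioned on her first message has density h.  Her
  -- new word is a fresh uniform x drawn from the coupling with her old
  -- one; Bob's words are only regrouped.
  module Condition {𝓐 : Alphabet} {B m : ℕ} (A : Player 𝓐 (m ℕ.* B))
                   (h : State A → ℚ) (0≤h : ∀ s → 0ℚ ≤ h s) (∫h≡1 : ∫ (law A) h ≡ 1ℚ) where
    private
      𝓑 = power 𝓐 B
      M = uniform-words 𝓑 m
      Z = word (regroup 𝓐 B m A)
      μ = law A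

    -- `δ-words` acts as a point mass: this is the density of the regrouped word, against uniform
    -- words, when the state has density `h`.
    density : Vec (Symbol 𝓑) m → ℚ
    density z = ∫ μ (λ s → h s * δ-words 𝓑 (Z s) z)

    0≤density : ∀ z → 0ℚ ≤ density z
    0≤density z = average-nonneg (law-prob A) (λ s → 0≤* (0≤h s) (δ-words≥0 𝓑 (Z s) z))

    ∫-density : ∀ (k : Vec (Symbol 𝓑) m → ℚ) → ∫ M (λ z → density z * k z) ≡ ∫ μ (λ s → h s * k (Z s))
    ∫-density k = begin
      ∫ M (λ z → density z * k z)
        ≡⟨ ∫-cong M (λ z → sym (∫-*ʳ μ _ (k z))) ⟩
      ∫ M (λ z → ∫ μ (λ s → h s * δ-words 𝓑 (Z s) z * k z))
        ≡⟨ ∫-swap M μ (λ z s → h s * δ-words 𝓑 (Z s) z * k z) ⟩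
      ∫ μ (λ s → ∫ M (λ z → h s * δ-words 𝓑 (Z s) z * k z))
        ≡⟨ ∫-cong μ (λ s → trans (∫-cong M (λ z → *-assoc (h s) (δ-words 𝓑 (Z s) z) (k z)))
             (trans (∫-*ˡ M (h s) _) (cong (h s *_) (δ-siftˡ (power 𝓑 m) k (Z s))))) ⟩
      ∫ μ (λ s → h s * k (Z s)) ∎
      where open ≡-Reasoning

    density-average : ∫ M density ≡ 1ℚ
    density-average = trans (∫-cong M (λ z → sym (*-identityʳ (density z))))
      (trans (∫-density (λ _ → 1ℚ)) (trans (∫-cong μ (λ s → *-identityʳ (h s))) ∫h≡1))

    -- The word is uniform before conditioning, so passing from states to words cannot raise the
    -- maximum of the density.
    density≤ : ∀ Δ → (∀ s → h s ≤ Δ) → ∀ z → density z ≤ Δ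
    density≤ Δ h≤Δ z = begin
      ∫ μ (λ s → h s * δ-words 𝓑 (Z s) z)
        ≤⟨ average-mono (law-prob A) (λ s → *-monoʳ-≤ (δ-words 𝓑 (Z s) z) (δ-words≥0 𝓑 (Z s) z) (h≤Δ s)) ⟩
      ∫ μ (λ s → Δ * δ-words 𝓑 (Z s) z)
        ≡⟨ ∫-*ˡ μ Δ _ ⟩
      Δ * ∫ μ (λ s → δ-words 𝓑 (Z s) z)
        ≡⟨ cong (Δ *_) (trans (word-uniform (regroup 𝓐 B m A) (λ x → δ-words 𝓑 x z)) (δ-total (power 𝓑 m) z)) ⟩
      Δ * 1ℚ
        ≡⟨ *-identityʳ Δ ⟩
      Δ ∎
      where open ≤-Reasoning

    module _ {loss : ℚ} (K : Coupling 𝓐 B m density loss) where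
      open Coupling K

      conditioned-law : Measure (State A × Vec (Symbol 𝓑) m)
      conditioned-law = (λ (s , x) → h s * kernel x (Z s)) ▹ (μ ⊗ M)

      ∫-conditioned : ∀ (f : State A → Vec (Symbol 𝓑) m → ℚ) →
        ∫ conditioned-law (λ (s , x) → f s x) ≡ ∫ μ (λ s → h s * ∫ M (λ x → kernel x (Z s) * f s x))
      ∫-conditioned f = trans (∫-▹ _ (μ ⊗ M) _) (trans (∫-⊗ μ M _)
        (∫-cong μ (λ s → trans (∫-cong M (λ x → *-assoc (h s) (kernel x (Z s)) (f s x))) (∫-*ˡ M (h s) _))))

      ∫-conditioned-state : ∀ (f : State A → ℚ) →
        ∫ conditioned-law (λ (s , x) → f s) ≡ ∫ μ (λ s → h s * f s)
      ∫-conditioned-state f = trans (∫-conditioned (λ s x → f s))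
        (∫-cong μ (λ s → cong (h s *_) (trans (∫-*ʳ M _ (f s))
          (trans (cong (_* f s) (kernel-total (Z s))) (*-identityˡ (f s))))))

      conditioned : Player 𝓑 m
      conditioned = record
        { State        = State A × Vec (Symbol 𝓑) m
        ; law          = conditioned-law
        ; law-prob     = record
          { weights≥0 = ▹-nonneg (λ (s , x) → 0≤* (0≤h s) (0≤kernel x (Z s)))
                          (⊗-nonneg (weights≥0 (law-prob A)) (weights≥0 (words-prob 𝓑 m)))
          ; total     = trans (∫-conditioned-state (λ _ → 1ℚ))
                              (trans (∫-cong μ (λ s → *-identityʳ (h s))) ∫h≡1)
          }
        ; word         = proj₂
        ; word-uniform = λ g → begin
            ∫ conditioned-law (λ (s , x) → g x)
              ≡⟨ ∫-conditioned (λ s x → g x) ⟩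
            ∫ μ (λ s → h s * ∫ M (λ x → kernel x (Z s) * g x))
              ≡⟨ ∫-density (λ z → ∫ M (λ x → kernel x z * g x)) ⟨
            ∫ M (λ z → density z * ∫ M (λ x → kernel x z * g x))
              ≡⟨ ∫-cong M (λ z → trans (sym (∫-*ˡ M (density z) _))
                   (∫-cong M (λ x → sym (*-assoc (density z) (kernel x z) (g x))))) ⟩
            ∫ M (λ z → ∫ M (λ x → density z * kernel x z * g x))
              ≡⟨ ∫-swap M M (λ z x → density z * kernel x z * g x) ⟩
            ∫ M (λ x → ∫ M (λ z → density z * kernel x z * g x))
              ≡⟨ ∫-cong M (λ x → trans (∫-*ʳ M _ (g x))
                   (trans (cong (_* g x) (kernel-uniform x)) (*-identityˡ (g x)))) ⟩
            ∫ M g ∎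
        }
        where open ≡-Reasoning

      module _ (C : Player 𝓐 (m ℕ.* B)) where
        private
          ν = law C
          Y = word (regroup 𝓐 B m C)

        -- `kernel-agree` carried over from words to states: `f` is the acceptance of the remaining
        -- protocol, and `U` integrates it over the states with given words.
        conditioned-agree : ∀ (f : State A → State C → ℚ) → (∀ s t → 0ℚ ≤ f s t) → (∀ s t → f s t ≤ 1ℚ) →
          ∫ μ (λ s → h s * ∫ ν (λ t → agree 𝓐 (word A s) (word C t) * f s t)) ≤
          ℕ→ℚ B * ∫ conditioned-law (λ (s , x) → ∫ ν (λ t → agree 𝓑 x (Y t) * f s t)) + loss
        conditioned-agree f 0≤f f≤1 = subst₂ (λ l r → l ≤ ℕ→ℚ B * r + loss) (sym lhs) (sym rhs)
          (kernel-agree U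
            (λ z y → average-nonneg (law-prob A) (λ s → 0≤* (0≤* (0≤h s) (δ-words≥0 𝓑 (Z s) z))
              (average-nonneg (law-prob C) (λ t → 0≤* (δ-words≥0 𝓑 (Y t) y) (0≤f s t)))))
            (λ z y → average-mono (law-prob A) (λ s → begin
              h s * δ-words 𝓑 (Z s) z * ∫ ν (λ t → δ-words 𝓑 (Y t) y * f s t)
                ≤⟨ *-monoˡ-≤ (h s * δ-words 𝓑 (Z s) z) (0≤* (0≤h s) (δ-words≥0 𝓑 (Z s) z))
                     (average-mono (law-prob C) (λ t → *-monoˡ-≤ (δ-words 𝓑 (Y t) y) (δ-words≥0 𝓑 (Y t) y) (f≤1 s t))) ⟩
              h s * δ-words 𝓑 (Z s) z * ∫ ν (λ t → δ-words 𝓑 (Y t) y * 1ℚ)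
                ≡⟨ cong (h s * δ-words 𝓑 (Z s) z *_) (trans (∫-cong ν (λ t → *-identityʳ (δ-words 𝓑 (Y t) y)))
                     (trans (word-uniform (regroup 𝓐 B m C) (λ x → δ-words 𝓑 x y)) (δ-total (power 𝓑 m) y))) ⟩
              h s * δ-words 𝓑 (Z s) z * 1ℚ
                ≡⟨ *-identityʳ (h s * δ-words 𝓑 (Z s) z) ⟩
              h s * δ-words 𝓑 (Z s) z ∎)))
          where
          open ≤-Reasoning
          U : Vec (Symbol 𝓑) m → Vec (Symbol 𝓑) m → ℚ
          U z y = ∫ μ (λ s → h s * δ-words 𝓑 (Z s) z * ∫ ν (λ t → δ-words 𝓑 (Y t) y * f s t))
          ∫U : ∀ (g : Vec (Symbol 𝓑) m → Vec (Symbol 𝓑) m → ℚ) →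
               ∫ M (λ z → ∫ M (λ y → U z y * g z y)) ≡ ∫ μ (λ s → h s * ∫ ν (λ t → g (Z s) (Y t) * f s t))
          ∫U g = begin-equality
            ∫ M (λ z → ∫ M (λ y → U z y * g z y))
              ≡⟨ ∫-cong M (λ z → ∫-cong M (λ y → trans (sym (∫-*ʳ μ _ (g z y)))
                   (∫-cong μ (λ s → trans (*-assoc (h s * δ-words 𝓑 (Z s) z) _ (g z y))
                     (cong (h s * δ-words 𝓑 (Z s) z *_) (sym (∫-*ʳ ν _ (g z y)))))))) ⟩
            ∫ M (λ z → ∫ M (λ y → ∫ μ (λ s → h s * δ-words 𝓑 (Z s) z * ∫ ν (λ t → δ-words 𝓑 (Y t) y * f s t * g z y))))
              ≡⟨ ∫∫-swap-nested M M μ (λ z y s →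
                   h s * δ-words 𝓑 (Z s) z * ∫ ν (λ t → δ-words 𝓑 (Y t) y * f s t * g z y)) ⟩
            ∫ μ (λ s → ∫ M (λ z → ∫ M (λ y → h s * δ-words 𝓑 (Z s) z * ∫ ν (λ t → δ-words 𝓑 (Y t) y * f s t * g z y))))
              ≡⟨ ∫-cong μ (λ s → trans
                   (∫-cong M (λ z → trans (∫-*ˡ M (h s * δ-words 𝓑 (Z s) z) _)
                     (trans (cong (h s * δ-words 𝓑 (Z s) z *_) (sift-y s z)) (*-assoc (h s) (δ-words 𝓑 (Z s) z) _))))
                   (trans (∫-*ˡ M (h s) _)
                     (cong (h s *_) (δ-siftˡ (power 𝓑 m) (λ z → ∫ ν (λ t → g z (Y t) * f s t)) (Z s))))) ⟩
            ∫ μ (λ s → h s * ∫ ν (λ t → g (Z s) (Y t) * f s t)) ∎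
            where
            eq : ∀ d f g → d * f * g ≡ d * (g * f)
            eq = solve-∀ ring
            sift-y : ∀ s z → ∫ M (λ y → ∫ ν (λ t → δ-words 𝓑 (Y t) y * f s t * g z y)) ≡
                             ∫ ν (λ t → g z (Y t) * f s t)
            sift-y s z = trans (∫-swap M ν (λ y t → δ-words 𝓑 (Y t) y * f s t * g z y))
              (∫-cong ν (λ t → trans (∫-cong M (λ y → eq (δ-words 𝓑 (Y t) y) (f s t) (g z y)))
                (δ-siftˡ (power 𝓑 m) (λ y → g z y * f s t) (Y t))))
          lhs : ∫ μ (λ s → h s * ∫ ν (λ t → agree 𝓐 (word A s) (word C t) * f s t)) ≡
                ∫ M (λ z → ∫ M (λ y → U z y * agree-blocks 𝓐 B z y))
          lhs = trans (∫-cong μ (λ s → cong (h s *_) (∫-cong ν (λ t →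
                  cong (_* f s t) (agree-chunks 𝓐 B m (word A s) (word C t))))))
                (sym (∫U (agree-blocks 𝓐 B)))
          rhs : ∫ conditioned-law (λ (s , x) → ∫ ν (λ t → agree 𝓑 x (Y t) * f s t)) ≡
                ∫ M (λ z → ∫ M (λ y → U z y * ∫ M (λ x → kernel x z * agree 𝓑 x y)))
          rhs = begin-equality
            ∫ conditioned-law (λ (s , x) → ∫ ν (λ t → agree 𝓑 x (Y t) * f s t))
              ≡⟨ ∫-conditioned (λ s x → ∫ ν (λ t → agree 𝓑 x (Y t) * f s t)) ⟩
            ∫ μ (λ s → h s * ∫ M (λ x → kernel x (Z s) * ∫ ν (λ t → agree 𝓑 x (Y t) * f s t)))
              ≡⟨ ∫-cong μ (λ s → cong (h s *_) (trans
                   (∫-cong M (λ x → trans (sym (∫-*ˡ ν (kernel x (Z s)) _))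
                     (∫-cong ν (λ t → sym (*-assoc (kernel x (Z s)) (agree 𝓑 x (Y t)) (f s t))))))
                   (trans (∫-swap M ν (λ x t → kernel x (Z s) * agree 𝓑 x (Y t) * f s t))
                     (∫-cong ν (λ t → ∫-*ʳ M _ (f s t)))))) ⟩
            ∫ μ (λ s → h s * ∫ ν (λ t → ∫ M (λ x → kernel x (Z s) * agree 𝓑 x (Y t)) * f s t))
              ≡⟨ ∫U (λ z y → ∫ M (λ x → kernel x z * agree 𝓑 x y)) ⟨
            ∫ M (λ z → ∫ M (λ y → U z y * ∫ M (λ x → kernel x z * agree 𝓑 x y))) ∎

-- Elimination of all rounds

module Elimination where
  open import Data.Rational.Base
  open import Data.Rational.Properties
  open import Tactic.RingSolver using (solve-∀)
  open RationalOrder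
  open Integral
  open Alphabets
  open Overflow
  open Transports
  open BlockCoupling
  open RoundElimination

  ℕ→ℚ-inverse : ∀ n → 1 ℕ.≤ n → ∃ λ y → 0ℚ ≤ y × ℕ→ℚ n * y ≡ 1ℚ
  ℕ→ℚ-inverse n 1≤n = inverse (ℕ→ℚ n) (<-≤-trans (positive⁻¹ 1ℚ) (ℕ→ℚ-mono {1} {n} 1≤n))

  -- B = R/ε² for R = 2^M and ε = 2^-e: the mean of B independent densities
  -- truncated at R has variance at most R/B = ε².
  blockSize : ℕ → ℕ → ℕ
  blockSize M e = 2 ℕ.^ M ℕ.* (2 ℕ.^ e ℕ.* 2 ℕ.^ e)

  -- Feasible c r e n: r rounds of messages of c bits can be eliminated
  -- from a problem of length n, the error of successive rounds being
  -- proportional to 2^-e, 2^-(e+1), …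
  data Feasible (c : ℕ) : ℕ → ℕ → ℕ → Set where
    done : ∀ {e n} → Feasible c 0 e n
    step : ∀ {r e m} M d →
           2 ℕ.^ (c ℕ.+ e) ℕ.* (m ℕ.* blockSize M e) ℕ.≤ 2 ℕ.^ (M ℕ.* d) →
           (d ℕ.+ 2) ℕ.* 2 ℕ.^ e ℕ.≤ 2 ℕ.* (m ℕ.* blockSize M e) →
           Feasible c r (suc e) m → Feasible c (suc r) e (m ℕ.* blockSize M e)

  threshold-power : ∀ M 1≤R θ 0≤θ d →
    threshold (ℕ→ℚ (2 ℕ.^ M)) 1≤R θ 0≤θ d ≡ θ * ℕ→ℚ (2 ℕ.^ (M ℕ.* d))
  threshold-power M 1≤R θ 0≤θ zero rewrite ℕ.*-zeroʳ M = sym (*-identityʳ θ)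
  threshold-power M 1≤R θ 0≤θ (suc d) = begin
    threshold R 1≤R θ 0≤θ d * R                   ≡⟨ cong (_* R) (threshold-power M 1≤R θ 0≤θ d) ⟩
    θ * ℕ→ℚ (2 ℕ.^ (M ℕ.* d)) * R                 ≡⟨ eq θ _ R ⟩
    θ * (R * ℕ→ℚ (2 ℕ.^ (M ℕ.* d)))               ≡⟨ cong (θ *_) (ℕ→ℚ-* (2 ℕ.^ M) _) ⟨
    θ * ℕ→ℚ (2 ℕ.^ M ℕ.* 2 ℕ.^ (M ℕ.* d))         ≡⟨ cong (λ k → θ * ℕ→ℚ k) (ℕ.^-distribˡ-+-* 2 M (M ℕ.* d)) ⟨
    θ * ℕ→ℚ (2 ℕ.^ (M ℕ.+ M ℕ.* d))               ≡⟨ cong (λ k → θ * ℕ→ℚ (2 ℕ.^ k)) (ℕ.*-suc M d) ⟨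
    θ * ℕ→ℚ (2 ℕ.^ (M ℕ.* suc d))                 ∎
    where
    open ≡-Reasoning
    R = ℕ→ℚ (2 ℕ.^ M)
    eq : ∀ t x r → t * x * r ≡ t * (r * x)
    eq = solve-∀ ring

  module _ (c e m M d : ℕ)
           (entropy≤ : 2 ℕ.^ (c ℕ.+ e) ℕ.* (m ℕ.* blockSize M e) ℕ.≤ 2 ℕ.^ (M ℕ.* d))
           (d≤ : (d ℕ.+ 2) ℕ.* 2 ℕ.^ e ℕ.≤ 2 ℕ.* (m ℕ.* blockSize M e)) where
    private
      B = blockSize M e
      n = m ℕ.* B
      R = ℕ→ℚ (2 ℕ.^ M)
      ε = half^ e
      E = ℕ→ℚ (2 ℕ.^ e)
      b = ℕ→ℚ B

      εE≡1 : ε * E ≡ 1ℚ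
      εE≡1 = half^-inverse e

      1≤2^ : ∀ k → 1 ℕ.≤ 2 ℕ.^ k
      1≤2^ k = ℕ.m^n>0 2 k

      1≤n : 1 ℕ.≤ n
      1≤n = ℕ.n≢0⇒n>0 (λ n≡0 → ℕ.<⇒≱ (ℕ.*-mono-≤ (ℕ.≤-trans (ℕ.s≤s ℕ.z≤n) (ℕ.m≤n+m 2 d)) (1≤2^ e))
                                       (ℕ.≤-trans d≤ (ℕ.≤-reflexive (cong (2 ℕ.*_) n≡0))))

      1≤B : 1 ℕ.≤ B
      1≤B = ℕ.*-mono-≤ (1≤2^ M) (ℕ.*-mono-≤ (1≤2^ e) (1≤2^ e))

      β = proj₁ (ℕ→ℚ-inverse B 1≤B)
      0≤β = proj₁ (proj₂ (ℕ→ℚ-inverse B 1≤B))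
      bβ≡1 = proj₂ (proj₂ (ℕ→ℚ-inverse B 1≤B))

      -- θ = 1/n, so that the additive θ per letter adds up to 1.
      θ = proj₁ (ℕ→ℚ-inverse n 1≤n)
      0≤θ = proj₁ (proj₂ (ℕ→ℚ-inverse n 1≤n))
      nθ≡1 = proj₂ (proj₂ (ℕ→ℚ-inverse n 1≤n))

      b≡ : b ≡ R * (E * E)
      b≡ = trans (ℕ→ℚ-* (2 ℕ.^ M) _) (cong (R *_) (ℕ→ℚ-* (2 ℕ.^ e) (2 ℕ.^ e)))

      1≤R : 1ℚ ≤ R
      1≤R = ℕ→ℚ-mono {1} (1≤2^ M)

      0≤R : 0ℚ ≤ R
      0≤R = 0≤ℕ→ℚ (2 ℕ.^ M)

      -- The loss 2Λ per block of B letters is 2ε per letter. The choice B = R/ε² makes `hΛ` an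
      -- equality.
      Λ = ε * b
      ι = E * β

      0≤Λ : 0ℚ ≤ Λ
      0≤Λ = 0≤* (0≤half^ e) (0≤ℕ→ℚ B)

      0≤ι : 0ℚ ≤ ι
      0≤ι = 0≤* (0≤ℕ→ℚ (2 ℕ.^ e)) 0≤β

      Λι≡1 : Λ * ι ≡ 1ℚ
      Λι≡1 = trans (eq ε b E β) (cong₂ _*_ εE≡1 bβ≡1)
        where
        eq : ∀ ε b E β → ε * b * (E * β) ≡ ε * E * (b * β)
        eq = solve-∀ ring

      hΛ : ι * (b * R) ≤ Λ
      hΛ = ≤-reflexive (begin
        E * β * (b * R)     ≡⟨ eq E β b R ⟩
        b * β * (R * E)     ≡⟨ cong (_* (R * E)) bβ≡1 ⟩
        1ℚ * (R * E)        ≡⟨ cong (_* (R * E)) εE≡1 ⟨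
        ε * E * (R * E)     ≡⟨ eq₂ ε E R ⟩
        ε * (R * (E * E))   ≡⟨ cong (ε *_) b≡ ⟨
        ε * b               ∎)
        where
        open ≡-Reasoning
        eq : ∀ E β b R → E * β * (b * R) ≡ b * β * (R * E)
        eq = solve-∀ ring
        eq₂ : ∀ ε E R → ε * E * (R * E) ≡ ε * (R * (E * E))
        eq₂ = solve-∀ ring

      Δ = ℕ→ℚ (2 ℕ.^ (c ℕ.+ e))

      -- The d + 1 thresholds lead from 1/n up to the density bound Δ in steps of factor `R`.
      Δ≤threshold : Δ ≤ threshold R 1≤R θ 0≤θ d
      Δ≤threshold = begin
        Δ                              ≡⟨ *-identityʳ Δ ⟨
        Δ * 1ℚ                         ≡⟨ cong (Δ *_) nθ≡1 ⟨
        Δ * (ℕ→ℚ n * θ)                ≡⟨ eq Δ (ℕ→ℚ n) θ ⟩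
        θ * (Δ * ℕ→ℚ n)                ≡⟨ cong (θ *_) (ℕ→ℚ-* (2 ℕ.^ (c ℕ.+ e)) n) ⟨
        θ * ℕ→ℚ (2 ℕ.^ (c ℕ.+ e) ℕ.* n) ≤⟨ *-monoˡ-≤ θ 0≤θ (ℕ→ℚ-mono entropy≤) ⟩
        θ * ℕ→ℚ (2 ℕ.^ (M ℕ.* d))      ≡⟨ threshold-power M 1≤R θ 0≤θ d ⟨
        threshold R 1≤R θ 0≤θ d        ∎
        where
        open ≤-Reasoning
        eq : ∀ D n t → D * (n * t) ≡ t * (D * n)
        eq = solve-∀ ring

      4ℚ = 2ℚ + 2ℚ
      5ℚ = 4ℚ + 1ℚ

    module _ {𝓐 : Alphabet} (A : Player 𝓐 n) (h : State A → ℚ) (0≤h : ∀ s → 0ℚ ≤ h s)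
             (∫h≡1 : ∫ (law A) h ≡ 1ℚ) (h≤Δ : ∀ s → h s ≤ ℕ→ℚ (2 ℕ.^ (c ℕ.+ e))) where
      open Condition {𝓐} {B} {m} A h 0≤h ∫h≡1

      round-loss : ℚ
      round-loss = ℕ→ℚ m * (Λ + Λ) + cost 𝓐 B R m density

      round-coupling : Coupling 𝓐 B m density round-loss
      round-coupling = coupling 𝓐 B R 0≤R β 0≤β bβ≡1 Λ ι 0≤Λ 0≤ι Λι≡1 hΛ m density 0≤density density-average

      -- Concentration costs 2ε per letter. The potential costs (d + 1) + 1, which `d≤` bounds by
      -- another 2ε per letter.
      round-loss≤ : round-loss ≤ ℕ→ℚ n * (4ℚ * ε)
      round-loss≤ = begin
        ℕ→ℚ m * (Λ + Λ) + cost 𝓐 B R m density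
          ≤⟨ +-monoʳ-≤ (ℕ→ℚ m * (Λ + Λ)) (≤-trans
               (cost-bound 𝓐 B R 1≤R θ 0≤θ d m density 0≤density
                 (λ z → ≤-trans (density≤ Δ h≤Δ z) Δ≤threshold)) cost≤) ⟩
        ℕ→ℚ m * (Λ + Λ) + 2ℚ * ε * ℕ→ℚ n
          ≡⟨ cong (λ x → ℕ→ℚ m * (Λ + Λ) + 2ℚ * ε * x) (ℕ→ℚ-* m B) ⟩
        ℕ→ℚ m * (ε * b + ε * b) + 2ℚ * ε * (ℕ→ℚ m * b)
          ≡⟨ eq (ℕ→ℚ m) ε b ⟩
        ℕ→ℚ m * b * (4ℚ * ε)
          ≡⟨ cong (_* (4ℚ * ε)) (ℕ→ℚ-* m B) ⟨
        ℕ→ℚ n * (4ℚ * ε) ∎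
        where
        open ≤-Reasoning
        eq : ∀ m ε b → m * (ε * b + ε * b) + 2ℚ * ε * (m * b) ≡ m * b * ((2ℚ + 2ℚ) * ε)
        eq = solve-∀ ring
        cost≤ : potential R 1≤R θ 0≤θ d (∫ (uniform-words (power 𝓐 B) m) density) + ℕ→ℚ n * θ ≤ 2ℚ * ε * ℕ→ℚ n
        cost≤ = begin
          potential R 1≤R θ 0≤θ d (∫ (uniform-words (power 𝓐 B) m) density) + ℕ→ℚ n * θ
            ≡⟨ cong₂ (λ v u → potential R 1≤R θ 0≤θ d v + u) density-average nθ≡1 ⟩
          potential R 1≤R θ 0≤θ d 1ℚ + 1ℚ
            ≤⟨ +-monoˡ-≤ 1ℚ (potential-1 R 1≤R θ 0≤θ d) ⟩
          ℕ→ℚ (suc d) + 1ℚ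
            ≡⟨ trans (+-comm (ℕ→ℚ (suc d)) 1ℚ) (sym (ℕ→ℚ-suc (suc d))) ⟩
          ℕ→ℚ (suc (suc d))
            ≡⟨ cong ℕ→ℚ (ℕ.+-comm 2 d) ⟩
          ℕ→ℚ (d ℕ.+ 2)
            ≡⟨ trans (sym (*-identityˡ _)) (cong (_* ℕ→ℚ (d ℕ.+ 2)) (sym εE≡1)) ⟩
          ε * E * ℕ→ℚ (d ℕ.+ 2)
            ≡⟨ trans (eq₁ ε E (ℕ→ℚ (d ℕ.+ 2))) (cong (ε *_) (sym (ℕ→ℚ-* (d ℕ.+ 2) (2 ℕ.^ e)))) ⟩
          ε * ℕ→ℚ ((d ℕ.+ 2) ℕ.* 2 ℕ.^ e)
            ≤⟨ *-monoˡ-≤ ε (0≤half^ e) (ℕ→ℚ-mono d≤) ⟩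
          ε * ℕ→ℚ (2 ℕ.* n)
            ≡⟨ trans (cong (ε *_) (ℕ→ℚ-* 2 n)) (eq₂ ε (ℕ→ℚ n)) ⟩
          2ℚ * ε * ℕ→ℚ n ∎
          where
          eq₁ : ∀ ε E k → ε * E * k ≡ ε * (k * E)
          eq₁ = solve-∀ ring
          eq₂ : ∀ ε n → ε * (2ℚ * n) ≡ 2ℚ * ε * n
          eq₂ = solve-∀ ring

  -- The solution of κ = 4 + κ/2 + 1: the coupling costs 4ε, the later rounds start from ε/2, and
  -- rare messages cost ε.
  10ℚ : ℚ
  10ℚ = (2ℚ + 2ℚ + 1ℚ) * 2ℚ

  ∫∫ : ∀ {𝓐 n} (A C : Player 𝓐 n) → (State A → State C → ℚ) → ℚ
  ∫∫ A C f = ∫ (law A) (λ s → ∫ (law C) (λ t → f s t))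

  -- Divided by n, the left side is the acceptance probability under planting, compared here with
  -- that under independence. The induction exchanges the players and enlarges the alphabet.
  decorrelation : ∀ {c r e n} → Feasible c r e n → ∀ (𝓐 : Alphabet) (A C : Player 𝓐 n)
    (π : Protocol c (State A) (State C) r) →
    ∫∫ A C (λ s t → agree 𝓐 (word A s) (word C t) * indicator (eval π s t)) ≤
    ℕ→ℚ n * ∫∫ A C (λ s t → indicator (eval π s t)) + ℕ→ℚ n * (10ℚ * half^ e)
  -- The output depends on one state alone, and given it the other word is still uniform, so there
  -- is no advantage at all.
  decorrelation {c} {e = e} {n} done 𝓐 A C (declare f) = begin
    ∫ (law A) (λ s → ∫ (law C) (λ t → agree 𝓐 (word A s) (word C t) * indicator (f s)))
      ≡⟨ ∫-cong (law A) (λ s → trans (∫-*ʳ (law C) _ (indicator (f s)))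
           (cong₂ _*_ (mean s) (sym (average-const (law-prob C) (indicator (f s)))))) ⟩
    ∫ (law A) (λ s → ℕ→ℚ n * ∫ (law C) (λ t → indicator (f s)))
      ≡⟨ ∫-*ˡ (law A) (ℕ→ℚ n) _ ⟩
    ℕ→ℚ n * ∫∫ A C (λ s t → indicator (f s))
      ≤⟨ ≤-slack (ℕ→ℚ n * (10ℚ * half^ e)) (0≤* (0≤ℕ→ℚ n) (0≤* (nonNegative⁻¹ 10ℚ) (0≤half^ e))) refl ⟩
    ℕ→ℚ n * ∫∫ A C (λ s t → indicator (f s)) + ℕ→ℚ n * (10ℚ * half^ e) ∎
    where
    open ≤-Reasoning
    mean : ∀ s → ∫ (law C) (λ t → agree 𝓐 (word A s) (word C t)) ≡ ℕ→ℚ n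
    mean s = trans (word-uniform C (λ y → agree 𝓐 (word A s) y)) (trans
      (∫-cong (uniform-words 𝓐 n) (λ y → agree-sym 𝓐 (word A s) y)) (agree-average 𝓐 n (word A s)))
  decorrelation {c} {suc r} {e} (step {m = m} M d entropy≤ d≤ feasible) 𝓐 A C (send f g) = begin
    ∫ μ (λ s → ∫ ν (λ t → a s t * F (f s) s t))
      ≡⟨ by-message (λ x s → ∫ ν (λ t → a s t * F x s t)) ⟩
    ∫ code (λ x → I x)
      ≤⟨ average-mono (words-prob bits c) (λ x → per-message x) ⟩
    ∫ code (λ x → n′ * O x + (n′ * (9ℚ * ε) * w x + n′ * ε))
      ≡⟨ trans (∫-+ code _ _) (cong₂ _+_ (∫-*ˡ code n′ O) (trans (∫-+ code _ _)
           (cong₂ _+_ (trans (∫-*ˡ code (n′ * (9ℚ * ε)) w) (cong (n′ * (9ℚ * ε) *_) w-average))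
                      (average-const (words-prob bits c) (n′ * ε))))) ⟩
    n′ * ∫ code O + (n′ * (9ℚ * ε) * 1ℚ + n′ * ε)
      ≡⟨ cong₂ (λ j k → n′ * j + k) (sym (by-message (λ x s → ∫ ν (λ t → F x s t)))) (eq₁ n′ ε) ⟩
    n′ * ∫ μ (λ s → ∫ ν (λ t → F (f s) s t)) + n′ * (10ℚ * ε) ∎
    where
    open ≤-Reasoning
    B = blockSize M e
    n = m ℕ.* B
    n′ = ℕ→ℚ n
    b = ℕ→ℚ B
    ε = half^ e
    μ = law A
    ν = law C
    9ℚ = (2ℚ + 2ℚ) * 2ℚ + 1ℚ
    code = uniform-words bits c
    a : State A → State C → ℚ
    a s t = agree 𝓐 (word A s) (word C t)
    F : Vec Bool c → State A → State C → ℚ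
    F x s t = indicator (eval (g x) t s)
    δ′ : Vec Bool c → State A → ℚ
    δ′ x s = δ-words bits x (f s)
    0≤δ′ : ∀ x s → 0ℚ ≤ δ′ x s
    0≤δ′ x s = δ-words≥0 bits x (f s)
    I O w : Vec Bool c → ℚ
    I x = ∫ μ (λ s → δ′ x s * ∫ ν (λ t → a s t * F x s t))
    O x = ∫ μ (λ s → δ′ x s * ∫ ν (λ t → F x s t))
    w x = ∫ μ (δ′ x)
    0≤F : ∀ x s t → 0ℚ ≤ F x s t
    0≤F x s t = 0≤indicator (eval (g x) t s)
    F≤1 : ∀ x s t → F x s t ≤ 1ℚ
    F≤1 x s t = indicator≤1 (eval (g x) t s)
    0≤w : ∀ x → 0ℚ ≤ w x
    0≤w x = average-nonneg (law-prob A) (0≤δ′ x)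
    0≤O : ∀ x → 0ℚ ≤ O x
    0≤O x = average-nonneg (law-prob A) (λ s → 0≤* (0≤δ′ x s) (average-nonneg (law-prob C) (0≤F x s)))
    0≤9ε : 0ℚ ≤ n′ * (9ℚ * ε)
    0≤9ε = 0≤* (0≤ℕ→ℚ n) (0≤* (nonNegative⁻¹ 9ℚ) (0≤half^ e))
    eq₁ : ∀ n ε → n * (((2ℚ + 2ℚ) * 2ℚ + 1ℚ) * ε) * 1ℚ + n * ε ≡ n * ((2ℚ + 2ℚ + 1ℚ) * 2ℚ * ε)
    eq₁ = solve-∀ ring

    -- The sum over messages becomes an average over uniform strings x, with `δ′ x` selecting the
    -- states that send x. Thus `w x` is 2^c times the probability of the message x.
    by-message : ∀ (k : Vec Bool c → State A → ℚ) →
                 ∫ μ (λ s → k (f s) s) ≡ ∫ code (λ x → ∫ μ (λ s → δ′ x s * k x s))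
    by-message k = trans (∫-cong μ (λ s → sym (δ-words-sift bits c (λ x → k x s) (f s))))
                         (∫-swap μ code (λ s x → δ′ x s * k x s))

    w-average : ∫ code w ≡ 1ℚ
    w-average = trans (∫-swap code μ δ′)
      (trans (∫-cong μ (λ s → δ-total (power bits c) (f s))) (total (law-prob A)))

    -- Messages with `w x ≤ ε` are given up, as their agreement averages to at most εn. For the
    -- others, division by `w x` yields a density of at most 2^(c+e).
    per-message : ∀ x → I x ≤ n′ * O x + (n′ * (9ℚ * ε) * w x + n′ * ε)
    per-message x with ≤-total (w x) ε
    ... | inj₁ w≤ε = begin
      I x
        ≤⟨ average-mono (law-prob A) (λ s → *-monoˡ-≤ (δ′ x s) (0≤δ′ x s)
             (average-mono (law-prob C) (λ t → ≤-trans
               (*-monoˡ-≤ (a s t) (agree≥0 𝓐 (word A s) (word C t)) (F≤1 x s t))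
               (≤-reflexive (*-identityʳ (a s t)))))) ⟩
      ∫ μ (λ s → δ′ x s * ∫ ν (λ t → a s t))
        ≡⟨ trans (∫-cong μ (λ s → cong (δ′ x s *_) (mean s))) (∫-*ʳ μ (δ′ x) n′) ⟩
      w x * n′
        ≤⟨ *-monoʳ-≤ n′ (0≤ℕ→ℚ n) w≤ε ⟩
      ε * n′
        ≤⟨ ≤-slack (n′ * O x + n′ * (9ℚ * ε) * w x)
             (0≤+ (0≤* (0≤ℕ→ℚ n) (0≤O x)) (0≤* 0≤9ε (0≤w x)))
             (eq ε n′ (n′ * O x) (n′ * (9ℚ * ε) * w x)) ⟩
      n′ * O x + (n′ * (9ℚ * ε) * w x + n′ * ε) ∎
      where
      eq : ∀ ε n j k → ε * n + (j + k) ≡ j + (k + n * ε)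
      eq = solve-∀ ring
      mean : ∀ s → ∫ ν (λ t → a s t) ≡ n′
      mean s = trans (word-uniform C (λ y → agree 𝓐 (word A s) y)) (trans
        (∫-cong (uniform-words 𝓐 n) (λ y → agree-sym 𝓐 (word A s) y)) (agree-average 𝓐 n (word A s)))
    ... | inj₂ ε≤w = begin
      I x
        ≡⟨ unscale (λ s → ∫ ν (λ t → a s t * F x s t)) ⟩
      w x * ∫ μ (λ s → h s * ∫ ν (λ t → a s t * F x s t))
        ≤⟨ *-monoˡ-≤ (w x) (0≤w x) conditioned-bound ⟩
      w x * (n′ * ∫ μ (λ s → h s * ∫ ν (λ t → F x s t)) + n′ * (9ℚ * ε))
        ≡⟨ eq₂ (w x) n′ (∫ μ (λ s → h s * ∫ ν (λ t → F x s t))) (9ℚ * ε) ⟩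
      n′ * (w x * ∫ μ (λ s → h s * ∫ ν (λ t → F x s t))) + n′ * (9ℚ * ε) * w x
        ≡⟨ cong (λ j → n′ * j + n′ * (9ℚ * ε) * w x) (unscale (λ s → ∫ ν (λ t → F x s t))) ⟨
      n′ * O x + n′ * (9ℚ * ε) * w x
        ≤⟨ +-monoʳ-≤ (n′ * O x) (≤-slack (n′ * ε) (0≤* (0≤ℕ→ℚ n) (0≤half^ e)) refl) ⟩
      n′ * O x + (n′ * (9ℚ * ε) * w x + n′ * ε) ∎
      where
      E = ℕ→ℚ (2 ℕ.^ e)
      eq₂ : ∀ w n j k → w * (n * j + n * k) ≡ n * (w * j) + n * k * w
      eq₂ = solve-∀ ring
      0<w : 0ℚ < w x
      0<w = <-≤-trans (0<half^ e) ε≤w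
      u = proj₁ (inverse (w x) 0<w)
      0≤u : 0ℚ ≤ u
      0≤u = proj₁ (proj₂ (inverse (w x) 0<w))
      wu≡1 : w x * u ≡ 1ℚ
      wu≡1 = proj₂ (proj₂ (inverse (w x) 0<w))
      u≤E : u ≤ E
      u≤E = begin
        u             ≡⟨ *-identityˡ u ⟨
        1ℚ * u        ≡⟨ cong (_* u) (half^-inverse e) ⟨
        ε * E * u     ≤⟨ *-monoʳ-≤ u 0≤u (*-monoʳ-≤ E (0≤ℕ→ℚ (2 ℕ.^ e)) ε≤w) ⟩
        w x * E * u   ≡⟨ eq (w x) E u ⟩
        E * (w x * u) ≡⟨ cong (E *_) wu≡1 ⟩
        E * 1ℚ        ≡⟨ *-identityʳ E ⟩
        E             ∎
        where
        eq : ∀ w e u → w * e * u ≡ e * (w * u)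
        eq = solve-∀ ring
      h : State A → ℚ
      h s = δ′ x s * u
      0≤h : ∀ s → 0ℚ ≤ h s
      0≤h s = 0≤* (0≤δ′ x s) 0≤u
      ∫h≡1 : ∫ μ h ≡ 1ℚ
      ∫h≡1 = trans (∫-*ʳ μ (δ′ x) u) wu≡1
      h≤ : ∀ s → h s ≤ ℕ→ℚ (2 ℕ.^ (c ℕ.+ e))
      h≤ s = begin
        δ′ x s * u                     ≤⟨ *-mono-≤ (0≤δ′ x s) (0≤ℕ→ℚ (2 ℕ.^ e)) (δ-bits≤ c x (f s)) u≤E ⟩
        ℕ→ℚ (2 ℕ.^ c) * ℕ→ℚ (2 ℕ.^ e)  ≡⟨ ℕ→ℚ-* (2 ℕ.^ c) (2 ℕ.^ e) ⟨
        ℕ→ℚ (2 ℕ.^ c ℕ.* 2 ℕ.^ e)      ≡⟨ cong ℕ→ℚ (ℕ.^-distribˡ-+-* 2 c e) ⟨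
        ℕ→ℚ (2 ℕ.^ (c ℕ.+ e))          ∎
      unscale : ∀ k → ∫ μ (λ s → δ′ x s * k s) ≡ w x * ∫ μ (λ s → h s * k s)
      unscale k = trans (∫-cong μ (λ s → trans (sym (*-identityˡ (δ′ x s * k s)))
        (trans (cong (_* (δ′ x s * k s)) (sym wu≡1)) (eq (w x) u (δ′ x s) (k s))))) (∫-*ˡ μ (w x) _)
        where
        eq : ∀ w u d k → w * u * (d * k) ≡ w * (d * u * k)
        eq = solve-∀ ring
      open Condition {𝓐} {B} {m} A h 0≤h ∫h≡1
      K = round-coupling c e m M d entropy≤ d≤ A h 0≤h ∫h≡1 h≤
      A′ = conditioned K
      C′ = regroup 𝓐 B m C
      -- The remaining protocol reads the old state and ignores the fresh word, so the hypothesis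
      -- can be restated for `F x`.
      π′ : Protocol c (State C) (State A′) r
      π′ = comap id proj₁ (g x)
      F′≡F : ∀ t s′ → indicator (eval π′ t s′) ≡ F x (proj₁ s′) t
      F′≡F t s′ = cong indicator (eval-comap id proj₁ (g x) t s′)
      hypothesis : ∫ (law A′) (λ s′ → ∫ ν (λ t → agree (power 𝓐 B) (proj₂ s′) (word C′ t) * F x (proj₁ s′) t)) ≤
                   ℕ→ℚ m * ∫ μ (λ s → h s * ∫ ν (λ t → F x s t)) + ℕ→ℚ m * (10ℚ * half^ (suc e))
      hypothesis = subst₂ (λ l j → l ≤ ℕ→ℚ m * j + ℕ→ℚ m * (10ℚ * half^ (suc e)))
        (trans (∫-cong ν (λ t → ∫-cong (law A′) (λ s′ →
                 cong₂ _*_ (agree-sym (power 𝓐 B) (word C′ t) (proj₂ s′)) (F′≡F t s′))))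
               (∫-swap ν (law A′) (λ t s′ → agree (power 𝓐 B) (proj₂ s′) (word C′ t) * F x (proj₁ s′) t)))
        (trans (∫-cong ν (λ t → ∫-cong (law A′) (λ s′ → F′≡F t s′)))
          (trans (∫-swap ν (law A′) (λ t s′ → F x (proj₁ s′) t))
                 (∫-conditioned-state K (λ s → ∫ ν (λ t → F x s t)))))
        (decorrelation feasible (power 𝓐 B) C′ A′ π′)
      conditioned-bound : ∫ μ (λ s → h s * ∫ ν (λ t → a s t * F x s t)) ≤
                          n′ * ∫ μ (λ s → h s * ∫ ν (λ t → F x s t)) + n′ * (9ℚ * ε)
      conditioned-bound = begin
        ∫ μ (λ s → h s * ∫ ν (λ t → a s t * F x s t))
          ≤⟨ conditioned-agree K C (F x) (0≤F x) (F≤1 x) ⟩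
        b * ∫ (law A′) (λ s′ → ∫ ν (λ t → agree (power 𝓐 B) (proj₂ s′) (word C′ t) * F x (proj₁ s′) t)) +
        round-loss c e m M d entropy≤ d≤ A h 0≤h ∫h≡1 h≤
          ≤⟨ +-mono-≤ (*-monoˡ-≤ b (0≤ℕ→ℚ B) hypothesis)
                      (round-loss≤ c e m M d entropy≤ d≤ A h 0≤h ∫h≡1 h≤) ⟩
        b * (ℕ→ℚ m * j + ℕ→ℚ m * (10ℚ * (½ * ε))) + n′ * ((2ℚ + 2ℚ) * ε)
          ≡⟨ cong (λ k → b * (ℕ→ℚ m * j + ℕ→ℚ m * (10ℚ * (½ * ε))) + k * ((2ℚ + 2ℚ) * ε)) (ℕ→ℚ-* m B) ⟩
        b * (ℕ→ℚ m * j + ℕ→ℚ m * (10ℚ * (½ * ε))) + ℕ→ℚ m * b * ((2ℚ + 2ℚ) * ε)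
          ≡⟨ eq b (ℕ→ℚ m) j ε ⟩
        ℕ→ℚ m * b * j + ℕ→ℚ m * b * (9ℚ * ε)
          ≡⟨ cong (λ k → k * j + k * (9ℚ * ε)) (ℕ→ℚ-* m B) ⟨
        n′ * j + n′ * (9ℚ * ε) ∎
        where
        j = ∫ μ (λ s → h s * ∫ ν (λ t → F x s t))
        eq : ∀ b m j ε → b * (m * j + m * ((2ℚ + 2ℚ + 1ℚ) * 2ℚ * (½ * ε))) + m * b * ((2ℚ + 2ℚ) * ε) ≡
                         m * b * j + m * b * (((2ℚ + 2ℚ) * 2ℚ + 1ℚ) * ε)
        eq = solve-∀ ring

-- Coding messages of bounded length and early stops by fixed-length strings

module Encoding where
  open import Data.Vec.Base using (toList; fromList; cast; replicate)
  open import Data.Vec.Properties using (toList-cast; toList∘fromList)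
  open RoundElimination

  -- A message m of length at most b is coded by b + 1 bits as 0…01m.
  decode-message : ∀ {b} → Vec Bool (suc b) → Message
  decode-message {zero}  _           = []
  decode-message {suc b} (true  ∷ v) = toList v
  decode-message {suc b} (false ∷ v) = decode-message v

  -- A flag bit tells an output from a message, and the message takes b + 1 more bits: hence 2 + b.
  decode : ∀ {b} → Vec Bool (2 ℕ.+ b) → Bool ⊎ Message
  decode (false ∷ v)     = inj₂ (decode-message v)
  decode (true  ∷ x ∷ v) = inj₁ x

  encode-message : ∀ b m → length m ℕ.≤ b → ∃ λ v → decode-message {b} v ≡ m
  encode-message zero    []      _   = true ∷ [] , refl
  encode-message (suc b) m       m≤b with length m ℕ.≟ suc b
  ... | yes eq = true ∷ cast eq (fromList m) , trans (toList-cast eq (fromList m)) (toList∘fromList m)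
  ... | no neq with encode-message b m (ℕ.s≤s⁻¹ (ℕ.≤∧≢⇒< m≤b neq))
  ...   | v , eq = false ∷ v , eq

  encode : ∀ b → Bool ⊎ Message → Vec Bool (2 ℕ.+ b)
  encode b (inj₁ x) = true ∷ x ∷ replicate b false
  encode b (inj₂ m) with length m ℕ.≤? b
  ... | yes m≤b = false ∷ proj₁ (encode-message b m m≤b)
  -- A default value: messages longer than b are excluded by `Short`.
  ... | no  _   = replicate (2 ℕ.+ b) false

  decode-encode : ∀ b m → length m ℕ.≤ b → decode (encode b (inj₂ m)) ≡ inj₂ m
  decode-encode b m m≤b with length m ℕ.≤? b
  ... | yes m≤b′ = cong inj₂ (proj₂ (encode-message b m m≤b′))
  ... | no  m≰b  = contradiction m≤b m≰b

  -- After an early stop the output is fixed, and filler is sent until the prescribed number of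
  -- rounds is reached.
  constant : ∀ {c P Q} k → Bool → Protocol c P Q k
  constant         zero    x = declare (λ _ → x)
  constant {c}     (suc k) x = send (λ _ → replicate c false) (λ _ → constant k x)

  eval-constant : ∀ {c P Q} k x (p : P) (q : Q) → eval (constant {c} k x) p q ≡ x
  eval-constant zero    x p q = refl
  eval-constant (suc k) x p q = eval-constant k x q p

  module _ (b : ℕ) where
    mutual
      coded : ∀ {P Q k} → Receiver P Q k → Protocol (2 ℕ.+ b) P Q k
      coded (declare f)   = declare f
      coded (respond f g) = send (encode b ∘ f) (λ v → resume g (decode v))

      resume : ∀ {P Q k} → (Message → Receiver P Q k) → Bool ⊎ Message → Protocol (2 ℕ.+ b) P Q k
      resume {k = k} g (inj₁ x) = constant k x
      resume         g (inj₂ m) = coded (g m)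

    Short : Message → Set
    Short m = length m ℕ.≤ b

    eval-coded : ∀ {P Q k} (ρ : Receiver P Q k) p q →
                 All Short (proj₁ (runReceiver ρ p q)) → eval (coded ρ) p q ≡ proj₂ (runReceiver ρ p q)
    eval-coded (declare f)   p q _ = refl
    eval-coded {k = suc k} (respond f g) p q short with f p
    ... | inj₁ x = eval-constant k x q p
    eval-coded (respond f g) p q (m≤b ∷ short) | inj₂ m
      rewrite decode-encode b m m≤b = eval-coded (g m) q p short

    coded-start : ∀ {P Q k} → (P → Message) → (Message → Receiver Q P k) → Protocol (2 ℕ.+ b) P Q (suc k)
    coded-start f g = send (encode b ∘ inj₂ ∘ f) (λ v → resume g (decode v))

    eval-coded-start : ∀ {P Q k} (f : P → Message) (g : Message → Receiver Q P k) p q →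
      All Short (proj₁ (f p ◃ runReceiver (g (f p)) q p)) →
      eval (coded-start f g) p q ≡ proj₂ (f p ◃ runReceiver (g (f p)) q p)
    eval-coded-start f g p q (m≤b ∷ short)
      rewrite decode-encode b (f p) m≤b = eval-coded (g (f p)) q p short

-- The hard distribution on inputs

module Gap where
  open import Data.Fin.Base as Fin using (Fin; zero; suc)
  import Data.Fin.Properties as Fin
  open import Data.Rational.Base
  open import Data.Rational.Properties
  open import Tactic.RingSolver using (solve-∀)
  open RationalOrder
  open Integral
  open Alphabets
  open RoundElimination
  open Elimination

  counting : ∀ t → Measure (Fin t)
  counting zero    = []
  counting (suc t) = (1ℚ , zero) ∷ pushforward suc (counting t)

  counting-nonneg : ∀ t → Nonneg (counting t)
  counting-nonneg zero    = []
  counting-nonneg (suc t) = 0≤1 ∷ pushforward-nonneg suc (counting-nonneg t)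

  counting-total : ∀ t → ∫ (counting t) (λ _ → 1ℚ) ≡ ℕ→ℚ t
  counting-total zero    = refl
  counting-total (suc t) = trans (cong (1ℚ +_) (trans (∫-pushforward suc (counting t) _) (counting-total t)))
                                 (sym (ℕ→ℚ-suc t))

  equal : ∀ {t} → Fin t → Fin t → ℚ
  equal a b = indicator (does (a Fin.≟ b))

  equal-sym : ∀ {t} (a b : Fin t) → equal a b ≡ equal b a
  equal-sym zero    zero    = refl
  equal-sym zero    (suc b) = refl
  equal-sym (suc a) zero    = refl
  equal-sym (suc a) (suc b) = equal-sym a b

  counting-sift : ∀ t (g : Fin t → ℚ) b → ∫ (counting t) (λ a → equal a b * g a) ≡ g b
  counting-sift (suc t) g zero = begin
    1ℚ * (1ℚ * g zero) + ∫ (pushforward suc (counting t)) (λ a → equal a zero * g a)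
      ≡⟨ cong₂ _+_ (trans (*-identityˡ (1ℚ * g zero)) (*-identityˡ (g zero)))
           (trans (∫-pushforward suc (counting t) _)
             (trans (∫-cong (counting t) (λ a → *-zeroˡ (g (suc a)))) (∫-0 (counting t)))) ⟩
    g zero + 0ℚ
      ≡⟨ +-identityʳ (g zero) ⟩
    g zero ∎
    where open ≡-Reasoning
  counting-sift (suc t) g (suc b) = begin
    1ℚ * (0ℚ * g zero) + ∫ (pushforward suc (counting t)) (λ a → equal a (suc b) * g a)
      ≡⟨ cong₂ _+_ (trans (*-identityˡ (0ℚ * g zero)) (*-zeroˡ (g zero)))
           (trans (∫-pushforward suc (counting t) _) (counting-sift t (λ a → g (suc a)) b)) ⟩
    0ℚ + g (suc b)
      ≡⟨ +-identityˡ (g (suc b)) ⟩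
    g (suc b) ∎
    where open ≡-Reasoning

  module FinAlphabet (t : ℕ) (1≤t : 1 ℕ.≤ t) where
    private
      τ = proj₁ (ℕ→ℚ-inverse t 1≤t)
      0≤τ = proj₁ (proj₂ (ℕ→ℚ-inverse t 1≤t))
      tτ≡1 = proj₂ (proj₂ (ℕ→ℚ-inverse t 1≤t))

    𝓕 : Alphabet
    𝓕 = record
      { Symbol  = Fin t
      ; uniform = (λ _ → τ) ▹ counting t
      ; prob    = record
        { weights≥0 = ▹-nonneg (λ _ → 0≤τ) (counting-nonneg t)
        ; total     = trans (∫-▹ (λ _ → τ) (counting t) _) (trans (∫-*ˡ (counting t) τ (λ _ → 1ℚ))
                        (trans (cong (τ *_) (counting-total t)) (trans (*-comm τ (ℕ→ℚ t)) tτ≡1)))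
        }
      ; δ       = λ a b → ℕ→ℚ t * equal a b
      ; δ≥0     = λ a b → 0≤* (0≤ℕ→ℚ t) (0≤indicator (does (a Fin.≟ b)))
      ; δ-sym   = λ a b → cong (ℕ→ℚ t *_) (equal-sym a b)
      ; δ-sift  = λ g b → trans (∫-▹ (λ _ → τ) (counting t) _) (trans
                    (∫-cong (counting t) (λ a → trans (eq τ (ℕ→ℚ t) (equal a b) (g a))
                      (trans (cong (_* (equal a b * g a)) tτ≡1) (*-identityˡ (equal a b * g a)))))
                    (counting-sift t g b))
      }
      where
      eq : ∀ u t e g → u * (t * e * g) ≡ t * u * (e * g)
      eq = solve-∀ ring

    distinct⇒agree≡0 : ∀ {n} (x y : Vec (Fin t) n) → (∀ i → lookup x i ≢ lookup y i) → agree 𝓕 x y ≡ 0ℚ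
    distinct⇒agree≡0 []      []      x≢y = refl
    distinct⇒agree≡0 (a ∷ x) (b ∷ y) x≢y with a Fin.≟ b
    ... | yes a≡b = contradiction a≡b (x≢y zero)
    ... | no  _   = trans (cong₂ _+_ (*-zeroʳ (ℕ→ℚ t)) (distinct⇒agree≡0 x y (λ i → x≢y (suc i)))) refl

    equal⇒t≤agree : ∀ {n} (x y : Vec (Fin t) n) i → lookup x i ≡ lookup y i → ℕ→ℚ t ≤ agree 𝓕 x y
    equal⇒t≤agree (a ∷ x) (b ∷ y) zero    a≡b with a Fin.≟ b
    ... | yes _   = ≤-slack (agree 𝓕 x y) (agree≥0 𝓕 x y) (cong (_+ agree 𝓕 x y) (sym (*-identityʳ (ℕ→ℚ t))))
    ... | no  a≢b = contradiction a≡b a≢b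
    equal⇒t≤agree (a ∷ x) (b ∷ y) (suc i) eq = ≤-trans (equal⇒t≤agree x y i eq)
      (≤-slack (δ 𝓕 a b) (δ≥0 𝓕 a b) (+-comm (agree 𝓕 x y) (δ 𝓕 a b)))

  module _ (n : ℕ) (1≤t : 1 ℕ.≤ 4 ℕ.* n) where
    open FinAlphabet (4 ℕ.* n) 1≤t

    -- `agree` is 0 or at least 4n according to `EE`. The motive `C` lets both answers be treated
    -- without unfolding the decision procedure.
    EE-cases : ∀ (x y : Input n) (C : Bool → Set) →
      (agree 𝓕 x y ≡ 0ℚ → C false) → (ℕ→ℚ (4 ℕ.* n) ≤ agree 𝓕 x y → C true) → C (EE x y)
    EE-cases x y C no-agreement agreement = cases (Fin.any? (λ i → lookup x i Fin.≟ lookup y i))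
      where
      cases : (d : Dec (∃ λ i → lookup x i ≡ lookup y i)) → C (does d)
      cases (yes (i , eq)) = agreement (equal⇒t≤agree x y i eq)
      cases (no  ∄i)       = no-agreement (distinct⇒agree≡0 x y (λ i eq → ∄i (i , eq)))

  error : Bool → Bool → ℚ
  error a b = indicator (a xor b)

  -- Under the weight, half of the mass is on uniform inputs with EE = 0 and
  -- half on inputs with a planted agreement among the first k coordinates.
  module Hard (k l : ℕ) (1≤k : 1 ℕ.≤ k) where
    n : ℕ
    n = k ℕ.+ l

    1≤t : 1 ℕ.≤ 4 ℕ.* n
    1≤t = ℕ.≤-trans 1≤k (ℕ.≤-trans (ℕ.m≤m+n k l) (ℕ.m≤n*m n 4))

    open FinAlphabet (4 ℕ.* n) 1≤t public

    inputs : Measure (Input n)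
    inputs = uniform-words 𝓕 n

    inputs-prob : Probability inputs
    inputs-prob = words-prob 𝓕 n

    agree₀ : Input n → Input n → ℚ
    agree₀ x y = agree 𝓕 (take k x) (take k y)

    0≤agree₀ : ∀ x y → 0ℚ ≤ agree₀ x y
    0≤agree₀ x y = agree≥0 𝓕 (take k x) (take k y)

    agree₀≤agree : ∀ x y → agree₀ x y ≤ agree 𝓕 x y
    agree₀≤agree x y = ≤-slack (agree 𝓕 (drop k x) (drop k y)) (agree≥0 𝓕 (drop k x) (drop k y))
                               (sym (agree-take-drop 𝓕 k x y))

    -- The protocol sees the whole input, but planting concerns the first `k` coordinates; the other
    -- `l` make up the difference between n and a power of two.
    prefix-player : Player 𝓕 k
    prefix-player = record
      { State        = Input n
      ; law          = inputs
      ; law-prob     = inputs-prob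
      ; word         = take k
      ; word-uniform = λ g → trans (∫-take-drop 𝓕 k l (λ x _ → g x))
                               (∫-cong (uniform-words 𝓕 k) (λ x → average-const (words-prob 𝓕 l) (g x)))
      }

    average₂ : (Input n → Input n → ℚ) → ℚ
    average₂ f = ∫ inputs (λ x → ∫ inputs (λ y → f x y))

    average₂-mono : ∀ {f g} → (∀ x y → f x y ≤ g x y) → average₂ f ≤ average₂ g
    average₂-mono h = average-mono inputs-prob (λ x → average-mono inputs-prob (h x))

    average₂-+ : ∀ f g → average₂ (λ x y → f x y + g x y) ≡ average₂ f + average₂ g
    average₂-+ f g = trans (∫-cong inputs (λ x → ∫-+ inputs (f x) (g x))) (∫-+ inputs _ _)

    average₂-- : ∀ f g → average₂ (λ x y → f x y - g x y) ≡ average₂ f - average₂ g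
    average₂-- f g = trans (∫-cong inputs (λ x → ∫-- inputs (f x) (g x))) (∫-- inputs _ _)

    average₂-*ˡ : ∀ c f → average₂ (λ x y → c * f x y) ≡ c * average₂ f
    average₂-*ˡ c f = trans (∫-cong inputs (λ x → ∫-*ˡ inputs c (f x))) (∫-*ˡ inputs c _)

    average₂-const : ∀ c → average₂ (λ _ _ → c) ≡ c
    average₂-const c = trans (∫-cong inputs (λ _ → average-const inputs-prob c)) (average-const inputs-prob c)

    agree-average₂ : average₂ (agree 𝓕) ≡ ℕ→ℚ n
    agree-average₂ = trans (∫-swap inputs inputs (agree 𝓕)) (trans
      (∫-cong inputs (λ y → agree-average 𝓕 n y)) (average-const inputs-prob (ℕ→ℚ n)))

    agree₀-average₂ : average₂ agree₀ ≡ ℕ→ℚ k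
    agree₀-average₂ = trans (∫-swap inputs inputs agree₀) (trans
      (∫-cong inputs (λ y → trans (word-uniform prefix-player (λ x → agree 𝓕 x (take k y)))
                                  (agree-average 𝓕 k (take k y))))
      (average-const inputs-prob (ℕ→ℚ k)))

    weight : Input n → Input n → ℚ
    weight x y = agree₀ x y + ℕ→ℚ k * indicator (not (EE x y))

    0≤weight : ∀ x y → 0ℚ ≤ weight x y
    0≤weight x y = 0≤+ (0≤agree₀ x y) (0≤* (0≤ℕ→ℚ k) (0≤indicator (not (EE x y))))

    weight-total : average₂ weight ≤ 2ℚ * ℕ→ℚ k
    weight-total = begin
      average₂ weight
        ≤⟨ average₂-mono (λ x y → +-monoʳ-≤ (agree₀ x y)
             (*-monoˡ-≤ (ℕ→ℚ k) (0≤ℕ→ℚ k) (indicator≤1 (not (EE x y))))) ⟩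
      average₂ (λ x y → agree₀ x y + ℕ→ℚ k * 1ℚ)
        ≡⟨ trans (average₂-+ agree₀ (λ _ _ → ℕ→ℚ k * 1ℚ))
                 (cong₂ _+_ agree₀-average₂ (average₂-const (ℕ→ℚ k * 1ℚ))) ⟩
      ℕ→ℚ k + ℕ→ℚ k * 1ℚ
        ≡⟨ eq (ℕ→ℚ k) ⟩
      2ℚ * ℕ→ℚ k ∎
      where
      open ≤-Reasoning
      eq : ∀ k → k + k * 1ℚ ≡ 2ℚ * k
      eq = solve-∀ ring

    ¼ : ℚ
    ¼ = ½ * ½

    -- Markov's inequality: `agree` has mean n and is at least 4n whenever some coordinate agrees.
    EE-average : average₂ (λ x y → indicator (EE x y)) ≤ ¼
    EE-average = begin
      p
        ≡⟨ trans (sym (*-identityˡ p)) (cong (_* p) (sym uN≡1)) ⟩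
      N * u * p
        ≡⟨ eq₁ N u p ⟩
      ¼ * u * ((2ℚ + 2ℚ) * N * p)
        ≤⟨ *-monoˡ-≤ (¼ * u) (0≤* (nonNegative⁻¹ ¼) 0≤u) bound ⟩
      ¼ * u * N
        ≡⟨ trans (eq₂ ¼ u N) (trans (cong (¼ *_) uN≡1) (*-identityʳ ¼)) ⟩
      ¼ ∎
      where
      open ≤-Reasoning
      N = ℕ→ℚ n
      p = average₂ (λ x y → indicator (EE x y))
      1≤n : 1 ℕ.≤ n
      1≤n = ℕ.≤-trans 1≤k (ℕ.m≤m+n k l)
      u = proj₁ (ℕ→ℚ-inverse n 1≤n)
      0≤u = proj₁ (proj₂ (ℕ→ℚ-inverse n 1≤n))
      uN≡1 : N * u ≡ 1ℚ
      uN≡1 = proj₂ (proj₂ (ℕ→ℚ-inverse n 1≤n))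
      eq₁ : ∀ N u p → N * u * p ≡ ½ * ½ * u * ((2ℚ + 2ℚ) * N * p)
      eq₁ = solve-∀ ring
      eq₂ : ∀ c u N → c * u * N ≡ c * (N * u)
      eq₂ = solve-∀ ring
      4N : ℕ→ℚ (4 ℕ.* n) ≡ (2ℚ + 2ℚ) * N
      4N = trans (ℕ→ℚ-* 4 n) (cong (_* N) 4≡)
        where
        4≡ : ℕ→ℚ 4 ≡ 2ℚ + 2ℚ
        4≡ = refl
      pointwise : ∀ x y → (2ℚ + 2ℚ) * N * indicator (EE x y) ≤ agree 𝓕 x y
      pointwise x y = EE-cases n 1≤t x y (λ e → (2ℚ + 2ℚ) * N * indicator e ≤ agree 𝓕 x y)
        (λ a≡0 → ≤-reflexive (trans (*-zeroʳ ((2ℚ + 2ℚ) * N)) (sym a≡0)))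
        (λ t≤a → ≤-trans (≤-reflexive (trans (*-identityʳ ((2ℚ + 2ℚ) * N)) (sym 4N))) t≤a)
      bound : (2ℚ + 2ℚ) * N * p ≤ N
      bound = subst₂ _≤_ (average₂-*ˡ ((2ℚ + 2ℚ) * N) (λ x y → indicator (EE x y))) agree-average₂
                     (average₂-mono pointwise)

    -- Pointwise the weighted error is at least agree₀ · (1 - out) + k · (out - EE): for EE = 0
    -- equality holds, as `agree₀` vanishes, and for EE = 1 the second term is never positive. On
    -- average this is k minus the advantage minus at most k/4.
    weighted-error : ∀ (out : Input n → Input n → Bool) (κ : ℚ) →
      average₂ (λ x y → agree₀ x y * indicator (out x y)) ≤
        ℕ→ℚ k * average₂ (λ x y → indicator (out x y)) + ℕ→ℚ k * κ →
      ℕ→ℚ k * (1ℚ - ¼ - κ) ≤ average₂ (λ x y → weight x y * error (out x y) (EE x y))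
    weighted-error out κ advantage≤ = begin
      K * (1ℚ - ¼ - κ)
        ≤⟨ ≤-slack (K * (¼ - p) + (K * o + K * κ - q))
             (0≤+ (0≤* (0≤ℕ→ℚ k) (a≤b⇒0≤b-a EE-average)) (a≤b⇒0≤b-a advantage≤)) (eq₁ K ¼ κ p o q) ⟩
      K - q + K * o - K * p
        ≡⟨ collect ⟨
      average₂ (λ x y → agree₀ x y - agree₀ x y * indicator (out x y) + K * indicator (out x y) - K * indicator (EE x y))
        ≤⟨ average₂-mono pointwise ⟩
      average₂ (λ x y → weight x y * error (out x y) (EE x y)) ∎
      where
      open ≤-Reasoning
      K = ℕ→ℚ k
      p = average₂ (λ x y → indicator (EE x y))
      o = average₂ (λ x y → indicator (out x y))
      q = average₂ (λ x y → agree₀ x y * indicator (out x y))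
      eq₁ : ∀ K c κ p o q → K * (1ℚ - c - κ) + (K * (c - p) + (K * o + K * κ - q)) ≡ K - q + K * o - K * p
      eq₁ = solve-∀ ring
      collect : average₂ (λ x y → agree₀ x y - agree₀ x y * indicator (out x y) + K * indicator (out x y)
                                  - K * indicator (EE x y)) ≡ K - q + K * o - K * p
      collect = trans (average₂-- _ _) (cong₂ _-_
        (trans (average₂-+ _ _) (cong₂ _+_
          (trans (average₂-- _ _) (cong (_- q) agree₀-average₂))
          (average₂-*ˡ K _)))
        (average₂-*ˡ K _))
      zero-case : ∀ a k o → a ≡ 0ℚ → a - a * o + k * o - k * 0ℚ ≡ (a + k * 1ℚ) * o
      zero-case a k o refl = eq k o
        where
        eq : ∀ k o → 0ℚ - 0ℚ * o + k * o - k * 0ℚ ≡ (0ℚ + k * 1ℚ) * o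
        eq = solve-∀ ring
      true-case : ∀ a k → a - a * 1ℚ + k * 1ℚ - k * 1ℚ ≡ (a + k * 0ℚ) * 0ℚ
      true-case = solve-∀ ring
      false-case : ∀ a k → a - a * 0ℚ + k * 0ℚ - k * 1ℚ + k ≡ (a + k * 0ℚ) * 1ℚ
      false-case = solve-∀ ring
      pointwise : ∀ x y → agree₀ x y - agree₀ x y * indicator (out x y) + K * indicator (out x y) - K * indicator (EE x y) ≤
                          weight x y * error (out x y) (EE x y)
      pointwise x y = EE-cases n 1≤t x y
        (λ e → agree₀ x y - agree₀ x y * indicator (out x y) + K * indicator (out x y) - K * indicator e ≤
               (agree₀ x y + K * indicator (not e)) * error (out x y) e)
        (λ a≡0 → no-agreement (out x y) (≤-antisym (≤-trans (agree₀≤agree x y) (≤-reflexive a≡0)) (0≤agree₀ x y)))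
        (λ _ → agreement (out x y))
        where
        a = agree₀ x y
        no-agreement : ∀ z → a ≡ 0ℚ → a - a * indicator z + K * indicator z - K * 0ℚ ≤ (a + K * 1ℚ) * error z false
        no-agreement false a≡0 = ≤-reflexive (zero-case a K 0ℚ a≡0)
        no-agreement true  a≡0 = ≤-reflexive (zero-case a K 1ℚ a≡0)
        agreement : ∀ z → a - a * indicator z + K * indicator z - K * 1ℚ ≤ (a + K * 0ℚ) * error z true
        agreement false = ≤-slack K (0≤ℕ→ℚ k) (false-case a K)
        agreement true  = ≤-reflexive (true-case a K)

-- Protocols with empty messages, by discrepancy

module Silent where
  open import Data.Rational.Base
  open import Data.Rational.Properties
  open import Tactic.RingSolver using (solve-∀)
  open RationalOrder
  open Integral
  open Alphabets
  open RoundElimination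
  open Elimination

  module _ (𝓐 : Alphabet) where

    -- Hence agree − n is the kernel of an orthogonal projection.
    agree-convolution : ∀ n (x z : Vec (Symbol 𝓐) n) →
      ∫ (uniform-words 𝓐 n) (λ y → agree 𝓐 x y * agree 𝓐 z y) ≡
      agree 𝓐 x z + (ℕ→ℚ n * ℕ→ℚ n - ℕ→ℚ n)
    agree-convolution zero    []      []      = ∫-[] 𝓐 (λ y → agree 𝓐 [] y * agree 𝓐 [] y)
    agree-convolution (suc n) (a ∷ x) (c ∷ z) = begin
      ∫ (W (suc n)) (λ y → agree 𝓐 (a ∷ x) y * agree 𝓐 (c ∷ z) y)
        ≡⟨ ∫-∷ 𝓐 n _ ⟩
      ∫ τ (λ b → ∫ (W n) (λ y → (δ 𝓐 a b + agree 𝓐 x y) * (δ 𝓐 c b + agree 𝓐 z y)))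
        ≡⟨ ∫-cong τ (λ b → inner b) ⟩
      ∫ τ (λ b → δ 𝓐 a b * δ 𝓐 c b + ((δ 𝓐 a b + δ 𝓐 c b) * N + S))
        ≡⟨ trans (∫-+ τ _ _) (cong₂ _+_ (trans (δ-siftˡ 𝓐 (λ b → δ 𝓐 c b) a) (δ-sym 𝓐 c a))
             (trans (∫-+ τ _ _) (cong₂ _+_
               (trans (∫-*ʳ τ _ N) (cong (_* N) (trans (∫-+ τ _ _) (cong₂ _+_ (ones a) (ones c)))))
               (average-const (prob 𝓐) S)))) ⟩
      δ 𝓐 a c + (2ℚ * N + S)
        ≡⟨ cong (λ s → δ 𝓐 a c + (2ℚ * N + s)) (agree-convolution n x z) ⟩
      δ 𝓐 a c + (2ℚ * N + (agree 𝓐 x z + (N * N - N)))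
        ≡⟨ trans (eq (δ 𝓐 a c) N (agree 𝓐 x z))
             (cong (λ k → (δ 𝓐 a c + agree 𝓐 x z) + (k * k - k)) (sym (ℕ→ℚ-suc n))) ⟩
      (δ 𝓐 a c + agree 𝓐 x z) + (ℕ→ℚ (suc n) * ℕ→ℚ (suc n) - ℕ→ℚ (suc n)) ∎
      where
      open ≡-Reasoning
      τ = uniform 𝓐
      W = uniform-words 𝓐
      N = ℕ→ℚ n
      S = ∫ (W n) (λ y → agree 𝓐 x y * agree 𝓐 z y)
      eq : ∀ d n a → d + (2ℚ * n + (a + (n * n - n))) ≡ (d + a) + ((1ℚ + n) * (1ℚ + n) - (1ℚ + n))
      eq = solve-∀ ring
      expand : ∀ d a e b → (d + a) * (e + b) ≡ d * e + ((d * b + e * a) + a * b)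
      expand = solve-∀ ring
      collect : ∀ d e n → d * n + e * n ≡ (d + e) * n
      collect = solve-∀ ring
      ones : ∀ a → ∫ τ (λ b → δ 𝓐 a b) ≡ 1ℚ
      ones a = trans (∫-cong τ (λ b → δ-sym 𝓐 a b)) (δ-total 𝓐 a)
      mean : ∀ x → ∫ (W n) (λ y → agree 𝓐 x y) ≡ N
      mean x = trans (∫-cong (W n) (λ y → agree-sym 𝓐 x y)) (agree-average 𝓐 n x)
      inner : ∀ b → ∫ (W n) (λ y → (δ 𝓐 a b + agree 𝓐 x y) * (δ 𝓐 c b + agree 𝓐 z y)) ≡
                    δ 𝓐 a b * δ 𝓐 c b + ((δ 𝓐 a b + δ 𝓐 c b) * N + S)
      inner b = trans (∫-cong (W n) (λ y → expand (δ 𝓐 a b) (agree 𝓐 x y) (δ 𝓐 c b) (agree 𝓐 z y)))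
        (trans (∫-+ (W n) _ _) (cong₂ _+_ (average-const (words-prob 𝓐 n) (δ 𝓐 a b * δ 𝓐 c b))
          (trans (∫-+ (W n) _ _) (cong (_+ S)
            (trans (∫-+ (W n) _ _) (trans (cong₂ _+_
              (trans (∫-*ˡ (W n) (δ 𝓐 a b) (λ y → agree 𝓐 z y)) (cong (δ 𝓐 a b *_) (mean z)))
              (trans (∫-*ˡ (W n) (δ 𝓐 c b) (λ y → agree 𝓐 x y)) (cong (δ 𝓐 c b *_) (mean x))))
              (collect (δ 𝓐 a b) (δ 𝓐 c b) N)))))))

    module _ {n : ℕ} where
      private
        N = ℕ→ℚ n
        W = uniform-words 𝓐 n
        X = Vec (Symbol 𝓐) n

      centred-agree : X → X → ℚ
      centred-agree x y = agree 𝓐 x y - N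

      centred-agree-sym : ∀ x y → centred-agree x y ≡ centred-agree y x
      centred-agree-sym x y = cong (_- N) (agree-sym 𝓐 x y)

      centred-agree-average : ∀ x → ∫ W (λ y → centred-agree x y) ≡ 0ℚ
      centred-agree-average x = begin
        ∫ W (λ y → agree 𝓐 x y - N)
          ≡⟨ ∫-- W _ _ ⟩
        ∫ W (λ y → agree 𝓐 x y) - ∫ W (λ _ → N)
          ≡⟨ cong₂ _-_ (trans (∫-cong W (λ y → agree-sym 𝓐 x y)) (agree-average 𝓐 n x))
                       (average-const (words-prob 𝓐 n) N) ⟩
        N - N
          ≡⟨ +-inverseʳ N ⟩
        0ℚ ∎
        where open ≡-Reasoning

      centred-agree-idempotent : ∀ x z → ∫ W (λ y → centred-agree x y * centred-agree z y) ≡ centred-agree x z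
      centred-agree-idempotent x z = begin
        ∫ W (λ y → (agree 𝓐 x y - N) * centred-agree z y)
          ≡⟨ trans (∫-cong W (λ y → expand (agree 𝓐 x y) N (agree 𝓐 z y))) (∫-- W _ _) ⟩
        ∫ W (λ y → agree 𝓐 x y * agree 𝓐 z y - N * agree 𝓐 x y) - ∫ W (λ y → N * centred-agree z y)
          ≡⟨ cong₂ _-_ (trans (∫-- W _ _) (cong₂ _-_ (agree-convolution n x z)
               (trans (∫-*ˡ W N _) (cong (N *_) (trans (∫-cong W (λ y → agree-sym 𝓐 x y)) (agree-average 𝓐 n x))))))
               (trans (∫-*ˡ W N _) (cong (N *_) (centred-agree-average z))) ⟩
        agree 𝓐 x z + (N * N - N) - N * N - N * 0ℚ
          ≡⟨ simplify (agree 𝓐 x z) N ⟩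
        agree 𝓐 x z - N ∎
        where
        open ≡-Reasoning
        expand : ∀ a n b → (a - n) * (b - n) ≡ a * b - n * a - n * (b - n)
        expand = solve-∀ ring
        simplify : ∀ a n → a + (n * n - n) - n * n - n * 0ℚ ≡ a - n
        simplify = solve-∀ ring

      correlation : (A C : Player 𝓐 n) → (State A → State C → ℚ) → ℚ
      correlation A C f = ∫∫ A C (λ s t → centred-agree (word A s) (word C t) * f s t)

      correlation-cong : ∀ A C {f g : State A → State C → ℚ} → (∀ s t → f s t ≡ g s t) → correlation A C f ≡ correlation A C g
      correlation-cong A C h = ∫-cong (law A) (λ s → ∫-cong (law C) (λ t →
        cong (centred-agree (word A s) (word C t) *_) (h s t)))

      correlation-+ : ∀ A C f g → correlation A C (λ s t → f s t + g s t) ≡ correlation A C f + correlation A C g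
      correlation-+ A C f g = trans
        (∫-cong (law A) (λ s → trans (∫-cong (law C) (λ t → *-distribˡ-+ (centred-agree (word A s) (word C t)) (f s t) (g s t)))
                                     (∫-+ (law C) _ _)))
        (∫-+ (law A) _ _)

      correlation-flip : ∀ A C f → correlation A C f ≡ correlation C A (λ t s → f s t)
      correlation-flip A C f = trans
        (∫-swap (law A) (law C) (λ s t → centred-agree (word A s) (word C t) * f s t))
        (∫-cong (law C) (λ t → ∫-cong (law A) (λ s → cong (_* f s t) (centred-agree-sym (word A s) (word C t)))))

      correlation-one-sided : ∀ A C (p : State A → ℚ) → correlation A C (λ s _ → p s) ≡ 0ℚ
      correlation-one-sided A C p = trans
        (∫-cong (law A) (λ s → trans (∫-*ʳ (law C) _ (p s)) (trans
          (cong (_* p s) (trans (word-uniform C (λ y → centred-agree (word A s) y)) (centred-agree-average (word A s))))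
          (*-zeroˡ (p s)))))
        (∫-0 (law A))

      ¼ : ℚ
      ¼ = ½ * ½

      ∫square≤¼ : ∀ {A : Set} {μ : Measure A} → Probability μ → ∀ {p : A → ℚ} → (∀ s → 0ℚ ≤ p s) → (∀ s → p s ≤ 1ℚ) →
                  ∫ μ (λ s → (p s - ½) * (p s - ½)) ≤ ¼
      ∫square≤¼ P {p} 0≤p p≤1 = average-≤ P ¼ (λ s →
        ≤-slack (p s * (1ℚ - p s)) (0≤* (0≤p s) (a≤b⇒0≤b-a (p≤1 s))) (eq (p s)))
        where
        eq : ∀ p → (p - ½) * (p - ½) + p * (1ℚ - p) ≡ ½ * ½
        eq = solve-∀ ring

      -- The projection with kernel `centred-agree` kills constants, so `p` and `q` may be shifted
      -- by 1/2. Both then have norm at most 1/2, and the bound is their product.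
      rectangle-correlation : ∀ A C (p : State A → ℚ) (q : State C → ℚ) → (∀ s → 0ℚ ≤ p s) → (∀ s → p s ≤ 1ℚ) → (∀ t → 0ℚ ≤ q t) → (∀ t → q t ≤ 1ℚ) →
        correlation A C (λ s t → p s * q t) ≤ ¼
      rectangle-correlation A C p q 0≤p p≤1 0≤q q≤1 = begin
        correlation A C (λ s t → p s * q t)
          ≡⟨ correlation≡ ⟩
        ∫ ν (λ t → (q t - ½) * w (word C t))
          ≤⟨ average-mono (law-prob C) (λ t → am-gm (q t - ½) (w (word C t))) ⟩
        ∫ ν (λ t → ½ * ((q t - ½) * (q t - ½) + w (word C t) * w (word C t)))
          ≡⟨ trans (∫-*ˡ ν ½ _) (cong (½ *_) (trans (∫-+ ν _ _)
               (cong (∫ ν (λ t → (q t - ½) * (q t - ½)) +_) (word-uniform C (λ y → w y * w y))))) ⟩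
        ½ * (∫ ν (λ t → (q t - ½) * (q t - ½)) + w²)
          ≤⟨ *-monoˡ-≤ ½ (nonNegative⁻¹ ½) (+-mono-≤ (∫square≤¼ (law-prob C) 0≤q q≤1) w²≤¼) ⟩
        ¼ ∎
        where
        open ≤-Reasoning
        μ = law A
        ν = law C
        -- The projection of `p`, as a function of the word.
        w : X → ℚ
        w y = ∫ μ (λ s → p s * centred-agree (word A s) y)
        w² = ∫ W (λ y → w y * w y)
        am-gm : ∀ a b → a * b ≤ ½ * (a * a + b * b)
        am-gm a b = ≤-slack (½ * ((a - b) * (a - b))) (0≤* (nonNegative⁻¹ ½) (0≤square (a - b))) (eq a b)
          where
          eq : ∀ a b → a * b + ½ * ((a - b) * (a - b)) ≡ ½ * (a * a + b * b)
          eq = solve-∀ ring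
        ∫w≡0 : ∫ W w ≡ 0ℚ
        ∫w≡0 = trans (∫-swap W μ (λ y s → p s * centred-agree (word A s) y)) (trans
          (∫-cong μ (λ s → trans (∫-*ˡ W (p s) _) (trans (cong (p s *_) (centred-agree-average (word A s))) (*-zeroʳ (p s)))))
          (∫-0 μ))
        correlation≡ : correlation A C (λ s t → p s * q t) ≡ ∫ ν (λ t → (q t - ½) * w (word C t))
        correlation≡ = begin-equality
          ∫ μ (λ s → ∫ ν (λ t → centred-agree (word A s) (word C t) * (p s * q t)))
            ≡⟨ ∫-swap μ ν (λ s t → centred-agree (word A s) (word C t) * (p s * q t)) ⟩
          ∫ ν (λ t → ∫ μ (λ s → centred-agree (word A s) (word C t) * (p s * q t)))
            ≡⟨ ∫-cong ν (λ t → trans (∫-cong μ (λ s → eq (centred-agree (word A s) (word C t)) (p s) (q t)))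
                 (trans (∫-*ˡ μ (q t) _) (eq₂ (q t) (w (word C t))))) ⟩
          ∫ ν (λ t → (q t - ½) * w (word C t) + ½ * w (word C t))
            ≡⟨ trans (∫-+ ν _ _) (cong (∫ ν (λ t → (q t - ½) * w (word C t)) +_)
                 (trans (∫-*ˡ ν ½ _) (cong (½ *_) (trans (word-uniform C w) ∫w≡0)))) ⟩
          ∫ ν (λ t → (q t - ½) * w (word C t)) + ½ * 0ℚ
            ≡⟨ +-identityʳ _ ⟩
          ∫ ν (λ t → (q t - ½) * w (word C t)) ∎
          where
          eq : ∀ k p q → k * (p * q) ≡ q * (p * k)
          eq = solve-∀ ring
          eq₂ : ∀ q w → q * w ≡ (q - ½) * w + ½ * w
          eq₂ = solve-∀ ring
        project : ∀ x → ∫ W (λ y → centred-agree x y * w y) ≡ w x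
        project x = begin-equality
          ∫ W (λ y → centred-agree x y * w y)
            ≡⟨ ∫-cong W (λ y → trans (sym (∫-*ˡ μ (centred-agree x y) _))
                 (∫-cong μ (λ s → eq (centred-agree x y) (p s) (centred-agree (word A s) y)))) ⟩
          ∫ W (λ y → ∫ μ (λ s → p s * (centred-agree (word A s) y * centred-agree x y)))
            ≡⟨ ∫-swap W μ (λ y s → p s * (centred-agree (word A s) y * centred-agree x y)) ⟩
          ∫ μ (λ s → ∫ W (λ y → p s * (centred-agree (word A s) y * centred-agree x y)))
            ≡⟨ ∫-cong μ (λ s → trans (∫-*ˡ W (p s) _) (cong (p s *_) (centred-agree-idempotent (word A s) x))) ⟩
          w x ∎
          where
          eq : ∀ k p l → k * (p * l) ≡ p * (l * k)
          eq = solve-∀ ring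
        pw : ∫ μ (λ s → p s * w (word A s)) ≡ w²
        pw = begin-equality
          ∫ μ (λ s → p s * w (word A s))
            ≡⟨ ∫-cong μ (λ s → trans (cong (p s *_) (sym (project (word A s))))
                 (trans (sym (∫-*ˡ W (p s) _)) (∫-cong W (λ y → sym (*-assoc (p s) (centred-agree (word A s) y) (w y)))))) ⟩
          ∫ μ (λ s → ∫ W (λ y → p s * centred-agree (word A s) y * w y))
            ≡⟨ ∫-swap μ W (λ s y → p s * centred-agree (word A s) y * w y) ⟩
          ∫ W (λ y → ∫ μ (λ s → p s * centred-agree (word A s) y * w y))
            ≡⟨ ∫-cong W (λ y → ∫-*ʳ μ _ (w y)) ⟩
          w² ∎
        -- A projection does not increase the norm: the residual p - ½ - w has a nonnegative square,
        -- and `pw` identifies its average as ‖p - ½‖² - ‖w‖².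
        w²≤¼ : w² ≤ ¼
        w²≤¼ = ≤-trans (0≤b-a⇒a≤b (subst (0ℚ ≤_) residual
                 (average-nonneg (law-prob A) (λ s → 0≤square (p s - ½ - w (word A s))))))
               (∫square≤¼ (law-prob A) 0≤p p≤1)
          where
          v = ∫ μ (λ s → (p s - ½) * (p s - ½))
          expand : ∀ p w → (p - ½ - w) * (p - ½ - w) ≡ ((p - ½) * (p - ½) + (w - 2ℚ * (p * w))) + w * w
          expand = solve-∀ ring
          simplify : ∀ v u → v + (0ℚ - 2ℚ * u) + u ≡ v - u
          simplify = solve-∀ ring
          residual : ∫ μ (λ s → (p s - ½ - w (word A s)) * (p s - ½ - w (word A s))) ≡ v - w²
          residual = begin-equality
            ∫ μ (λ s → (p s - ½ - w (word A s)) * (p s - ½ - w (word A s)))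
              ≡⟨ trans (∫-cong μ (λ s → expand (p s) (w (word A s)))) (∫-+ μ _ _) ⟩
            ∫ μ (λ s → (p s - ½) * (p s - ½) + (w (word A s) - 2ℚ * (p s * w (word A s)))) +
            ∫ μ (λ s → w (word A s) * w (word A s))
              ≡⟨ cong₂ _+_ (trans (∫-+ μ _ _) (cong (v +_) (trans (∫-- μ _ _)
                   (cong₂ _-_ (trans (word-uniform A w) ∫w≡0) (trans (∫-*ˡ μ 2ℚ _) (cong (2ℚ *_) pw))))))
                   (word-uniform A (λ y → w y * w y)) ⟩
            v + (0ℚ - 2ℚ * w²) + w²
              ≡⟨ simplify v w² ⟩
            v - w² ∎

  -- A protocol with empty messages still conveys one bit per round: whether
  -- a player stops.
  silent : ∀ {P Q k} → Receiver P Q k → P → Q → Bool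
  silent (declare f)   p q = f p
  silent (respond f g) p q with f p
  ... | inj₁ x = x
  ... | inj₂ _ = silent (g []) q p

  silent-correct : ∀ {P Q k} (ρ : Receiver P Q k) p q →
    All (λ m → length m ℕ.≤ 0) (proj₁ (runReceiver ρ p q)) → silent ρ p q ≡ proj₂ (runReceiver ρ p q)
  silent-correct (declare f)   p q _ = refl
  silent-correct (respond f g) p q short with f p
  ... | inj₁ x = refl
  silent-correct (respond f g) p q (_ ∷ short) | inj₂ [] = silent-correct (g []) q p short

  stops : Bool ⊎ Message → ℚ
  stops (inj₁ x) = indicator x
  stops (inj₂ _) = 0ℚ

  continues : Bool ⊎ Message → ℚ
  continues (inj₁ _) = 0ℚ
  continues (inj₂ _) = 1ℚ

  silent-respond : ∀ {P Q k} (f : P → Bool ⊎ Message) (g : Message → Receiver Q P k) p q →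
    indicator (silent (respond f g) p q) ≡ stops (f p) + continues (f p) * indicator (silent (g []) q p)
  silent-respond f g p q with f p
  ... | inj₁ x = sym (trans (cong (indicator x +_) (*-zeroˡ (indicator (silent (g []) q p)))) (+-identityʳ (indicator x)))
  ... | inj₂ _ = sym (trans (+-identityˡ _) (*-identityˡ _))

  In[0,1] : {A : Set} → (A → ℚ) → Set
  In[0,1] u = (∀ s → 0ℚ ≤ u s) × (∀ s → u s ≤ 1ℚ)

  *-In[0,1] : ∀ {A : Set} {u v : A → ℚ} → In[0,1] u → In[0,1] v → In[0,1] (λ s → u s * v s)
  *-In[0,1] (0≤u , u≤1) (0≤v , v≤1) =
    (λ s → 0≤* (0≤u s) (0≤v s)) , (λ s → ≤-trans (*-≤1ˡ (0≤v s) (u≤1 s)) (v≤1 s))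

  indicator-In[0,1] : ∀ {A : Set} (f : A → Bool) → In[0,1] (λ s → indicator (f s))
  indicator-In[0,1] f = (λ s → 0≤indicator (f s)) , (λ s → indicator≤1 (f s))

  stops-In[0,1] : ∀ {A : Set} (f : A → Bool ⊎ Message) → In[0,1] (λ s → stops (f s))
  stops-In[0,1] f = (λ s → low (f s)) , (λ s → high (f s))
    where
    low : ∀ o → 0ℚ ≤ stops o
    low (inj₁ x) = 0≤indicator x
    low (inj₂ _) = ≤-refl
    high : ∀ o → stops o ≤ 1ℚ
    high (inj₁ x) = indicator≤1 x
    high (inj₂ _) = 0≤1

  continues-In[0,1] : ∀ {A : Set} (f : A → Bool ⊎ Message) → In[0,1] (λ s → continues (f s))
  continues-In[0,1] f = (λ s → low (f s)) , (λ s → high (f s))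
    where
    low : ∀ o → 0ℚ ≤ continues o
    low (inj₁ _) = ≤-refl
    low (inj₂ _) = 0≤1
    high : ∀ o → continues o ≤ 1ℚ
    high (inj₁ _) = 0≤1
    high (inj₂ _) = ≤-refl

  module _ (𝓐 : Alphabet) {n : ℕ} where

    -- The inputs on which play stops at a given moment with output `true` form a rectangle, and so
    -- do those on which it goes on; `u` and `v` record the latter. With k messages left there are
    -- at most k + 1 such rectangles.
    silent-correlation : ∀ {k} (A C : Player 𝓐 n) (ρ : Receiver (State A) (State C) k)
      (u : State A → ℚ) (v : State C → ℚ) → In[0,1] u → In[0,1] v →
      correlation 𝓐 A C (λ s t → u s * v t * indicator (silent ρ s t)) ≤ ℕ→ℚ (suc k) * (½ * ½)
    silent-correlation A C (declare f) u v u∈ v∈ = ≤-trans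
      (≤-reflexive (correlation-cong 𝓐 A C (λ s t → eq (u s) (v t) (indicator (f s)))))
      (≤-trans (rectangle-correlation 𝓐 A C (λ s → u s * indicator (f s)) v (proj₁ uf∈) (proj₂ uf∈) (proj₁ v∈) (proj₂ v∈))
               (≤-reflexive refl))
      where
      uf∈ = *-In[0,1] u∈ (indicator-In[0,1] f)
      eq : ∀ u v i → u * v * i ≡ u * i * v
      eq = solve-∀ ring
    silent-correlation {suc k} A C (respond f g) u v u∈ v∈ = begin
      correlation 𝓐 A C (λ s t → u s * v t * indicator (silent (respond f g) s t))
        ≡⟨ trans (correlation-cong 𝓐 A C (λ s t → trans (cong (u s * v t *_) (silent-respond f g s t))
                   (eq (u s) (v t) (stops (f s)) (continues (f s)) (indicator (silent (g []) t s)))))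
                 (correlation-+ 𝓐 A C _ _) ⟩
      correlation 𝓐 A C (λ s t → u s * stops (f s) * v t) +
      correlation 𝓐 A C (λ s t → v t * (u s * continues (f s)) * indicator (silent (g []) t s))
        ≤⟨ +-mono-≤ (rectangle-correlation 𝓐 A C (λ s → u s * stops (f s)) v (proj₁ us∈) (proj₂ us∈) (proj₁ v∈) (proj₂ v∈))
             (≤-trans (≤-reflexive (correlation-flip 𝓐 A C _))
                      (silent-correlation C A (g []) v (λ s → u s * continues (f s)) v∈ (*-In[0,1] u∈ (continues-In[0,1] f)))) ⟩
      ½ * ½ + ℕ→ℚ (suc k) * (½ * ½)
        ≡⟨ trans (eq₂ (½ * ½) (ℕ→ℚ (suc k))) (cong (_* (½ * ½)) (sym (ℕ→ℚ-suc (suc k)))) ⟩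
      ℕ→ℚ (suc (suc k)) * (½ * ½) ∎
      where
      open ≤-Reasoning
      us∈ = *-In[0,1] u∈ (stops-In[0,1] f)
      eq : ∀ u v x y z → u * v * (x + y * z) ≡ u * x * v + v * (u * y) * z
      eq = solve-∀ ring
      eq₂ : ∀ q k → q + k * q ≡ (1ℚ + k) * q
      eq₂ = solve-∀ ring

    -- The first stop depends on one word only, so it does not count.
    silent-start-correlation : ∀ {k} (A C : Player 𝓐 n) (ρ : Receiver (State A) (State C) k) →
      correlation 𝓐 A C (λ s t → indicator (silent ρ s t)) ≤ ℕ→ℚ k * (½ * ½)
    silent-start-correlation A C (declare f) = ≤-reflexive (correlation-one-sided 𝓐 A C (λ s → indicator (f s)))
    silent-start-correlation {suc k} A C (respond f g) = begin
      correlation 𝓐 A C (λ s t → indicator (silent (respond f g) s t))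
        ≡⟨ trans (correlation-cong 𝓐 A C (λ s t → trans (silent-respond f g s t)
                   (eq (stops (f s)) (continues (f s)) (indicator (silent (g []) t s)))))
                 (correlation-+ 𝓐 A C (λ s _ → stops (f s)) _) ⟩
      correlation 𝓐 A C (λ s _ → stops (f s)) +
      correlation 𝓐 A C (λ s t → 1ℚ * continues (f s) * indicator (silent (g []) t s))
        ≤⟨ +-mono-≤ (≤-reflexive (correlation-one-sided 𝓐 A C (λ s → stops (f s))))
             (≤-trans (≤-reflexive (correlation-flip 𝓐 A C _))
                      (silent-correlation C A (g []) (λ _ → 1ℚ) (λ s → continues (f s)) ((λ _ → 0≤1) , (λ _ → ≤-refl)) (continues-In[0,1] f))) ⟩
      0ℚ + ℕ→ℚ (suc k) * (½ * ½)
        ≡⟨ +-identityˡ _ ⟩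
      ℕ→ℚ (suc k) * (½ * ½) ∎
      where
      open ≤-Reasoning
      eq : ∀ x y z → x + y * z ≡ x + 1ℚ * y * z
      eq = solve-∀ ring

-- Averaging over the random source

module Averaging where
  open import Data.Integer.Base using (+_)
  open import Data.Rational.Base
  open import Data.Rational.Properties
  open import Relation.Nullary.Decidable using (_×-dec_; ¬?; decidable-stable)
  open import Relation.Unary using (Pred; Decidable; _∈_; _⊆_; _≐_; _⊥_; U; ∁; ⋃; _∩_; _∪_)
  open import Tactic.RingSolver using (solve-∀)
  open RationalOrder
  open Integral
  open RoundElimination using (indicator; 0≤indicator)

  module _ (source : RandomSource) where
    open RandomSource source

    Event : Set₁
    Event = Pred Ω 0ℓ

    ∅′ : Event
    ∅′ = ∁ U

    ∅′-measurable : Measurable ∅′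
    ∅′-measurable = measurable-∁ measurable-U

    -- Finite additivity is obtained from countable additivity by appending empty events.
    two : Event → Event → ℕ → Event
    two X Y zero          = X
    two X Y (suc zero)    = Y
    two X Y (suc (suc _)) = ∅′

    two-measurable : ∀ {X Y} → Measurable X → Measurable Y → ∀ i → Measurable (two X Y i)
    two-measurable mX mY zero          = mX
    two-measurable mX mY (suc zero)    = mY
    two-measurable mX mY (suc (suc _)) = ∅′-measurable

    two-disjoint : ∀ {X Y} → X ⊥ Y → ∀ {i j} → i ≢ j → two X Y i ⊥ two X Y j
    two-disjoint X⊥Y {zero}        {zero}        i≢j = ⊥-elim (i≢j refl)
    two-disjoint X⊥Y {zero}        {suc zero}    i≢j = X⊥Y
    two-disjoint X⊥Y {suc zero}    {zero}        i≢j (y , x) = X⊥Y (x , y)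
    two-disjoint X⊥Y {suc zero}    {suc zero}    i≢j = ⊥-elim (i≢j refl)
    two-disjoint X⊥Y {suc (suc _)} {_}           i≢j (e , _) = e tt
    two-disjoint X⊥Y {zero}        {suc (suc _)} i≢j (_ , e) = e tt
    two-disjoint X⊥Y {suc zero}    {suc (suc _)} i≢j (_ , e) = e tt

    ⋃-two : ∀ {X Y Z : Event} → Z ⊆ X ∪ Y → X ⊆ Z → Y ⊆ Z → ⋃ ℕ (two X Y) ≐ Z
    ⋃-two {X} {Y} {Z} Z⊆ X⊆ Y⊆ = to , λ z → [ (λ x → 0 , x) , (λ y → 1 , y) ]′ (Z⊆ z)
      where
      to : ⋃ ℕ (two X Y) ⊆ Z
      to (zero          , x) = X⊆ x
      to (suc zero      , y) = Y⊆ y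
      to (suc (suc _)   , e) = ⊥-elim (e tt)

    module _ {X Y Z : Event} (mX : Measurable X) (mY : Measurable Y) (X⊥Y : X ⊥ Y)
             (Z⊆ : Z ⊆ X ∪ Y) (X⊆ : X ⊆ Z) (Y⊆ : Y ⊆ Z) where
      private
        fam = two X Y

        ℙZ≐ : ℙ Z ≐ ⋃ ℕ (λ k → sumᶜ k (λ i → ℙ (fam i)))
        ℙZ≐ = (λ q → proj₁ ℙ⋃ (proj₂ ℙ-family q)) , (λ q → proj₁ ℙ-family (proj₂ ℙ⋃ q))
          where
          ℙ⋃ = ℙ-⋃ (two-measurable mX mY) (two-disjoint X⊥Y)
          ℙ-family = ℙ-resp (measurable-⋃ (two-measurable mX mY)) (⋃-two Z⊆ X⊆ Y⊆)

      -- The term c < 0 is forced by the empty partial sum, the cut of 0, which contains only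
      -- negative rationals.
      ℙ-superadditive : ∀ {c a b} → c < 0ℚ → a ∈ ℙ X → b ∈ ℙ Y → (c + a) + b ∈ ℙ Z
      ℙ-superadditive {c} {a} {b} c<0 a∈ b∈ =
        proj₂ ℙZ≐ (2 , (c + a) , b , (c , a , c<0 , a∈ , refl) , b∈ , refl)

      -- The partial sum may have any length: missing terms are supplied by `ℙ-nonneg`, and surplus
      -- ones belong to the empty event.
      ℙ-subadditive : (∀ {e} → e ∈ ℙ ∅′ → e ≤ 0ℚ) →
                      ∀ {q} → q ∈ ℙ Z → ∃ λ a → ∃ λ b → a ∈ ℙ X × b ∈ ℙ Y × q ≤ a + b
      ℙ-subadditive ℙ∅′≤0 q∈ with proj₁ ℙZ≐ q∈
      ... | k , q∈sum = go k q∈sum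
        where
        go : ∀ k {q} → q ∈ sumᶜ k (λ i → ℙ (fam i)) → ∃ λ a → ∃ λ b → a ∈ ℙ X × b ∈ ℙ Y × q ≤ a + b
        go zero {q} q<0 = ½ * q , ½ * q , ℙ-nonneg mX hq<0 , ℙ-nonneg mY hq<0 , ≤-reflexive (eq q)
          where
          hq<0 : ½ * q < 0ℚ
          hq<0 = subst (½ * q <_) (*-zeroʳ ½) (*-monoʳ-<-pos ½ q<0)
          eq : ∀ q → q ≡ ½ * q + ½ * q
          eq = solve-∀ ring
        go (suc zero) (c , a , c<0 , a∈ , refl) =
          a , c , a∈ , ℙ-nonneg mY c<0 , ≤-reflexive (+-comm c a)
        go (suc (suc zero)) (_ , b , (c , a , c<0 , a∈ , refl) , b∈ , refl) =
          a , b , a∈ , b∈ , +-monoˡ-≤ b (≤-trans (+-monoˡ-≤ a (<⇒≤ c<0)) (≤-reflexive (+-identityˡ a)))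
        go (suc (suc (suc k))) (q′ , e , q′∈ , e∈ , refl) with go (suc (suc k)) q′∈
        ... | a , b , a∈ , b∈ , q′≤ = a , b , a∈ , b∈ ,
          ≤-trans (+-mono-≤ q′≤ (ℙ∅′≤0 e∈)) (≤-reflexive (+-identityʳ (a + b)))

    -- Uniting the sure event with an empty event of mass e > 0 would exceed 1. A half and a quarter
    -- of e absorb the strict inequalities.
    ℙ∅′≤0 : ∀ {e} → e ∈ ℙ ∅′ → e ≤ 0ℚ
    ℙ∅′≤0 {e} e∈ with e ≤? 0ℚ
    ... | yes e≤0 = e≤0
    ... | no  e≰0 = ⊥-elim (<-irrefl refl (<-trans 1<1+e/4 1+e/4<1))
      where
      ¼e = ½ * (½ * e)
      0<¼e : 0ℚ < ¼e
      0<¼e = subst (_< ¼e) refl (*-monoʳ-<-pos ½ (subst (_< ½ * e) refl (*-monoʳ-<-pos ½ (≰⇒> e≰0))))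
      1<1+e/4 : 1ℚ < 1ℚ + ¼e
      1<1+e/4 = subst (_< 1ℚ + ¼e) (+-identityʳ 1ℚ) (+-monoʳ-< 1ℚ 0<¼e)
      -¼e<0 : - ¼e < 0ℚ
      -¼e<0 = neg-antimono-< 0<¼e
      u∈ : (1ℚ - ½ * e) ∈ ℙ U
      u∈ = proj₂ ℙ-U (subst (1ℚ - ½ * e <_) (+-identityʳ 1ℚ)
        (+-monoʳ-< 1ℚ (neg-antimono-< (subst (_< ½ * e) refl (*-monoʳ-<-pos ½ (≰⇒> e≰0))))))
      eq : ∀ e → - (½ * (½ * e)) + (1ℚ - ½ * e) + e ≡ 1ℚ + ½ * (½ * e)
      eq = solve-∀ ring
      1+e/4<1 : 1ℚ + ¼e < 1ℚ
      1+e/4<1 = proj₁ ℙ-U (subst (_∈ ℙ U) (eq e)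
        (ℙ-superadditive measurable-U ∅′-measurable (λ (_ , e) → e tt) (λ _ → inj₁ tt) (λ _ → tt) (λ _ → tt) -¼e<0 u∈ e∈))

    ∩-measurable : ∀ {X Y : Event} → Decidable X → Decidable Y → Measurable X → Measurable Y → Measurable (X ∩ Y)
    ∩-measurable {X} {Y} X? Y? mX mY = measurable-resp
      ((λ {ω} h → decidable-stable (X? ω) (λ ¬x → h (0 , ¬x)) , decidable-stable (Y? ω) (λ ¬y → h (1 , ¬y))) ,
       (λ { (x , y) (zero , ¬x) → ¬x x ; (x , y) (suc zero , ¬y) → ¬y y ; (x , y) (suc (suc _) , e) → e tt }))
      (measurable-∁ (measurable-⋃ (two-measurable (measurable-∁ mX) (measurable-∁ mY))))

    lower-+ : ∀ {X Y Z : Event} → Measurable X → Measurable Y → X ⊥ Y → Z ⊆ X ∪ Y → X ⊆ Z → Y ⊆ Z →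
              ∀ {a b} → fromℚ a ≤ᶜ ℙ X → fromℚ b ≤ᶜ ℙ Y → fromℚ (a + b) ≤ᶜ ℙ Z
    lower-+ {Z = Z} mX mY X⊥Y Z⊆ X⊆ Y⊆ {a} {b} a≤ b≤ {q} q<a+b = subst (_∈ ℙ Z) (eq q a b)
      (ℙ-superadditive mX mY X⊥Y Z⊆ X⊆ Y⊆ third<0 (a≤ (below a)) (b≤ (below b)))
      where
      -- The gap between q and a + b is shared by the two cuts and the negative term of
      -- `ℙ-superadditive`.
      third = + 1 / 3
      d = third * (q - (a + b))
      third<0 : d < 0ℚ
      third<0 = subst (d <_) (*-zeroʳ third) (*-monoʳ-<-pos third
        (subst (q - (a + b) <_) (+-inverseʳ (a + b)) (+-monoˡ-< (- (a + b)) q<a+b)))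
      below : ∀ x → x + d < x
      below x = subst (x + d <_) (+-identityʳ x) (+-monoʳ-< x third<0)
      eq : ∀ q a b → third * (q - (a + b)) + (a + third * (q - (a + b))) + (b + third * (q - (a + b))) ≡ q
      eq q a b = trans (lemma third q a b) (refl′ q a b)
        where
        lemma : ∀ t q a b → t * (q - (a + b)) + (a + t * (q - (a + b))) + (b + t * (q - (a + b))) ≡
                            (a + b) + (t + t + t) * (q - (a + b))
        lemma = solve-∀ ring
        refl′ : ∀ q a b → (a + b) + 1ℚ * (q - (a + b)) ≡ q
        refl′ = solve-∀ ring

    module _ {J : Set} (A : J → Event) (A? : ∀ j → Decidable (A j)) (mA : ∀ j → Measurable (A j)) where

      occurs : J → Ω → ℚ
      occurs j ω = indicator (does (A? j ω))

      -- A lower bound t for the integral over `B` of the weighted number of occurring events,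
      -- witnessed by a rational lower bound for each `ℙ (A j ∩ B)`. No integral over Ω has to be
      -- defined.
      Attained : Measure J → Event → ℚ → Set
      Attained []            B t = t ≤ 0ℚ
      Attained ((w , j) ∷ m) B t = ∃ λ p → ∃ λ s →
        0ℚ ≤ p × (fromℚ p ≤ᶜ ℙ (A j ∩ B)) × Attained m B s × t ≤ w * p + s

      attained-≤ : ∀ m {B s t} → t ≤ s → Attained m B s → Attained m B t
      attained-≤ []      t≤s s≤0                           = ≤-trans t≤s s≤0
      attained-≤ (_ ∷ m) t≤s (p , s′ , 0≤p , p≤ , h , s≤) = p , s′ , 0≤p , p≤ , h , ≤-trans t≤s s≤

      attained-0 : ∀ m {B} → Decidable B → Measurable B → Attained m B 0ℚ
      attained-0 []            B? mB = ≤-refl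
      attained-0 ((w , j) ∷ m) B? mB = 0ℚ , 0ℚ , ≤-refl , ℙ-nonneg (∩-measurable (A? j) B? (mA j) mB) ,
        attained-0 m B? mB , ≤-reflexive (sym (trans (+-identityʳ (w * 0ℚ)) (*-zeroʳ w)))

      attained-+ : ∀ m {X Y Z} → Decidable X → Decidable Y → Measurable X → Measurable Y →
        X ⊥ Y → Z ⊆ X ∪ Y → X ⊆ Z → Y ⊆ Z →
        ∀ {s t} → Attained m X s → Attained m Y t → Attained m Z (s + t)
      attained-+ []            X? Y? mX mY X⊥Y Z⊆ X⊆ Y⊆ s≤0 t≤0 = +-mono-≤ s≤0 t≤0
      attained-+ ((w , j) ∷ m) X? Y? mX mY X⊥Y Z⊆ X⊆ Y⊆ (p , s′ , 0≤p , p≤ , hX , s≤) (r , t′ , 0≤r , r≤ , hY , t≤) =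
        p + r , s′ + t′ , 0≤+ 0≤p 0≤r ,
        lower-+ (∩-measurable (A? j) X? (mA j) mX) (∩-measurable (A? j) Y? (mA j) mY)
          (λ ((_ , x) , (_ , y)) → X⊥Y (x , y))
          (λ (a , z) → [ (λ x → inj₁ (a , x)) , (λ y → inj₂ (a , y)) ]′ (Z⊆ z))
          (λ (a , x) → a , X⊆ x) (λ (a , y) → a , Y⊆ y) p≤ r≤ ,
        attained-+ m X? Y? mX mY X⊥Y Z⊆ X⊆ Y⊆ hX hY ,
        ≤-trans (+-mono-≤ s≤ t≤) (≤-reflexive (eq w p s′ r t′))
        where
        eq : ∀ w p s r t → (w * p + s) + (w * r + t) ≡ w * (p + r) + (s + t)
        eq = solve-∀ ring

      0≤-scaled : ∀ {v q} → 0ℚ ≤ v → q ≤ 0ℚ → v * q ≤ 0ℚ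
      0≤-scaled {v} 0≤v q≤0 = ≤-trans (*-monoˡ-≤ v 0≤v q≤0) (≤-reflexive (*-zeroʳ v))

      -- The events are removed one by one: `B` is split by `A j`, and on the part inside `A j` the
      -- level that the remaining events must reach drops from v to `v - w`.
      attained : ∀ {m} → Nonneg m → ∀ {B} → Decidable B → Measurable B → ∀ {q v} → q ∈ ℙ B → 0ℚ ≤ v →
        (∀ ω → B ω → v ≤ ∫ m (λ j → occurs j ω)) → Attained m B (v * q)
      attained [] {B} B? mB {q} {v} q∈ 0≤v h with v ≤? 0ℚ
      ... | yes v≤0 = ≤-reflexive (trans (cong (_* q) (≤-antisym v≤0 0≤v)) (*-zeroˡ q))
      -- With no event left, a level v > 0 can be reached only on an empty `B`.
      ... | no  v≰0 = 0≤-scaled 0≤v (ℙ∅′≤0 (proj₁ (ℙ-resp mB ((λ {ω} b → ⊥-elim (v≰0 (h ω b))) ,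
                                                                (λ e → ⊥-elim (e tt)))) q∈))
      attained {(w , j) ∷ m} (0≤w ∷ 0≤m) {B} B? mB {q} {v} q∈ 0≤v h
        with ℙ-subadditive {B ∩ A j} {B ∩ ∁ (A j)} {B}
               (∩-measurable B? (A? j) mB (mA j)) (∩-measurable B? (λ ω → ¬? (A? j ω)) mB (measurable-∁ (mA j)))
               (λ ((_ , a) , (_ , ¬a)) → ¬a a) (λ {ω} b → cover b (A? j ω)) proj₁ proj₁ ℙ∅′≤0 q∈
        where
        cover : ∀ {ω} → B ω → Dec (A j ω) → (B ∩ A j) ω ⊎ (B ∩ ∁ (A j)) ω
        cover b (yes a) = inj₁ (b , a)
        cover b (no ¬a) = inj₂ (b , ¬a)
      ... | a , b , a∈ , b∈ , q≤a+b = attained-≤ ((w , j) ∷ m) total≤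
        (attained-+ ((w , j) ∷ m) X? Y? mX mY (λ ((_ , a) , (_ , ¬a)) → ¬a a)
          (λ {ω} b → cover b (A? j ω)) proj₁ proj₁ X-attained Y-attained)
        where
        X = B ∩ A j
        Y = B ∩ ∁ (A j)
        X? : Decidable X
        X? ω = B? ω ×-dec A? j ω
        Y? : Decidable Y
        Y? ω = B? ω ×-dec ¬? (A? j ω)
        mX : Measurable X
        mX = ∩-measurable B? (A? j) mB (mA j)
        mY : Measurable Y
        mY = ∩-measurable B? (λ ω → ¬? (A? j ω)) mB (measurable-∁ (mA j))
        cover : ∀ {ω} → B ω → Dec (A j ω) → X ω ⊎ Y ω
        cover b (yes a) = inj₁ (b , a)
        cover b (no ¬a) = inj₂ (b , ¬a)
        v′ = posPart (v - w)
        0≤occurs : ∀ j ω → 0ℚ ≤ occurs j ω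
        0≤occurs j ω = 0≤indicator (does (A? j ω))
        hX : ∀ ω → X ω → v′ ≤ ∫ m (λ j → occurs j ω)
        hX ω (b , a) = pos-lub (with-event (A? j ω) (h ω b)) (∫-nonneg 0≤m (λ j → 0≤occurs j ω))
          where
          eq : ∀ w s → w * 1ℚ + s - w ≡ s
          eq = solve-∀ ring
          with-event : (d : Dec (A j ω)) → v ≤ w * indicator (does d) + ∫ m (λ j → occurs j ω) →
                       v - w ≤ ∫ m (λ j → occurs j ω)
          with-event (yes _) v≤ = ≤-trans (+-monoˡ-≤ (- w) v≤) (≤-reflexive (eq w (∫ m (λ j → occurs j ω))))
          with-event (no ¬a) _  = contradiction a ¬a
        hY : ∀ ω → Y ω → v ≤ ∫ m (λ j → occurs j ω)
        hY ω (b , ¬a) = without-event (A? j ω) (h ω b)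
          where
          eq : ∀ w s → w * 0ℚ + s ≡ s
          eq = solve-∀ ring
          without-event : (d : Dec (A j ω)) → v ≤ w * indicator (does d) + ∫ m (λ j → occurs j ω) →
                          v ≤ ∫ m (λ j → occurs j ω)
          without-event (yes a) _  = contradiction a ¬a
          without-event (no _)  v≤ = ≤-trans v≤ (≤-reflexive (eq w (∫ m (λ j → occurs j ω))))
        mAX : Measurable (A j ∩ X)
        mAX = ∩-measurable (A? j) X? (mA j) mX
        -- `a` may be a negative element of the cut, but the witness has to be nonnegative.
        a⁺≤ : fromℚ (posPart a) ≤ᶜ ℙ (A j ∩ X)
        a⁺≤ {x} x<a⁺ with x <? 0ℚ
        ... | yes x<0 = ℙ-nonneg mAX x<0
        ... | no  x≮0 = proj₁ (ℙ-resp mX ((λ (b , a) → a , (b , a)) , proj₂)) (IsCut.closed (ℙ-isCut mX) x≤a a∈)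
          where
          x≤a : x ≤ a
          x≤a with x ≤? a
          ... | yes p = p
          ... | no ¬p = contradiction (<-≤-trans x<a⁺ (pos-lub (<⇒≤ (≰⇒> ¬p)) (≮⇒≥ x≮0))) (<-irrefl refl)
        X-attained : Attained ((w , j) ∷ m) X (w * posPart a + v′ * a)
        X-attained = posPart a , v′ * a , 0≤pos a , a⁺≤ , attained 0≤m X? mX a∈ (0≤pos (v - w)) hX , ≤-refl
        Y-attained : Attained ((w , j) ∷ m) Y (v * b)
        Y-attained = 0ℚ , v * b , ≤-refl , ℙ-nonneg (∩-measurable (A? j) Y? (mA j) mY) ,
          attained 0≤m Y? mY b∈ 0≤v hY , ≤-reflexive (eq w (v * b))
          where
          eq : ∀ w s → s ≡ w * 0ℚ + s
          eq = solve-∀ ring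
        va≤ : v * a ≤ w * posPart a + v′ * a
        va≤ with ≤-total 0ℚ a
        ... | inj₁ 0≤a = begin
          v * a                   ≤⟨ *-monoʳ-≤ a 0≤a (≤-trans (≤-reflexive (eq v w)) (+-monoʳ-≤ w (≤pos (v - w)))) ⟩
          (w + v′) * a            ≡⟨ *-distribʳ-+ a w v′ ⟩
          w * a + v′ * a          ≤⟨ +-monoˡ-≤ (v′ * a) (*-monoˡ-≤ w 0≤w (≤pos a)) ⟩
          w * posPart a + v′ * a  ∎
          where
          open ≤-Reasoning
          eq : ∀ v w → v ≡ w + (v - w)
          eq = solve-∀ ring
        ... | inj₂ a≤0 = ≤-slack (w * posPart a + (v - v′) * (- a))
          (0≤+ (0≤* 0≤w (0≤pos a)) (0≤* (a≤b⇒0≤b-a (pos-lub {v - w} (≤-slack w 0≤w (eq v w)) 0≤v)) (neg-antimono-≤ a≤0)))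
          (eq₂ v a (w * posPart a) v′)
          where
          eq : ∀ v w → v - w + w ≡ v
          eq = solve-∀ ring
          eq₂ : ∀ v a p u → v * a + (p + (v - u) * (- a)) ≡ p + u * a
          eq₂ = solve-∀ ring
        total≤ : v * q ≤ w * posPart a + v′ * a + v * b
        total≤ = begin
          v * q                            ≤⟨ *-monoˡ-≤ v 0≤v q≤a+b ⟩
          v * (a + b)                      ≡⟨ *-distribˡ-+ v a b ⟩
          v * a + v * b                    ≤⟨ +-monoˡ-≤ (v * b) va≤ ⟩
          w * posPart a + v′ * a + v * b   ∎
          where open ≤-Reasoning

      attained-bound : ∀ {m} → Nonneg m → ∀ ε → (∀ j → ℙ (A j) ≤ᶜ fromℚ ε) → ∀ {t} → Attained m U t →
                       t ≤ ∫ m (λ _ → 1ℚ) * ε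
      attained-bound []  ε ℙ≤ε t≤0 = ≤-trans t≤0 (≤-reflexive (sym (*-zeroˡ ε)))
      attained-bound {(w , j) ∷ m} (0≤w ∷ 0≤m) ε ℙ≤ε {t} (p , s , 0≤p , p≤ , h , t≤) = begin
        t                                 ≤⟨ t≤ ⟩
        w * p + s                         ≤⟨ +-mono-≤ (*-monoˡ-≤ w 0≤w p≤ε) (attained-bound 0≤m ε ℙ≤ε h) ⟩
        w * ε + ∫ m (λ _ → 1ℚ) * ε        ≡⟨ eq w ε (∫ m (λ _ → 1ℚ)) ⟩
        (w * 1ℚ + ∫ m (λ _ → 1ℚ)) * ε     ∎
        where
        open ≤-Reasoning
        eq : ∀ w e s → w * e + s * e ≡ (w * 1ℚ + s) * e
        eq = solve-∀ ring
        p≤ε : p ≤ ε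
        p≤ε with p ≤? ε
        ... | yes le = le
        ... | no ¬le with <-dense (≰⇒> ¬le)
        ...   | r , ε<r , r<p = contradiction
                  (ℙ≤ε j (proj₁ (ℙ-resp (∩-measurable (A? j) (λ _ → yes tt) (mA j) measurable-U) (proj₁ , λ a → a , tt)) (p≤ r<p)))
                  (<-asym ε<r)

      -- The easy direction of Yao's principle: errors of probability at most ε on every input bound
      -- the weighted error of the best deterministic protocol. The factor q < 1 stems from ℙ of the
      -- sure event being an open cut.
      averaging : ∀ {m} → Nonneg m → ∀ ε → (∀ j → ℙ (A j) ≤ᶜ fromℚ ε) → ∀ {v} → 0ℚ ≤ v →
                  (∀ ω → v ≤ ∫ m (λ j → occurs j ω)) → ∀ {q} → q < 1ℚ → v * q ≤ ∫ m (λ _ → 1ℚ) * ε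
      averaging 0≤m ε ℙ≤ε 0≤v h q<1 =
        attained-bound 0≤m ε ℙ≤ε (attained 0≤m (λ _ → yes tt) measurable-U (proj₂ ℙ-U q<1) 0≤v (λ ω _ → h ω))

-- Choice of the parameters, and tower growth

module Numerics where
  open import Data.Nat.Base
  open import Data.Nat.DivMod using (m≡m%n+[m/n]*n; m%n<n; m/n*n≤m; /-monoˡ-≤)
  open import Data.Nat.Properties
  open import Data.Nat.Tactic.RingSolver using (solve-∀)
  open Elimination using (Feasible; done; step; blockSize)

  m+n≤o⇒n≤o∸m : ∀ m {n o} → m + n ≤ o → n ≤ o ∸ m
  m+n≤o⇒n≤o∸m m {n} {o} h = m+n≤o⇒m≤o∸n n (subst (_≤ o) (+-comm m n) h)

  n<2^n : ∀ n → n < 2 ^ n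
  n<2^n zero    = s≤s z≤n
  n<2^n (suc n) = begin-strict
    suc n           <⟨ s≤s (n<2^n n) ⟩
    suc (2 ^ n)     ≤⟨ +-monoˡ-≤ (2 ^ n) (m^n>0 2 n) ⟩
    2 ^ n + 2 ^ n   ≡⟨ eq (2 ^ n) ⟩
    2 ^ suc n       ∎
    where
    open ≤-Reasoning
    eq : ∀ x → x + x ≡ 2 * x
    eq = solve-∀

  2^-mono : ∀ {m n} → m ≤ n → 2 ^ m ≤ 2 ^ n
  2^-mono = ^-monoʳ-≤ 2

  2^-cancel-< : ∀ m n → 2 ^ m < 2 ^ n → m < n
  2^-cancel-< m n 2^m<2^n with m <? n
  ... | yes m<n = m<n
  ... | no  m≮n = contradiction (2^-mono (≮⇒≥ m≮n)) (<⇒≱ 2^m<2^n)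

  log₂ : ∀ n → 1 ≤ n → ∃ λ s → 2 ^ s ≤ n × n < 2 ^ suc s
  log₂ (suc zero)    1≤n = 0 , s≤s z≤n , s≤s (s≤s z≤n)
  log₂ (suc (suc n)) 1≤n with log₂ (suc n) (s≤s z≤n)
  ... | s , lo , hi with suc (suc n) <? 2 ^ suc s
  ...   | yes lt = s , m≤n⇒m≤1+n lo , lt
  ...   | no ¬lt = suc s , ≮⇒≥ ¬lt , (begin-strict
    suc (suc n)               ≤⟨ hi ⟩
    2 ^ suc s                 <⟨ n<2n (2 ^ suc s) (m^n>0 2 (suc s)) ⟩
    2 ^ suc (suc s)           ∎)
    where
    open ≤-Reasoning
    n<2n : ∀ n → 1 ≤ n → n < 2 * n
    n<2n n 1≤n = ≤-trans (+-monoˡ-≤ n 1≤n) (+-monoʳ-≤ n (m≤m+n n 0))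

  tower : ℕ → ℕ → ℕ
  tower zero    x = x
  tower (suc r) x = tower r (2 ^ x)

  tower-mono : ∀ r {x y} → x ≤ y → tower r x ≤ tower r y
  tower-mono zero    x≤y = x≤y
  tower-mono (suc r) x≤y = tower-mono r (2^-mono x≤y)

  x≤tower : ∀ r x → x ≤ tower r x
  x≤tower zero    x = ≤-refl
  x≤tower (suc r) x = ≤-trans (<⇒≤ (n<2^n x)) (x≤tower r (2 ^ x))

  tower-suc : ∀ r x → tower (suc r) x ≡ 2 ^ tower r x
  tower-suc zero    x = refl
  tower-suc (suc r) x = tower-suc r (2 ^ x)

  -- In a round at which log^(r) has reached 2^x, a message reveals fewer than
  -- width x bits per coordinate and n is divided by 2^(width x + 1 + 2e).
  width : ℕ → ℕ
  width x = suc (2 ^ x / 8)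

  remaining : ℕ → ℕ → ℕ → ℕ
  remaining zero    x e = 0
  remaining (suc r) x e = (suc (width x) + 2 * e) + remaining r (2 ^ x) (suc e)

  -- A round multiplies b/2^s by 2^(width x + 1 + 2e), while the size tolerated by the next round
  -- grows from about 2^x to 2^(2^x). For small x the former may win; `slack` is the number of bits
  -- to be saved beforehand, zero once 2^x dominates.
  slack : ℕ → ℕ → ℕ → ℕ
  slack zero    x e = 0
  slack (suc r) x e = (slack r (2 ^ x) (suc e) + (2 + (suc (width x) + 2 * e) + x)) ∸ 2 ^ x

  m≤8*[1+m/8] : ∀ m → m ≤ 8 * suc (m / 8)
  m≤8*[1+m/8] m = begin
    m                        ≡⟨ m≡m%n+[m/n]*n m 8 ⟩
    m % 8 + m / 8 * 8        ≤⟨ +-monoˡ-≤ (m / 8 * 8) (<⇒≤ (m%n<n m 8)) ⟩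
    8 + m / 8 * 8            ≡⟨ *-comm (suc (m / 8)) 8 ⟩
    8 * suc (m / 8)          ∎
    where open ≤-Reasoning

  -- With k = s - e, which is at least half of s: s ≤ 2k ≤ 2^k.
  ≤2^half : ∀ e s → 2 * e + 2 ≤ s → s ≤ 2 ^ (s ∸ e)
  ≤2^half e s h = begin
    s                        ≤⟨ m≤n+m∸n s e ⟩
    e + (s ∸ e)              ≤⟨ +-monoˡ-≤ (s ∸ e) e≤k ⟩
    k + k                    ≤⟨ two-k k ⟩
    2 ^ k                    ∎
    where
    open ≤-Reasoning
    k = s ∸ e
    e≤k : e ≤ k
    e≤k = m+n≤o⇒n≤o∸m e (≤-trans (≤-trans (≤-reflexive (cong (e +_) (sym (+-identityʳ e)))) (m≤m+n (2 * e) 2)) h)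
    two-k : ∀ k → k + k ≤ 2 ^ k
    two-k zero    = z≤n
    two-k (suc k) = begin
      suc k + suc k     ≤⟨ +-mono-≤ (n<2^n k) (n<2^n k) ⟩
      2 ^ k + 2 ^ k     ≡⟨ cong (2 ^ k +_) (+-identityʳ (2 ^ k)) ⟨
      2 ^ suc k         ∎

  3+e≤2^e : ∀ e → 3 ≤ e → 3 + e ≤ 2 ^ e
  3+e≤2^e e 3≤e = subst (λ e → 3 + e ≤ 2 ^ e) (m+[n∸m]≡n 3≤e) (go (e ∸ 3))
    where
    open ≤-Reasoning
    go : ∀ k → 3 + (3 + k) ≤ 2 ^ (3 + k)
    go zero    = m≤m+n 6 2
    go (suc k) = begin
      3 + (3 + suc k)             ≡⟨ cong (3 +_) (+-suc 3 k) ⟩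
      suc (3 + (3 + k))           ≤⟨ +-mono-≤ (m^n>0 2 (3 + k)) (go k) ⟩
      2 ^ (3 + k) + 2 ^ (3 + k)   ≡⟨ cong (2 ^ (3 + k) +_) (+-identityʳ (2 ^ (3 + k))) ⟨
      2 ^ (3 + suc k)             ∎

  2+b+e≤b*2^e : ∀ b e → 1 ≤ b → 3 ≤ e → 2 + b + e ≤ b * 2 ^ e
  2+b+e≤b*2^e (suc b) e 1≤b 3≤e = begin
    2 + suc b + e            ≡⟨ eq b e ⟩
    (3 + e) + b * 1          ≤⟨ +-mono-≤ (3+e≤2^e e 3≤e) (*-monoʳ-≤ b (m^n>0 2 e)) ⟩
    2 ^ e + b * 2 ^ e        ∎
    where
    open ≤-Reasoning
    eq : ∀ b e → 2 + suc b + e ≡ (3 + e) + b * 1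
    eq = solve-∀

  -- Take d = 2^(s - e), which is εn. In the exponent M d with M = w + 1, the part w d absorbs the c
  -- + e bits of the density bound, and the additional d the s bits due to the lowest threshold 1/n.
  feasible-step : ∀ {r} b e w s → 1 ≤ b → 3 ≤ e → (b * 2 ^ (2 * e)) ≤ 2 ^ s * w → suc w + 2 * e ≤ s → 1 ≤ w →
    Feasible (2 + b) r (suc e) (2 ^ (s ∸ (suc w + 2 * e))) → Feasible (2 + b) (suc r) e (2 ^ s)
  feasible-step {r} b e w s 1≤b 3≤e b≤ room 1≤w feasible =
    subst (Feasible (2 + b) (suc r) e) n≡ (step M d entropy≤ d≤ feasible)
    where
    open ≤-Reasoning
    M = suc w
    s′ = s ∸ (M + 2 * e)
    d = 2 ^ (s ∸ e)
    e≤s : e ≤ s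
    e≤s = ≤-trans (m≤m+n e (e + 0)) (≤-trans (m≤n+m (2 * e) M) room)
    2e+2≤s : 2 * e + 2 ≤ s
    2e+2≤s = ≤-trans (≤-trans (+-monoʳ-≤ (2 * e) (s≤s 1≤w)) (≤-reflexive (+-comm (2 * e) M))) room
    d*2^e : d * 2 ^ e ≡ 2 ^ s
    d*2^e = trans (sym (^-distribˡ-+-* 2 (s ∸ e) e)) (cong (2 ^_) (m∸n+n≡m e≤s))
    n≡ : 2 ^ s′ * blockSize M e ≡ 2 ^ s
    n≡ = begin-equality
      2 ^ s′ * (2 ^ M * (2 ^ e * 2 ^ e))   ≡⟨ cong (λ k → 2 ^ s′ * (2 ^ M * k)) (^-distribˡ-+-* 2 e e) ⟨
      2 ^ s′ * (2 ^ M * 2 ^ (e + e))       ≡⟨ cong (2 ^ s′ *_) (^-distribˡ-+-* 2 M (e + e)) ⟨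
      2 ^ s′ * 2 ^ (M + (e + e))           ≡⟨ ^-distribˡ-+-* 2 s′ (M + (e + e)) ⟨
      2 ^ (s′ + (M + (e + e)))             ≡⟨ cong (λ k → 2 ^ (s′ + (M + (e + k)))) (+-identityʳ e) ⟨
      2 ^ (s′ + (M + 2 * e))               ≡⟨ cong (2 ^_) (m∸n+n≡m room) ⟩
      2 ^ s                                ∎
    c+e≤ : 2 + b + e ≤ w * d
    c+e≤ = *-cancelʳ-≤ (2 + b + e) (w * d) (2 ^ e) {{>-nonZero (m^n>0 2 e)}} (begin
      (2 + b + e) * 2 ^ e          ≤⟨ *-monoˡ-≤ (2 ^ e) (2+b+e≤b*2^e b e 1≤b 3≤e) ⟩
      b * 2 ^ e * 2 ^ e            ≡⟨ trans (*-assoc b (2 ^ e) (2 ^ e)) (cong (b *_) (sym (^-distribˡ-+-* 2 e e))) ⟩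
      b * 2 ^ (e + e)              ≡⟨ cong (λ k → b * 2 ^ (e + k)) (+-identityʳ e) ⟨
      b * 2 ^ (2 * e)              ≤⟨ b≤ ⟩
      2 ^ s * w                    ≡⟨ cong (_* w) d*2^e ⟨
      d * 2 ^ e * w                ≡⟨ eq d (2 ^ e) w ⟩
      w * d * 2 ^ e                ∎)
      where
      eq : ∀ d p w → d * p * w ≡ w * d * p
      eq = solve-∀
    entropy≤ : 2 ^ (2 + b + e) * (2 ^ s′ * blockSize M e) ≤ 2 ^ (M * d)
    entropy≤ = begin
      2 ^ (2 + b + e) * (2 ^ s′ * blockSize M e)   ≡⟨ cong (2 ^ (2 + b + e) *_) n≡ ⟩
      2 ^ (2 + b + e) * 2 ^ s                      ≡⟨ ^-distribˡ-+-* 2 (2 + b + e) s ⟨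
      2 ^ (2 + b + e + s)                          ≤⟨ 2^-mono (+-mono-≤ c+e≤ (≤2^half e s 2e+2≤s)) ⟩
      2 ^ (w * d + d)                              ≡⟨ cong (2 ^_) (+-comm (w * d) d) ⟩
      2 ^ (M * d)                                  ∎
    d≤ : (d + 2) * 2 ^ e ≤ 2 * (2 ^ s′ * blockSize M e)
    d≤ = begin
      (d + 2) * 2 ^ e              ≡⟨ *-distribʳ-+ (2 ^ e) d 2 ⟩
      d * 2 ^ e + 2 ^ suc e        ≤⟨ +-mono-≤ (≤-reflexive d*2^e) (2^-mono 1+e≤s) ⟩
      2 ^ s + 2 ^ s                ≡⟨ cong (2 ^ s +_) (+-identityʳ (2 ^ s)) ⟨
      2 * 2 ^ s                    ≡⟨ cong (2 *_) n≡ ⟨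
      2 * (2 ^ s′ * blockSize M e) ∎
      where
      1+e≤s : suc e ≤ s
      1+e≤s = ≤-trans (s≤s (≤-trans (m≤m+n e (e + 0)) (m≤n+m (2 * e) w))) room

  -- In the size hypothesis 2e is the price of the precision 2^-e, 3 pays for the division by 8 in
  -- `width`, and `slack` is the reserve for later rounds.
  feasible-rounds : ∀ r b x e s → 1 ≤ b → 3 ≤ e → b * 2 ^ (2 * e + 3 + slack r x e) ≤ 2 ^ (s + x) →
                    remaining r x e ≤ s → Feasible (2 + b) r e (2 ^ s)
  feasible-rounds zero    b x e s 1≤b 3≤e size room = done
  feasible-rounds (suc r) b x e s 1≤b 3≤e size room =
    feasible-step b e (width x) s 1≤b 3≤e size₀ room₀ (s≤s z≤n)
      (feasible-rounds r b (2 ^ x) (suc e) s′ 1≤b (m≤n⇒m≤1+n 3≤e) size′ room′)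
    where
    open ≤-Reasoning
    k = suc (width x) + 2 * e
    s′ = s ∸ k
    a = slack (suc r) x e
    a′ = slack r (2 ^ x) (suc e)
    room₀ : k ≤ s
    room₀ = ≤-trans (m≤m+n k _) room
    room′ : remaining r (2 ^ x) (suc e) ≤ s′
    room′ = m+n≤o⇒n≤o∸m k room
    size₀ : b * 2 ^ (2 * e) ≤ 2 ^ s * width x
    size₀ = *-cancelʳ-≤ (b * 2 ^ (2 * e)) (2 ^ s * width x) 8 (begin
      b * 2 ^ (2 * e) * 2 ^ 3           ≡⟨ trans (*-assoc b (2 ^ (2 * e)) (2 ^ 3)) (cong (b *_) (sym (^-distribˡ-+-* 2 (2 * e) 3))) ⟩
      b * 2 ^ (2 * e + 3)               ≤⟨ *-monoʳ-≤ b (2^-mono (m≤m+n (2 * e + 3) a)) ⟩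
      b * 2 ^ (2 * e + 3 + a)           ≤⟨ size ⟩
      2 ^ (s + x)                       ≡⟨ ^-distribˡ-+-* 2 s x ⟩
      2 ^ s * 2 ^ x                     ≤⟨ *-monoʳ-≤ (2 ^ s) (m≤8*[1+m/8] (2 ^ x)) ⟩
      2 ^ s * (8 * width x)             ≡⟨ eq (2 ^ s) (width x) ⟩
      2 ^ s * width x * 8               ∎)
      where
      eq : ∀ p w → p * (8 * w) ≡ p * w * 8
      eq = solve-∀
    size′ : b * 2 ^ (2 * suc e + 3 + a′) ≤ 2 ^ (s′ + 2 ^ x)
    size′ = *-cancelʳ-≤ (b * 2 ^ (2 * suc e + 3 + a′)) (2 ^ (s′ + 2 ^ x)) (2 ^ (k + x)) {{>-nonZero (m^n>0 2 (k + x))}} (begin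
      b * 2 ^ (2 * suc e + 3 + a′) * 2 ^ (k + x)
        ≡⟨ trans (*-assoc b _ _) (cong (b *_) (sym (^-distribˡ-+-* 2 (2 * suc e + 3 + a′) (k + x)))) ⟩
      b * 2 ^ (2 * suc e + 3 + a′ + (k + x))
        ≡⟨ cong (λ i → b * 2 ^ i) (eq e a′ k x) ⟩
      b * 2 ^ (2 * e + 3 + (a′ + (2 + k + x)))
        ≤⟨ *-monoʳ-≤ b (2^-mono (+-monoʳ-≤ (2 * e + 3) (m≤n+m∸n (a′ + (2 + k + x)) (2 ^ x)))) ⟩
      b * 2 ^ (2 * e + 3 + (2 ^ x + a))
        ≡⟨ cong (λ i → b * 2 ^ i) (eq₂ e (2 ^ x) a) ⟩
      b * 2 ^ (2 * e + 3 + a + 2 ^ x)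
        ≡⟨ trans (cong (b *_) (^-distribˡ-+-* 2 (2 * e + 3 + a) (2 ^ x))) (sym (*-assoc b _ _)) ⟩
      b * 2 ^ (2 * e + 3 + a) * 2 ^ (2 ^ x)
        ≤⟨ *-monoˡ-≤ (2 ^ (2 ^ x)) size ⟩
      2 ^ (s + x) * 2 ^ (2 ^ x)
        ≡⟨ ^-distribˡ-+-* 2 (s + x) (2 ^ x) ⟨
      2 ^ (s + x + 2 ^ x)
        ≡⟨ cong (λ i → 2 ^ (i + x + 2 ^ x)) (m∸n+n≡m room₀) ⟨
      2 ^ (s′ + k + x + 2 ^ x)
        ≡⟨ trans (cong (2 ^_) (eq₃ s′ k x (2 ^ x))) (^-distribˡ-+-* 2 (s′ + 2 ^ x) (k + x)) ⟩
      2 ^ (s′ + 2 ^ x) * 2 ^ (k + x) ∎)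
      where
      eq : ∀ e a k x → 2 * suc e + 3 + a + (k + x) ≡ 2 * e + 3 + (a + (2 + k + x))
      eq = solve-∀
      eq₂ : ∀ e p a → 2 * e + 3 + (p + a) ≡ 2 * e + 3 + a + p
      eq₂ = solve-∀
      eq₃ : ∀ s k x p → s + k + x + p ≡ s + p + (k + x)
      eq₃ = solve-∀

  -- After j more rounds, x has overtaken e and grows as a tower.
  Late : ℕ → ℕ → ℕ → Set
  Late zero    x e = e ≤ x
  Late (suc j) x e = Late j (2 ^ x) (suc e)

  Late-mono : ∀ j {x y e} → x ≤ y → Late j x e → Late j y e
  Late-mono zero    x≤y e≤x = ≤-trans e≤x x≤y
  Late-mono (suc j) x≤y l   = Late-mono j (2^-mono x≤y) l

  reduction : ℕ → ℕ → ℕ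
  reduction x e = suc (width x) + 2 * e

  8+6x≤2^x : ∀ x → 8 ≤ x → 2 * (8 + 6 * x) ≤ 2 ^ x
  8+6x≤2^x x 8≤x = subst (λ x → 2 * (8 + 6 * x) ≤ 2 ^ x) (m+[n∸m]≡n 8≤x) (go (x ∸ 8))
    where
    open ≤-Reasoning
    eq : ∀ k → 2 * (8 + 6 * (8 + suc k)) ≡ 2 * (8 + 6 * (8 + k)) + 12
    eq = solve-∀
    go : ∀ k → 2 * (8 + 6 * (8 + k)) ≤ 2 ^ (8 + k)
    go zero    = ≤ᵇ⇒≤ 112 256 _
    go (suc k) = begin
      2 * (8 + 6 * (8 + suc k))             ≡⟨ eq k ⟩
      2 * (8 + 6 * (8 + k)) + 12            ≤⟨ +-mono-≤ (go k) (≤-trans (≤ᵇ⇒≤ 12 256 _) (2^-mono (m≤m+n 8 k))) ⟩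
      2 ^ (8 + k) + 2 ^ (8 + k)             ≡⟨ cong (2 ^ (8 + k) +_) (+-identityʳ (2 ^ (8 + k))) ⟨
      2 * 2 ^ (8 + k)                       ≡⟨ cong (2 ^_) (+-suc 8 k) ⟨
      2 ^ (8 + suc k)                       ∎

  -- `width` takes an eighth of 2^x, and from x = 8 on the linear terms fit into the rest.
  late-reduction : ∀ x e → 8 ≤ e → e ≤ x → 2 * (reduction x e + x) ≤ 2 ^ x
  late-reduction x e 8≤e e≤x = *-cancelˡ-≤ 4 (begin
    4 * (2 * (suc (suc z) + 2 * e + x))     ≤⟨ *-monoʳ-≤ 4 (*-monoʳ-≤ 2 (+-monoˡ-≤ x (+-monoʳ-≤ (2 + z) (*-monoʳ-≤ 2 e≤x)))) ⟩
    4 * (2 * (suc (suc z) + 2 * x + x))     ≡⟨ eq z x ⟩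
    z * 8 + (16 + 24 * x)                   ≤⟨ +-mono-≤ (m/n*n≤m (2 ^ x) 8) small ⟩
    2 ^ x + 3 * 2 ^ x                       ≡⟨⟩
    4 * 2 ^ x                               ∎)
    where
    open ≤-Reasoning
    z = 2 ^ x / 8
    eq : ∀ z x → 4 * (2 * (suc (suc z) + 2 * x + x)) ≡ z * 8 + (16 + 24 * x)
    eq = solve-∀
    eq₂ : ∀ x → 16 + 24 * x + 16 ≡ 2 * (2 * (8 + 6 * x))
    eq₂ = solve-∀
    small : 16 + 24 * x ≤ 3 * 2 ^ x
    small = begin
      16 + 24 * x               ≤⟨ m≤m+n (16 + 24 * x) 16 ⟩
      16 + 24 * x + 16          ≡⟨ eq₂ x ⟩
      2 * (2 * (8 + 6 * x))     ≤⟨ *-monoʳ-≤ 2 (8+6x≤2^x x (≤-trans 8≤e e≤x)) ⟩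
      2 * 2 ^ x                 ≤⟨ *-monoˡ-≤ (2 ^ x) (m≤m+n 2 1) ⟩
      3 * 2 ^ x                 ∎

  -- The summand x closes the induction: a reduction plus x is at most 2^x, the x of the next round.
  -- All rounds together use at most half of the tower.
  late-remaining : ∀ r x e → 8 ≤ e → e ≤ x → 2 * (remaining (suc r) x e + x) ≤ tower (suc r) x
  late-remaining zero    x e 8≤e e≤x = begin
    2 * (reduction x e + 0 + x)     ≡⟨ cong (λ k → 2 * (k + x)) (+-identityʳ (reduction x e)) ⟩
    2 * (reduction x e + x)         ≤⟨ late-reduction x e 8≤e e≤x ⟩
    2 ^ x                           ∎
    where open ≤-Reasoning
  late-remaining (suc r) x e 8≤e e≤x = begin
    2 * (reduction x e + remaining (suc r) (2 ^ x) (suc e) + x)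
      ≡⟨ cong (2 *_) (eq (reduction x e) (remaining (suc r) (2 ^ x) (suc e)) x) ⟩
    2 * (remaining (suc r) (2 ^ x) (suc e) + (reduction x e + x))
      ≤⟨ *-monoʳ-≤ 2 (+-monoʳ-≤ (remaining (suc r) (2 ^ x) (suc e)) (≤-trans (m≤m+n (reduction x e + x) (reduction x e + x + 0)) (late-reduction x e 8≤e e≤x))) ⟩
    2 * (remaining (suc r) (2 ^ x) (suc e) + 2 ^ x)
      ≤⟨ late-remaining r (2 ^ x) (suc e) (m≤n⇒m≤1+n 8≤e) (≤-trans (s≤s e≤x) (n<2^n x)) ⟩
    tower (suc r) (2 ^ x) ∎
    where
    open ≤-Reasoning
    eq : ∀ k m x → k + m + x ≡ m + (k + x)
    eq = solve-∀

  total-reduction : ℕ → ℕ → ℕ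
  total-reduction zero    e = 0
  total-reduction (suc j) e = reduction e e + total-reduction j (suc e)

  reduction-mono : ∀ {x y} e → x ≤ y → reduction x e ≤ reduction y e
  reduction-mono e x≤y = +-monoˡ-≤ (2 * e) (s≤s (s≤s (/-monoˡ-≤ 8 (2^-mono x≤y))))

  -- The at most j rounds in which x has not reached e are replaced by their values at x = e, a
  -- constant for fixed j and e.
  remaining-bound : ∀ j r x e → 8 ≤ e → Late j x e → 2 * remaining r x e ≤ tower r x + 2 * total-reduction j e
  remaining-bound j zero    x e 8≤e late = z≤n
  remaining-bound j (suc r) x e 8≤e late with e ≤? x
  ... | yes e≤x = ≤-trans (*-monoʳ-≤ 2 (m≤m+n (remaining (suc r) x e) x))
                          (≤-trans (late-remaining r x e 8≤e e≤x) (m≤m+n (tower (suc r) x) _))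
  remaining-bound zero    (suc r) x e 8≤e late | no e≰x = contradiction late e≰x
  remaining-bound (suc j) (suc r) x e 8≤e late | no e≰x = begin
    2 * (reduction x e + remaining r (2 ^ x) (suc e))
      ≡⟨ *-distribˡ-+ 2 (reduction x e) _ ⟩
    2 * reduction x e + 2 * remaining r (2 ^ x) (suc e)
      ≤⟨ +-mono-≤ (*-monoʳ-≤ 2 (reduction-mono e (<⇒≤ (≰⇒> e≰x))))
                  (remaining-bound j r (2 ^ x) (suc e) (m≤n⇒m≤1+n 8≤e) late) ⟩
    2 * reduction e e + (tower r (2 ^ x) + 2 * total-reduction j (suc e))
      ≡⟨ eq (reduction e e) (tower r (2 ^ x)) (total-reduction j (suc e)) ⟩
    tower (suc r) x + 2 * total-reduction (suc j) e ∎
    where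
    open ≤-Reasoning
    eq : ∀ k t c → 2 * k + (t + 2 * c) ≡ t + 2 * (k + c)
    eq = solve-∀

  total-slack : ℕ → ℕ → ℕ
  total-slack zero    e = 0
  total-slack (suc j) e = total-slack j (suc e) + (2 + reduction e e + e)

  late-slack : ∀ r x e → 8 ≤ e → e ≤ x → slack r x e ≡ 0
  late-slack zero    x e 8≤e e≤x = refl
  late-slack (suc r) x e 8≤e e≤x
    rewrite late-slack r (2 ^ x) (suc e) (m≤n⇒m≤1+n 8≤e) (≤-trans (s≤s e≤x) (n<2^n x)) =
    m≤n⇒m∸n≡0 (≤-trans (≤-trans (m≤m+n (2 + reduction x e + x) (2 ^ x / 8 + 2 * e + x)) (≤-reflexive (eq (2 ^ x / 8) e x)))
                       (late-reduction x e 8≤e e≤x))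
    where
    eq : ∀ z e x → 2 + (suc (suc z) + 2 * e) + x + (z + 2 * e + x) ≡ 2 * (suc (suc z) + 2 * e + x)
    eq = solve-∀

  slack-bound : ∀ j r x e → 8 ≤ e → Late j x e → slack r x e ≤ total-slack j e
  slack-bound j zero    x e 8≤e late = z≤n
  slack-bound j (suc r) x e 8≤e late with e ≤? x
  ... | yes e≤x = ≤-trans (≤-reflexive (late-slack (suc r) x e 8≤e e≤x)) z≤n
  slack-bound zero    (suc r) x e 8≤e late | no e≰x = contradiction late e≰x
  slack-bound (suc j) (suc r) x e 8≤e late | no e≰x = ≤-trans (m∸n≤m _ (2 ^ x))
    (+-mono-≤ (slack-bound j r (2 ^ x) (suc e) (m≤n⇒m≤1+n 8≤e) late)
              (+-mono-≤ (+-monoʳ-≤ 2 (reduction-mono e x≤e)) x≤e))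
    where
    x≤e : x ≤ e
    x≤e = <⇒≤ (≰⇒> e≰x)

  -- Gives m · 2^(m/8) ≤ 2^m, the hypothesis of `feasible` for x = m.
  n≤2^[n∸n/8] : ∀ n → n ≤ 2 ^ (n ∸ n / 8)
  n≤2^[n∸n/8] n = cases (n / 8) (m/n*n≤m n 8)
    where
    cases : ∀ z → z * 8 ≤ n → n ≤ 2 ^ (n ∸ z)
    cases zero    _ = <⇒≤ (n<2^n n)
    cases (suc z) h = ≤2^half (suc z) n (≤-trans (≤-trans (m≤m+n (2 * suc z + 2) (6 * z + 4)) (≤-reflexive (eq z))) h)
      where
      eq : ∀ z → 2 * suc z + 2 + (6 * z + 4) ≡ suc z * 8
      eq = solve-∀

  2^-shift : ∀ b i j → b * 2 ^ i * 2 ^ j ≡ b * 2 ^ (i + j)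
  2^-shift b i j = trans (*-assoc b (2 ^ i) (2 ^ j)) (cong (b *_) (sym (^-distribˡ-+-* 2 i j)))

  *2^-mono : ∀ b i j → i ≤ j → b * 2 ^ i ≤ b * 2 ^ j
  *2^-mono b i j i≤j = *-monoʳ-≤ b (^-monoʳ-≤ 2 i≤j)

  -- Abstract, so that 2 ^ (precision + k) is never unfolded.
  abstract
    slackBudget reductionBudget precision : ℕ
    -- 1102 and 1052 are the exact totals for four rounds from e = 9; 6500 is a round number above 2
    -- · (3 · 1052 + 49) + 2 = 6412.
    slackBudget     = 1102
    reductionBudget = 1052
    precision       = 6500

    total-slack≤ : total-slack 4 9 ≤ slackBudget
    total-slack≤ = ≤ᵇ⇒≤ (total-slack 4 9) slackBudget _

    total-reduction≤ : total-reduction 4 9 ≤ reductionBudget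
    total-reduction≤ = ≤ᵇ⇒≤ (total-reduction 4 9) reductionBudget _

    slackBudget≤ : slackBudget + 41 ≤ precision
    slackBudget≤ = ≤ᵇ⇒≤ (slackBudget + 41) precision _

    reductionBudget≤ : 2 * (3 * reductionBudget + 49) + 2 ≤ precision
    reductionBudget≤ = ≤ᵇ⇒≤ (2 * (3 * reductionBudget + 49) + 2) precision _

    21≤precision : 21 ≤ precision
    21≤precision = ≤ᵇ⇒≤ 21 precision _

  -- The first round starts from log^(r) n about m; later rounds from 2^x.
  feasible : ∀ r b m x s → 1 ≤ b → m ≤ suc x → m * 2 ^ (m / 8) ≤ 2 ^ x → tower r x ≤ s →
             b * 2 ^ precision ≤ m * 2 ^ (s + 2) → Feasible (2 + b) (suc r) 8 (2 ^ s)
  feasible r b m x s 1≤b m≤1+x m≤ tower≤s size =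
    feasible-step b 8 w s 1≤b (s≤s (s≤s (s≤s z≤n))) size₀ (≤-trans (m≤m+n k (remaining r x 9)) room) (s≤s z≤n)
      (feasible-rounds r b x 9 (s ∸ k) 1≤b (s≤s (s≤s (s≤s z≤n))) size′ (m+n≤o⇒n≤o∸m k room))
    where
    open ≤-Reasoning
    w = suc (m / 8)
    k = suc w + 2 * 8
    -- From x = 0 four exponentials lead to 16, while e goes from 9 to 13.
    late : Late 4 x 9
    late = Late-mono 4 {0} {x} {9} z≤n (≤ᵇ⇒≤ 13 16 _)
    8≤9 : 8 ≤ 9
    8≤9 = ≤ᵇ⇒≤ 8 9 _
    m≤1+s : m ≤ suc s
    m≤1+s = ≤-trans m≤1+x (s≤s (≤-trans (x≤tower r x) tower≤s))
    -- A nonempty message within the size bound forces n to be so large that `s` exceeds the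
    -- constants of the first rounds.
    precision≤ : precision ≤ s + (s + 2)
    precision≤ = ≮⇒≥ (λ lt → <⇒≱ (^-monoʳ-< 2 (s≤s (s≤s z≤n)) lt) (begin
      2 ^ precision             ≡⟨ *-identityˡ (2 ^ precision) ⟨
      1 * 2 ^ precision         ≤⟨ *-monoˡ-≤ (2 ^ precision) 1≤b ⟩
      b * 2 ^ precision         ≤⟨ size ⟩
      m * 2 ^ (s + 2)           ≤⟨ *-monoˡ-≤ (2 ^ (s + 2)) (≤-trans m≤1+s (n<2^n s)) ⟩
      2 ^ s * 2 ^ (s + 2)       ≡⟨ ^-distribˡ-+-* 2 s (s + 2) ⟨
      2 ^ (s + (s + 2))         ∎))
    budget≤s : 3 * reductionBudget + 49 ≤ s
    budget≤s = *-cancelˡ-≤ 2 (+-cancelʳ-≤ 2 (2 * (3 * reductionBudget + 49)) (2 * s)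
                 (≤-trans reductionBudget≤ (≤-trans precision≤ (≤-reflexive (eq s)))))
      where
      eq : ∀ s → s + (s + 2) ≡ 2 * s + 2
      eq = solve-∀
    -- Eight times the left side is at most 5s plus constants, and `budget≤s` bounds the constants
    -- by 3s.
    room : k + remaining r x 9 ≤ s
    room = *-cancelˡ-≤ 8 (begin
      8 * (suc w + 2 * 8 + remaining r x 9)
        ≡⟨ eq (m / 8) (remaining r x 9) ⟩
      m / 8 * 8 + 4 * (2 * remaining r x 9) + 144
        ≤⟨ +-monoˡ-≤ 144 (+-mono-≤ (≤-trans (m/n*n≤m m 8) m≤1+s) (*-monoʳ-≤ 4
             (≤-trans (remaining-bound 4 r x 9 8≤9 late) (+-mono-≤ tower≤s (*-monoʳ-≤ 2 total-reduction≤))))) ⟩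
      suc s + 4 * (s + 2 * reductionBudget) + 144
        ≤⟨ m≤m+n _ (reductionBudget + 2) ⟩
      suc s + 4 * (s + 2 * reductionBudget) + 144 + (reductionBudget + 2)
        ≡⟨ eq₂ s reductionBudget ⟩
      5 * s + 3 * (3 * reductionBudget + 49)
        ≤⟨ +-monoʳ-≤ (5 * s) (*-monoʳ-≤ 3 budget≤s) ⟩
      5 * s + 3 * s
        ≡⟨ *-distribʳ-+ s 5 3 ⟨
      8 * s ∎)
      where
      eq : ∀ z q → 8 * (suc (suc z) + 2 * 8 + q) ≡ z * 8 + 4 * (2 * q) + 144
      eq = solve-∀
      eq₂ : ∀ s c → suc s + 4 * (s + 2 * c) + 144 + (c + 2) ≡ 5 * s + 3 * (3 * c + 49)
      eq₂ = solve-∀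
    size₀ : b * 2 ^ (2 * 8) ≤ 2 ^ s * w
    size₀ = *-cancelʳ-≤ (b * 2 ^ 16) (2 ^ s * w) (2 ^ 5) (begin
      b * 2 ^ 16 * 2 ^ 5          ≡⟨ *-assoc b (2 ^ 16) (2 ^ 5) ⟩
      b * 2 ^ 21                  ≤⟨ *2^-mono b 21 precision 21≤precision ⟩
      b * 2 ^ precision           ≤⟨ size ⟩
      m * 2 ^ (s + 2)             ≤⟨ *-monoˡ-≤ (2 ^ (s + 2)) (m≤8*[1+m/8] m) ⟩
      8 * w * 2 ^ (s + 2)         ≡⟨ cong (8 * w *_) (^-distribˡ-+-* 2 s 2) ⟩
      8 * w * (2 ^ s * 4)         ≡⟨ eq w (2 ^ s) ⟩
      2 ^ s * w * 2 ^ 5           ∎)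
      where
      eq : ∀ w p → 8 * w * (p * 4) ≡ p * w * 32
      eq = solve-∀
    -- 39 is 2 · 9 + 3 from the invariant of the later rounds plus 18 from k = m/8 + 18.
    b≤ : b * 2 ^ (slackBudget + 39) ≤ m * 2 ^ s
    b≤ = *-cancelʳ-≤ (b * 2 ^ (slackBudget + 39)) (m * 2 ^ s) (2 ^ 2) (begin
      b * 2 ^ (slackBudget + 39) * 2 ^ 2    ≡⟨ 2^-shift b (slackBudget + 39) 2 ⟩
      b * 2 ^ (slackBudget + 39 + 2)        ≤⟨ *2^-mono b (slackBudget + 39 + 2) precision (≤-trans (≤-reflexive (+-assoc slackBudget 39 2)) slackBudget≤) ⟩
      b * 2 ^ precision                     ≤⟨ size ⟩
      m * 2 ^ (s + 2)                       ≡⟨ 2^-shift m s 2 ⟨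
      m * 2 ^ s * 2 ^ 2                     ∎)
    size′ : b * 2 ^ (2 * 9 + 3 + slack r x 9) ≤ 2 ^ (s ∸ k + x)
    size′ = *-cancelʳ-≤ (b * 2 ^ (2 * 9 + 3 + slack r x 9)) (2 ^ (s ∸ k + x)) (2 ^ k) {{>-nonZero (m^n>0 2 k)}} (begin
      b * 2 ^ (2 * 9 + 3 + slack r x 9) * 2 ^ k
        ≡⟨ 2^-shift b (2 * 9 + 3 + slack r x 9) k ⟩
      b * 2 ^ (2 * 9 + 3 + slack r x 9 + k)
        ≤⟨ *2^-mono b (2 * 9 + 3 + slack r x 9 + k) (slackBudget + 39 + m / 8) (≤-trans (≤-reflexive (eq (slack r x 9) (m / 8)))
             (+-monoˡ-≤ (m / 8) (+-monoˡ-≤ 39 (≤-trans (slack-bound 4 r x 9 8≤9 late) total-slack≤)))) ⟩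
      b * 2 ^ (slackBudget + 39 + m / 8)
        ≡⟨ 2^-shift b (slackBudget + 39) (m / 8) ⟨
      b * 2 ^ (slackBudget + 39) * 2 ^ (m / 8)
        ≤⟨ *-monoˡ-≤ (2 ^ (m / 8)) b≤ ⟩
      m * 2 ^ s * 2 ^ (m / 8)
        ≡⟨ eq₁ m (2 ^ s) (2 ^ (m / 8)) ⟩
      m * 2 ^ (m / 8) * 2 ^ s
        ≤⟨ *-monoˡ-≤ (2 ^ s) m≤ ⟩
      2 ^ x * 2 ^ s
        ≡⟨ ^-distribˡ-+-* 2 x s ⟨
      2 ^ (x + s)
        ≡⟨ cong (λ i → 2 ^ (x + i)) (m∸n+n≡m (≤-trans (m≤m+n k (remaining r x 9)) room)) ⟨
      2 ^ (x + (s ∸ k + k))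
        ≡⟨ trans (cong (2 ^_) (eq₂ x (s ∸ k) k)) (^-distribˡ-+-* 2 (s ∸ k + x) k) ⟩
      2 ^ (s ∸ k + x) * 2 ^ k ∎)
      where
      eq : ∀ a z → 2 * 9 + 3 + a + (suc (suc z) + 2 * 8) ≡ a + 39 + z
      eq = solve-∀
      eq₁ : ∀ m p q → m * p * q ≡ m * q * p
      eq₁ = solve-∀
      eq₂ : ∀ x t k → x + (t + k) ≡ t + x + k
      eq₂ = solve-∀

-- Logarithms of cuts and integer towers

module Logs where
  open import Data.Integer.Base as ℤ using (+_; -[1+_])
  import Data.Integer.Properties as ℤ
  open import Data.Rational.Base
  open import Data.Rational.Properties
  open import Algebra.Definitions.RawSemiring +-*-rawSemiring using () renaming (_^_ to _^ℚ_)
  open import Relation.Unary using (_∈_)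
  open RationalOrder
  open Numerics using (tower)

  ^-nonneg : ∀ {x} k → 0ℚ ≤ x → 0ℚ ≤ x ^ℚ k
  ^-nonneg zero    0≤x = 0≤1
  ^-nonneg (suc k) 0≤x = 0≤* 0≤x (^-nonneg k 0≤x)

  ^-mono-≤ : ∀ {x y} k → 0ℚ ≤ x → x ≤ y → x ^ℚ k ≤ y ^ℚ k
  ^-mono-≤ zero    0≤x x≤y = ≤-refl
  ^-mono-≤ (suc k) 0≤x x≤y = *-mono-≤ 0≤x (^-nonneg k (≤-trans 0≤x x≤y)) x≤y (^-mono-≤ k 0≤x x≤y)

  ^-mono-< : ∀ {x y} k → 0ℚ ≤ x → x < y → x ^ℚ suc k < y ^ℚ suc k
  ^-mono-< {x} {y} zero    0≤x x<y = subst₂ _<_ (sym (*-identityʳ x)) (sym (*-identityʳ y)) x<y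
  ^-mono-< {x} {y} (suc k) 0≤x x<y = ≤-<-trans
    (*-monoʳ-≤ (x ^ℚ suc k) (^-nonneg (suc k) 0≤x) (<⇒≤ x<y))
    (*-monoʳ-<-pos y {{positive (≤-<-trans 0≤x x<y)}} (^-mono-< k 0≤x x<y))

  ^-cancel-≤ : ∀ {x y} k → 0ℚ ≤ y → x ^ℚ suc k ≤ y ^ℚ suc k → x ≤ y
  ^-cancel-≤ {x} {y} k 0≤y h with x ≤? y
  ... | yes x≤y = x≤y
  ... | no  x≰y = contradiction (<-≤-trans (^-mono-< k 0≤y (≰⇒> x≰y)) h) (<-irrefl refl)

  ^-+ : ∀ x j k → x ^ℚ (j ℕ.+ k) ≡ x ^ℚ j * x ^ℚ k
  ^-+ x zero    k = sym (*-identityˡ (x ^ℚ k))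
  ^-+ x (suc j) k = trans (cong (x *_) (^-+ x j k)) (sym (*-assoc x (x ^ℚ j) (x ^ℚ k)))

  ^-* : ∀ x j k → x ^ℚ (k ℕ.* j) ≡ (x ^ℚ j) ^ℚ k
  ^-* x j zero    = refl
  ^-* x j (suc k) = trans (^-+ x j (k ℕ.* j)) (cong (x ^ℚ j *_) (^-* x j k))

  ℕ→ℚ-^ : ∀ m k → ℕ→ℚ (m ℕ.^ k) ≡ ℕ→ℚ m ^ℚ k
  ℕ→ℚ-^ m zero    = refl
  ℕ→ℚ-^ m (suc k) = trans (ℕ→ℚ-* m (m ℕ.^ k)) (cong (ℕ→ℚ m *_) (ℕ→ℚ-^ m k))

  -- Raising both sides to the denominator of q leaves natural exponents only, and monotonicity of
  -- powers removes it again. A negative q contradicts 0 ≤ a ≤ d q.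
  pow-lower : ∀ a d q s → 1 ℕ.≤ d → 0ℚ < s → ℕ→ℚ a ≤ ℕ→ℚ d * q → 2^ q ≤ s → ℕ→ℚ (2 ℕ.^ a) ≤ s ^ℚ d
  pow-lower a d q s 1≤d 0<s a≤dq 2^q≤s = numerator q refl
    where
    D = ↧ₙ q
    0≤s : 0ℚ ≤ s
    0≤s = <⇒≤ 0<s
    q*D : q * ℕ→ℚ D ≡ ↥ q / 1
    q*D = toℚᵘ-injective (ℚᵘ.≃-trans (toℚᵘ-homo-* q (ℕ→ℚ D)) (ℚᵘ.≃-trans
      (ℚᵘ.*-congˡ {toℚᵘ q} (toℚᵘ-fromℚᵘ (mkℚᵘ (+ D) 0)))
      (ℚᵘ.≃-trans (denominator q) (ℚᵘ.≃-sym (toℚᵘ-fromℚᵘ (mkℚᵘ (↥ q) 0))))))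
      where
      open import Data.Rational.Unnormalised.Base using (mkℚᵘ; *≡*) renaming (_*_ to _*ᵘ_; _≃_ to _≃ᵘ_)
      import Data.Rational.Unnormalised.Properties as ℚᵘ
      denominator : ∀ q → toℚᵘ q *ᵘ mkℚᵘ (+ ↧ₙ q) 0 ≃ᵘ mkℚᵘ (↥ q) 0
      denominator (mkℚ n d-1 _) = *≡* (trans (ℤ.*-identityʳ (n ℤ.* + suc d-1))
        (cong (λ k → n ℤ.* + k) (sym (ℕ.*-identityʳ (suc d-1)))))
    aD≤ : ℕ→ℚ (a ℕ.* D) ≤ ℕ→ℚ d * (↥ q / 1)
    aD≤ = begin
      ℕ→ℚ (a ℕ.* D)            ≡⟨ ℕ→ℚ-* a D ⟩
      ℕ→ℚ a * ℕ→ℚ D            ≤⟨ *-monoʳ-≤ (ℕ→ℚ D) (0≤ℕ→ℚ D) a≤dq ⟩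
      ℕ→ℚ d * q * ℕ→ℚ D        ≡⟨ *-assoc (ℕ→ℚ d) q (ℕ→ℚ D) ⟩
      ℕ→ℚ d * (q * ℕ→ℚ D)      ≡⟨ cong (ℕ→ℚ d *_) q*D ⟩
      ℕ→ℚ d * (↥ q / 1)        ∎
      where open ≤-Reasoning
    numerator : ∀ p → p ≡ q → ℕ→ℚ (2 ℕ.^ a) ≤ s ^ℚ d
    numerator (mkℚ (+ u) d-1 _) refl = ^-cancel-≤ d-1 (^-nonneg d 0≤s) (begin
      ℕ→ℚ (2 ℕ.^ a) ^ℚ D          ≡⟨ cong (_^ℚ D) (ℕ→ℚ-^ 2 a) ⟩
      (ℕ→ℚ 2 ^ℚ a) ^ℚ D           ≡⟨ ^-* (ℕ→ℚ 2) a D ⟨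
      ℕ→ℚ 2 ^ℚ (D ℕ.* a)          ≡⟨ ℕ→ℚ-^ 2 (D ℕ.* a) ⟨
      ℕ→ℚ (2 ℕ.^ (D ℕ.* a))       ≤⟨ ℕ→ℚ-mono (ℕ.^-monoʳ-≤ 2 Da≤du) ⟩
      ℕ→ℚ (2 ℕ.^ (d ℕ.* u))       ≡⟨ trans (ℕ→ℚ-^ 2 (d ℕ.* u)) (^-* (ℕ→ℚ 2) u d) ⟩
      (ℕ→ℚ 2 ^ℚ u) ^ℚ d           ≤⟨ ^-mono-≤ d (^-nonneg u (0≤ℕ→ℚ 2)) 2^q≤s ⟩
      (s ^ℚ D) ^ℚ d               ≡⟨ ^-* s D d ⟨
      s ^ℚ (d ℕ.* D)              ≡⟨ cong (s ^ℚ_) (ℕ.*-comm d D) ⟩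
      s ^ℚ (D ℕ.* d)              ≡⟨ ^-* s d D ⟩
      (s ^ℚ d) ^ℚ D               ∎)
      where
      open ≤-Reasoning
      Da≤du : D ℕ.* a ℕ.≤ d ℕ.* u
      Da≤du = ℕ.≤-trans (ℕ.≤-reflexive (ℕ.*-comm D a))
        (ℕ→ℚ-cancel-≤ (≤-trans aD≤ (≤-reflexive (sym (ℕ→ℚ-* d u)))))
    numerator (mkℚ -[1+ u ] d-1 _) refl =
      contradiction (≤-<-trans (≤-trans (0≤ℕ→ℚ (a ℕ.* D)) aD≤) negative-product) (<-irrefl refl)
      where
      negative-product : ℕ→ℚ d * (-[1+ u ] / 1) < 0ℚ
      negative-product = subst (ℕ→ℚ d * (-[1+ u ] / 1) <_) (*-zeroʳ (ℕ→ℚ d))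
        (*-monoʳ-<-pos (ℕ→ℚ d) {{positive (<-≤-trans (positive⁻¹ 1ℚ) (ℕ→ℚ-mono {1} {d} 1≤d))}}
          (negative⁻¹ (-[1+ u ] / 1) {{neg-pos {normalize (suc u) 1} (normalize-pos (suc u) 1)}}))

  -- Each logarithm in the cut turns into one exponential of the tower, so membership of a rational
  -- yields an inequality of naturals.
  log-tower : ∀ i {q} k n → q ∈ log^ i (fromℕ n) → ℕ→ℚ k ≤ q → tower i k ℕ.≤ n
  log-tower zero    k n q<n k≤q = ℕ.<⇒≤ (ℕ→ℚ-cancel-< (≤-<-trans k≤q q<n))
  log-tower (suc i) {q} k n (s , s∈ , 0<s , 2^q≤s) k≤q = log-tower i (2 ℕ.^ k) n s∈
    (subst (ℕ→ℚ (2 ℕ.^ k) ≤_) (*-identityʳ s)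
      (pow-lower k 1 q s ℕ.≤-refl 0<s (subst (ℕ→ℚ k ≤_) (sym (*-identityˡ q)) k≤q) 2^q≤s))

  8/5 : ℚ
  8/5 = + 8 / 5

  -- 3 ^ 5 < 2 ^ 8, that is, log 3 < 8/5.
  log-8/5 : ∀ {x : Cut} → 8/5 ∈ log x → ∃ λ s → s ∈ x × ℕ→ℚ 3 ≤ s
  log-8/5 (s , s∈ , 0<s , 2^q≤s) = s , s∈ , ≮⇒≥ (λ s<3 → contradiction
    (≤-<-trans (pow-lower 8 5 8/5 s (ℕ.s≤s ℕ.z≤n) 0<s ≤-refl 2^q≤s)
               (<-trans (^-mono-< 4 (<⇒≤ 0<s) s<3) 243<256))
    (<-irrefl refl))
    where
    243<256 : ℕ→ℚ 3 ^ℚ 5 < ℕ→ℚ (2 ℕ.^ 8)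
    243<256 = *<* (ℤ.+<+ (ℕ.≤ᵇ⇒≤ 244 256 _))

  integer-part : ∀ p → 0ℚ ≤ p → ∃ λ m → ℕ→ℚ m ≤ p × p < ℕ→ℚ (suc m)
  integer-part (mkℚ -[1+ u ] d c) (*≤* ())
  integer-part (mkℚ (+ u) d c) 0≤p = m ,
    subst (_≤ mkℚ (+ u) d c) (sym (ℕ→ℚ-mkℚ m)) (*≤* (subst₂ ℤ._≤_ (ℤ.pos-* m (suc d)) (ℤ.pos-* u 1)
      (ℤ.+≤+ (ℕ.≤-trans (ℕ.m/n*n≤m u (suc d)) (ℕ.≤-reflexive (sym (ℕ.*-identityʳ u))))))) ,
    subst (mkℚ (+ u) d c <_) (sym (ℕ→ℚ-mkℚ (suc m))) (*<* (subst₂ ℤ._<_ (ℤ.pos-* u 1) (ℤ.pos-* (suc m) (suc d))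
      (ℤ.+<+ (ℕ.≤-<-trans (ℕ.≤-reflexive (ℕ.*-identityʳ u)) u<))))
    where
    m = u ℕ./ suc d
    u< : u ℕ.< suc m ℕ.* suc d
    u< = begin-strict
      u                                  ≡⟨ ℕ.m≡m%n+[m/n]*n u (suc d) ⟩
      u ℕ.% suc d ℕ.+ m ℕ.* suc d        <⟨ ℕ.+-monoˡ-< (m ℕ.* suc d) (ℕ.m%n<n u (suc d)) ⟩
      suc d ℕ.+ m ℕ.* suc d              ∎
      where open ℕ.≤-Reasoning

-- Assembling the lower bound

module LowerBound where
  open import Data.Empty using (⊥)
  open import Data.Integer.Base as ℤ using (+_)
  open import Data.Rational.Base
  open import Data.Rational.Properties
  open import Data.Nat.Tactic.RingSolver using () renaming (solve-∀ to ℕ-solve-∀)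
  open import Relation.Nullary.Decidable using (¬?; decidable-stable)
  open import Relation.Unary using (_∈_)
  open import Tactic.RingSolver using (solve-∀)
  open RationalOrder
  open Integral
  open Alphabets
  open RoundElimination hiding (declare)
  open Elimination
  open Encoding
  open Gap
  open Silent
  open Averaging
  open Numerics
  open Logs

  1/16 : ℚ
  1/16 = + 1 / 16

  quarter : ∀ {k} r → 4 ℕ.* r ℕ.≤ k → ℕ→ℚ r * (½ * ½) ≤ ℕ→ℚ k * 1/16
  quarter {k} r 4r≤k = begin
    ℕ→ℚ r * (½ * ½)            ≡⟨ eq (ℕ→ℚ r) ⟩
    ℕ→ℚ 4 * ℕ→ℚ r * 1/16       ≡⟨ cong (_* 1/16) (ℕ→ℚ-* 4 r) ⟨
    ℕ→ℚ (4 ℕ.* r) * 1/16       ≤⟨ *-monoʳ-≤ 1/16 (nonNegative⁻¹ 1/16) (ℕ→ℚ-mono 4r≤k) ⟩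
    ℕ→ℚ k * 1/16               ∎
    where
    open ≤-Reasoning
    eq : ∀ r → r * (½ * ½) ≡ ℕ→ℚ 4 * r * 1/16
    eq r = trans (cong (r *_) {½ * ½} {ℕ→ℚ 4 * 1/16} refl) (eq′ r (ℕ→ℚ 4) 1/16)
      where
      eq′ : ∀ r f s → r * (f * s) ≡ f * r * s
      eq′ = solve-∀ ring

  module Refute (k l : ℕ) (1≤k : 1 ℕ.≤ k) where
    open Hard k l 1≤k

    -- Divided by k: acceptance under planting exceeds acceptance under the uniform law by at most
    -- κ.
    Uncorrelated : ℚ → (Input n → Input n → Bool) → Set
    Uncorrelated κ out = average₂ (λ x y → agree₀ x y * indicator (out x y)) ≤
                         ℕ→ℚ k * average₂ (λ x y → indicator (out x y)) + ℕ→ℚ k * κ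

    average₂-cong : ∀ {f g} → (∀ x y → f x y ≡ g x y) → average₂ f ≡ average₂ g
    average₂-cong h = ∫-cong inputs (λ x → ∫-cong inputs (h x))

    uncorrelated-cong : ∀ {κ out out′} → (∀ x y → out x y ≡ out′ x y) → Uncorrelated κ out → Uncorrelated κ out′
    uncorrelated-cong {κ} eq = subst₂ (λ a o → a ≤ ℕ→ℚ k * o + ℕ→ℚ k * κ)
      (average₂-cong (λ x y → cong (λ z → agree₀ x y * indicator z) (eq x y)))
      (average₂-cong (λ x y → cong indicator (eq x y)))

    uncorrelated-flip : ∀ {κ out} → Uncorrelated κ out → Uncorrelated κ (λ y x → out x y)
    uncorrelated-flip {κ} {out} = subst₂ (λ a o → a ≤ ℕ→ℚ k * o + ℕ→ℚ k * κ)
      (trans (∫-swap inputs inputs (λ x y → agree₀ x y * indicator (out x y)))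
             (average₂-cong (λ y x → cong (_* indicator (out x y)) (agree-sym 𝓕 (take k x) (take k y)))))
      (∫-swap inputs inputs (λ x y → indicator (out x y)))

    module _ {r : ℕ} (π : ProbProtocol n r) (error≤ : ErrorAtMost π (+ 1 / 3)) where
      open ProbProtocol π

      ¬-uncorrelated : ¬ (∀ ω → Uncorrelated 1/16 (output (protocol ω)))
      ¬-uncorrelated uncorrelated = <⇒≱ two-thirds<q (*-cancelˡ-≤-pos (ℕ→ℚ k) {{k>0}} (begin
        ℕ→ℚ k * (¾-1/16 * q)
          ≡⟨ *-assoc (ℕ→ℚ k) ¾-1/16 q ⟨
        ℕ→ℚ k * ¾-1/16 * q
          ≤⟨ averaging source occurrence occurs? measurable (▹-nonneg (λ (x , y) → 0≤weight x y)
               (⊗-nonneg (weights≥0 inputs-prob) (weights≥0 inputs-prob))) (+ 1 / 3) (λ (x , y) → error≤ x y)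
               (0≤* (0≤ℕ→ℚ k) (nonNegative⁻¹ ¾-1/16)) pointwise q<1 ⟩
        ∫ hard (λ _ → 1ℚ) * (+ 1 / 3)
          ≤⟨ *-monoʳ-≤ (+ 1 / 3) (nonNegative⁻¹ (+ 1 / 3)) hard-total ⟩
        2ℚ * ℕ→ℚ k * (+ 1 / 3)
          ≡⟨ eq (ℕ→ℚ k) 2ℚ (+ 1 / 3) ⟩
        ℕ→ℚ k * (2ℚ * (+ 1 / 3)) ∎))
        where
        open ≤-Reasoning
        -- Any q < 1 with 11/16 · q > 2/3 serves here.
        q = + 63 / 64
        q<1 : q < 1ℚ
        q<1 = *<* (ℤ.+<+ (ℕ.≤ᵇ⇒≤ 64 64 _))
        ¾-1/16 = 1ℚ - ½ * ½ - 1/16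
        two-thirds<q : 2ℚ * (+ 1 / 3) < ¾-1/16 * q
        two-thirds<q = *<* (ℤ.+<+ (ℕ.≤ᵇ⇒≤ 2049 2079 _))
        k>0 : Positive (ℕ→ℚ k)
        k>0 = positive (<-≤-trans (positive⁻¹ 1ℚ) (ℕ→ℚ-mono {1} 1≤k))
        <⇒≱ : ∀ {x y} → x < y → ¬ y ≤ x
        <⇒≱ x<y y≤x = <-irrefl refl (<-≤-trans x<y y≤x)
        eq : ∀ k t u → t * k * u ≡ k * (t * u)
        eq = solve-∀ ring
        hard : Measure (Input n × Input n)
        hard = (λ (x , y) → weight x y) ▹ (inputs ⊗ inputs)
        ∫hard : ∀ (f : Input n → Input n → ℚ) → ∫ hard (λ (x , y) → f x y) ≡ average₂ (λ x y → weight x y * f x y)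
        ∫hard f = trans (∫-▹ _ (inputs ⊗ inputs) _) (∫-⊗ inputs inputs _)
        hard-total : ∫ hard (λ _ → 1ℚ) ≤ 2ℚ * ℕ→ℚ k
        hard-total = ≤-trans (≤-reflexive (trans (∫hard (λ _ _ → 1ℚ))
          (average₂-cong (λ x y → *-identityʳ (weight x y))))) weight-total
        occurrence : Input n × Input n → Event source
        occurrence (x , y) = Error x y
        occurs? : ∀ j ω → Dec (occurrence j ω)
        occurs? (x , y) ω = ¬? (output (protocol ω) x y Bool.≟ EE x y)
        measurable : ∀ j → Measurable (occurrence j)
        measurable (x , y) = measurable-∁ (output-measurable x y (EE x y))
        does-≢ : ∀ a b → does (¬? (a Bool.≟ b)) ≡ a xor b
        does-≢ false false = refl
        does-≢ false true  = refl
        does-≢ true  false = refl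
        does-≢ true  true  = refl
        pointwise : ∀ ω → ℕ→ℚ k * ¾-1/16 ≤ ∫ hard (λ j → occurs source occurrence occurs? measurable j ω)
        pointwise ω = ≤-trans (weighted-error (output (protocol ω)) 1/16 (uncorrelated ω))
          (≤-reflexive (sym (trans (∫hard (λ x y → indicator (does (occurs? (x , y) ω))))
            (average₂-cong (λ x y → cong (λ z → weight x y * indicator z)
              (does-≢ (output (protocol ω) x y) (EE x y)))))))

    weaken : ∀ {κ κ′ out} → κ ≤ κ′ → Uncorrelated κ out → Uncorrelated κ′ out
    weaken {out = out} κ≤κ′ h = ≤-trans h (+-monoʳ-≤ (ℕ→ℚ k * average₂ (λ x y → indicator (out x y)))
      (*-monoˡ-≤ (ℕ→ℚ k) (0≤ℕ→ℚ k) κ≤κ′))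

    coded-uncorrelated : ∀ b {r} → Feasible (2 ℕ.+ b) r 8 k → (π : DetProtocol (Input n) (Input n) r) →
      (∀ x y → All (Short b) (messages π x y)) → Uncorrelated 1/16 (output π)
    -- The initial precision is e = 8 because 10/256 ≤ 1/16 < 10/128.
    coded-uncorrelated b feasible π short = weaken (≤ᵇ⇒≤ {10ℚ * half^ 8} {1/16} _) (eliminated π short)
      where
      eliminated : ∀ π → (∀ x y → All (Short b) (messages π x y)) → Uncorrelated (10ℚ * half^ 8) (output π)
      eliminated (aliceStarts f g) short = uncorrelated-cong (λ x y → eval-coded-start b f g x y (short x y))
        (decorrelation feasible 𝓕 prefix-player prefix-player (coded-start b f g))
      eliminated (bobStarts f g) short = uncorrelated-cong (λ x y → eval-coded-start b f g y x (short x y))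
        (uncorrelated-flip (decorrelation feasible 𝓕 prefix-player prefix-player (coded-start b f g)))

    correlation⇒uncorrelated : ∀ {κ} out →
      correlation 𝓕 prefix-player prefix-player (λ x y → indicator (out x y)) ≤ ℕ→ℚ k * κ → Uncorrelated κ out
    correlation⇒uncorrelated {κ} out h = begin
      average₂ (λ x y → agree₀ x y * indicator (out x y))
        ≡⟨ average₂-cong (λ x y → eq (agree₀ x y) (ℕ→ℚ k) (indicator (out x y))) ⟩
      average₂ (λ x y → ℕ→ℚ k * indicator (out x y) + (agree₀ x y - ℕ→ℚ k) * indicator (out x y))
        ≡⟨ trans (average₂-+ _ _) (cong (_+ average₂ (λ x y → (agree₀ x y - ℕ→ℚ k) * indicator (out x y)))
             (average₂-*ˡ (ℕ→ℚ k) _)) ⟩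
      ℕ→ℚ k * average₂ (λ x y → indicator (out x y)) + average₂ (λ x y → (agree₀ x y - ℕ→ℚ k) * indicator (out x y))
        ≤⟨ +-monoʳ-≤ (ℕ→ℚ k * average₂ (λ x y → indicator (out x y))) h ⟩
      ℕ→ℚ k * average₂ (λ x y → indicator (out x y)) + ℕ→ℚ k * κ ∎
      where
      open ≤-Reasoning
      eq : ∀ a k i → a * i ≡ k * i + (a - k) * i
      eq = solve-∀ ring

    silent-uncorrelated : ∀ {r} → 4 ℕ.* r ℕ.≤ k → (π : DetProtocol (Input n) (Input n) (suc r)) →
      (∀ x y → All (Short 0) (messages π x y)) → Uncorrelated 1/16 (output π)
    silent-uncorrelated {r} 4r≤k (aliceStarts f g) short = uncorrelated-cong correct
      (uncorrelated-flip (correlation⇒uncorrelated (silent (g []))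
        (≤-trans (silent-start-correlation 𝓕 prefix-player prefix-player (g [])) (quarter r 4r≤k))))
      where
      correct : ∀ x y → silent (g []) y x ≡ output (aliceStarts f g) x y
      correct x y with f x | short x y
      ... | [] | _ ∷ short′ = silent-correct (g []) y x short′
    silent-uncorrelated {r} 4r≤k (bobStarts f g) short = uncorrelated-cong correct
      (correlation⇒uncorrelated (silent (g []))
        (≤-trans (silent-start-correlation 𝓕 prefix-player prefix-player (g [])) (quarter r 4r≤k)))
      where
      correct : ∀ x y → silent (g []) x y ≡ output (bobStarts f g) x y
      correct x y with f y | short x y
      ... | [] | _ ∷ short′ = silent-correct (g []) x y short′

  refute-coded : ∀ k l {n r b} → n ≡ k ℕ.+ l → 1 ℕ.≤ k → Feasible (2 ℕ.+ b) r 8 k →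
    (π : ProbProtocol n r) → ErrorAtMost π (+ 1 / 3) → ¬ MessageSizeAtMost π b
  refute-coded k l {b = b} refl 1≤k feasible π error≤ short =
    ¬-uncorrelated π error≤ (λ ω → coded-uncorrelated b feasible (ProbProtocol.protocol π ω) (short ω))
    where open Refute k l 1≤k

  refute-silent : ∀ k l {n r} → n ≡ k ℕ.+ l → 1 ℕ.≤ k → 4 ℕ.* r ℕ.≤ k →
    (π : ProbProtocol n (suc r)) → ErrorAtMost π (+ 1 / 3) → ¬ MessageSizeAtMost π 0
  refute-silent k l refl 1≤k 4r≤k π error≤ short =
    ¬-uncorrelated π error≤ (λ ω → silent-uncorrelated 4r≤k (ProbProtocol.protocol π ω) (short ω))
    where open Refute k l 1≤k

  x+4r≤tower : ∀ r x → 8 ℕ.≤ x → x ℕ.+ 4 ℕ.* r ℕ.≤ tower r x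
  x+4r≤tower zero    x 8≤x = ℕ.≤-reflexive (ℕ.+-identityʳ x)
  x+4r≤tower (suc r) x 8≤x = begin
    x ℕ.+ 4 ℕ.* suc r                                ≤⟨ ℕ.m≤m+n _ (11 ℕ.* x ℕ.+ 12) ⟩
    x ℕ.+ 4 ℕ.* suc r ℕ.+ (11 ℕ.* x ℕ.+ 12)          ≡⟨ eq x r ⟩
    2 ℕ.* (8 ℕ.+ 6 ℕ.* x) ℕ.+ 4 ℕ.* r                ≤⟨ ℕ.+-monoˡ-≤ (4 ℕ.* r) (8+6x≤2^x x 8≤x) ⟩
    2 ℕ.^ x ℕ.+ 4 ℕ.* r                              ≤⟨ x+4r≤tower r (2 ℕ.^ x) (ℕ.≤-trans 8≤x (ℕ.<⇒≤ (n<2^n x))) ⟩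
    tower r (2 ℕ.^ x)                                ∎
    where
    open ℕ.≤-Reasoning
    eq : ∀ x r → x ℕ.+ 4 ℕ.* suc r ℕ.+ (11 ℕ.* x ℕ.+ 12) ≡ 2 ℕ.* (8 ℕ.+ 6 ℕ.* x) ℕ.+ 4 ℕ.* r
    eq = ℕ-solve-∀

  module _ {n r ℓ b : ℕ} (2≤n : 2 ℕ.≤ n) (log* : IsLog* (fromℕ n) ℓ) (r<ℓ : suc r ℕ.≤ ℓ)
           (π : ProbProtocol n (suc r)) (error≤ : ErrorAtMost π (+ 1 / 3)) (short : MessageSizeAtMost π b) where

    1≤n : 1 ℕ.≤ n
    1≤n = ℕ.≤-trans (ℕ.s≤s ℕ.z≤n) 2≤n

    -- Minimality of ℓ only refutes non-membership in the cut. The double negation disappears later,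
    -- where the conclusions are decidable inequalities of naturals.
    8/5∈log : ¬ ¬ (8/5 ∈ log^ r (fromℕ n))
    8/5∈log 8/5∉ = ℕ.<⇒≱ r<ℓ (IsLog*.smallest log* r (8/5 , *<* (ℤ.+<+ (ℕ.≤ᵇ⇒≤ 9 10 _)) , 8/5∉))

    -- Minimality of ℓ puts 8/5 into log^ r n.  As 8/5 > log 3, this gives
    -- 3 one level down, enough for 4 r ≤ n even if r is 1 or 2.
    tower-3 : ∀ r′ → r ≡ suc r′ → tower r′ 3 ℕ.≤ n
    tower-3 r′ refl = decidable-stable (_ ℕ.≤? n) (λ ≰n → 8/5∈log (λ 8/5∈ →
      let (s , s∈ , 3≤s) = log-8/5 8/5∈ in ≰n (log-tower r′ 3 n s∈ 3≤s)))

    4*rounds≤n : 4 ℕ.* r ℕ.≤ n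
    4*rounds≤n = cases r refl
      where
      open ℕ.≤-Reasoning
      cases : ∀ r′ → r ≡ r′ → 4 ℕ.* r′ ℕ.≤ n
      cases zero          _    = ℕ.z≤n
      cases (suc zero)    refl = decidable-stable (4 ℕ.≤? n) (λ ≰n → 8/5∈log (λ 8/5∈ →
        let (s , s<n , 3≤s) = log-8/5 8/5∈ in ≰n (ℕ→ℚ-cancel-< (≤-<-trans 3≤s s<n))))
      cases (suc (suc j)) eq   = begin
        4 ℕ.* suc (suc j)     ≡⟨ ℕ.*-distribˡ-+ 4 2 j ⟩
        8 ℕ.+ 4 ℕ.* j         ≤⟨ x+4r≤tower j 8 ℕ.≤-refl ⟩
        -- `tower (suc j) 3` unfolds to `tower j 8`, as 2^3 = 8.
        tower j 8             ≤⟨ tower-3 (suc j) eq ⟩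
        n                     ∎

    -- For b ≥ 1 the hypothesis makes n large, and elimination applies to the first 2^s coordinates,
    -- where 2^s ≤ n < 2^(s+1). For b = 0 it says nothing about n, and the bound for empty messages
    -- covers every n.
    impossible : ∀ {p} → p ∈ log^ (suc r) (fromℕ n) → ¬ ℕ→ℚ b ≤ half^ precision * ℕ→ℚ n * p
    impossible {p} p∈ b≤ = by-size b refl
      where
      s = proj₁ (log₂ n 1≤n)
      2^s≤n = proj₁ (proj₂ (log₂ n 1≤n))
      n<2^1+s = proj₂ (proj₂ (log₂ n 1≤n))
      size : ∀ c → p ≤ ℕ→ℚ c → b ℕ.* 2 ℕ.^ precision ℕ.≤ n ℕ.* c
      size c p≤c = ℕ→ℚ-cancel-≤ (begin
        ℕ→ℚ (b ℕ.* 2 ℕ.^ precision)                               ≡⟨ ℕ→ℚ-* b (2 ℕ.^ precision) ⟩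
        ℕ→ℚ b * E                                                 ≤⟨ *-monoʳ-≤ E (0≤ℕ→ℚ (2 ℕ.^ precision)) b≤ ⟩
        half^ precision * ℕ→ℚ n * p * E                           ≡⟨ eq (half^ precision) (ℕ→ℚ n) p E ⟩
        half^ precision * E * (ℕ→ℚ n * p)                         ≡⟨ trans (cong (_* (ℕ→ℚ n * p)) (half^-inverse precision)) (*-identityˡ _) ⟩
        ℕ→ℚ n * p                                                 ≤⟨ *-monoˡ-≤ (ℕ→ℚ n) (0≤ℕ→ℚ n) p≤c ⟩
        ℕ→ℚ n * ℕ→ℚ c                                             ≡⟨ ℕ→ℚ-* n c ⟨
        ℕ→ℚ (n ℕ.* c)                                             ∎)
        where
        open ≤-Reasoning
        E = ℕ→ℚ (2 ℕ.^ precision)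
        eq : ∀ h n p e → h * n * p * e ≡ h * e * (n * p)
        eq = solve-∀ ring
      below-s : ∀ {x} → 2 ℕ.^ x ℕ.≤ n → x ℕ.≤ s
      below-s {x} h = ℕ.s≤s⁻¹ (2^-cancel-< x (suc s) (ℕ.≤-<-trans h n<2^1+s))
      eliminate : 1 ℕ.≤ b → ∀ m x → m ℕ.≤ suc x → m ℕ.* 2 ℕ.^ (m ℕ./ 8) ℕ.≤ 2 ℕ.^ x → tower r x ℕ.≤ s →
                  b ℕ.* 2 ℕ.^ precision ℕ.≤ m ℕ.* 2 ℕ.^ (s ℕ.+ 2) → ⊥
      eliminate 1≤b m x m≤1+x m≤ tower≤s size≤ =
        refute-coded (2 ℕ.^ s) (n ℕ.∸ 2 ℕ.^ s) (sym (ℕ.m+[n∸m]≡n 2^s≤n)) (ℕ.m^n>0 2 s)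
          (feasible r b m x s 1≤b m≤1+x m≤ tower≤s size≤) π error≤ short
      by-size : ∀ b′ → b ≡ b′ → ⊥
      by-size zero     refl = refute-silent n 0 (sym (ℕ.+-identityʳ n)) 1≤n 4*rounds≤n π error≤ short
      by-size (suc b′) refl with 1ℚ ≤? p
      -- m is the integer part of p and at least 1, so p < m + 1 ≤ 2m.
      ... | yes 1≤p = eliminate (ℕ.s≤s ℕ.z≤n) m m (ℕ.n≤1+n m) m≤2^m tower≤s (begin
        b ℕ.* 2 ℕ.^ precision             ≤⟨ size (suc m) (<⇒≤ p<1+m) ⟩
        n ℕ.* suc m                       ≤⟨ ℕ.*-mono-≤ (ℕ.<⇒≤ n<2^1+s) (ℕ.+-monoˡ-≤ m 1≤m) ⟩
        2 ℕ.^ suc s ℕ.* (m ℕ.+ m)         ≡⟨ double (2 ℕ.^ s) m ⟩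
        m ℕ.* (2 ℕ.^ s ℕ.* 2 ℕ.^ 2)       ≡⟨ cong (m ℕ.*_) (ℕ.^-distribˡ-+-* 2 s 2) ⟨
        m ℕ.* 2 ℕ.^ (s ℕ.+ 2)             ∎)
        where
        open ℕ.≤-Reasoning
        m = proj₁ (integer-part p (≤-trans 0≤1 1≤p))
        m≤p = proj₁ (proj₂ (integer-part p (≤-trans 0≤1 1≤p)))
        p<1+m = proj₂ (proj₂ (integer-part p (≤-trans 0≤1 1≤p)))
        1≤m : 1 ℕ.≤ m
        1≤m = ℕ.s≤s⁻¹ (ℕ→ℚ-cancel-< {1} (≤-<-trans 1≤p p<1+m))
        tower≤s : tower r m ℕ.≤ s
        tower≤s = below-s (subst (ℕ._≤ n) (tower-suc r m) (log-tower (suc r) m n p∈ m≤p))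
        m≤2^m : m ℕ.* 2 ℕ.^ (m ℕ./ 8) ℕ.≤ 2 ℕ.^ m
        m≤2^m = begin
          m ℕ.* 2 ℕ.^ (m ℕ./ 8)                         ≤⟨ ℕ.*-monoˡ-≤ (2 ℕ.^ (m ℕ./ 8)) (n≤2^[n∸n/8] m) ⟩
          2 ℕ.^ (m ℕ.∸ m ℕ./ 8) ℕ.* 2 ℕ.^ (m ℕ./ 8)     ≡⟨ ℕ.^-distribˡ-+-* 2 (m ℕ.∸ m ℕ./ 8) (m ℕ./ 8) ⟨
          2 ℕ.^ (m ℕ.∸ m ℕ./ 8 ℕ.+ m ℕ./ 8)             ≡⟨ cong (2 ℕ.^_) (ℕ.m∸n+n≡m (ℕ.m/n≤m m 8)) ⟩
          2 ℕ.^ m                                       ∎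
        double : ∀ q m → 2 ℕ.* q ℕ.* (m ℕ.+ m) ≡ m ℕ.* (q ℕ.* 4)
        double = ℕ-solve-∀
      -- An integer part of 0 would give no bound on b, so m = 1 is taken, while the tower starts at
      -- x = 0; hence the hypothesis m ≤ x + 1 in `feasible`. The tower bound now comes from log*
      -- instead of p.
      ... | no  1≰p = eliminate (ℕ.s≤s ℕ.z≤n) 1 0 ℕ.≤-refl ℕ.≤-refl (tower≤s r refl) (begin
        b ℕ.* 2 ℕ.^ precision             ≤⟨ size 1 (<⇒≤ (≰⇒> 1≰p)) ⟩
        n ℕ.* 1                           ≡⟨ ℕ.*-comm n 1 ⟩
        1 ℕ.* n                           ≤⟨ ℕ.*-monoʳ-≤ 1 (ℕ.≤-trans (ℕ.<⇒≤ n<2^1+s) (ℕ.^-monoʳ-≤ 2 1+s≤s+2)) ⟩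
        1 ℕ.* 2 ℕ.^ (s ℕ.+ 2)             ∎)
        where
        open ℕ.≤-Reasoning
        1+s≤s+2 : suc s ℕ.≤ s ℕ.+ 2
        1+s≤s+2 = ℕ.≤-trans (ℕ.n≤1+n (suc s)) (ℕ.≤-reflexive (ℕ.+-comm 2 s))
        tower≤s : ∀ r′ → r ≡ r′ → tower r′ 0 ℕ.≤ s
        tower≤s zero     _  = ℕ.z≤n
        tower≤s (suc r′) eq = below-s (begin
          2 ℕ.^ tower r′ 1      ≡⟨ tower-suc r′ 1 ⟨
          tower r′ 2            ≤⟨ tower-mono r′ (ℕ.n≤1+n 2) ⟩
          tower r′ 3            ≤⟨ tower-3 r′ eq ⟩
          n                     ∎)

open import Data.Integer.Base using (+_)
open import Data.Nat.Base using (_≤_; s≤s)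
open import Data.Rational.Base using (ℚ; 0ℚ; _<_; _*_; _/_)
open import Data.Rational.Properties using (_<?_; ≮⇒≥)
open import Relation.Nullary.Decidable using (decidable-stable)
open RationalOrder using (half^; 0<half^)
open Numerics using (precision)
open LowerBound using (impossible)

theorem4 : ∃ λ (δ : ℚ) → 0ℚ < δ ×
    (∀ (n r ℓ : ℕ) → 2 ≤ n → IsLog* (fromℕ n) ℓ → 1 ≤ r → r ≤ ℓ →
    (π : ProbProtocol n r) → ErrorAtMost π (+ 1 / 3) →
    (b : ℕ) → MessageSizeAtMost π b →
    (δ * ℕ→ℚ n) • log^ r (fromℕ n) ≤ᶜ fromℕ b)
theorem4 = half^ precision , 0<half^ precision ,
  λ { n _ ℓ 2≤n log* (s≤s _) r≤ℓ π error≤ b short {q} (p , p∈ , refl) →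
      decidable-stable (q <? ℕ→ℚ b) (λ q≮b → impossible 2≤n log* r≤ℓ π error≤ short p∈ (≮⇒≥ q≮b)) }
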